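{- For every integer $t\ge 4$, the graph $F_t$ is a connected line graph and $$[s_{(4,4,4,4,1^{t-4})}]\,X_{F_t}=-40\,(t-1)\,(t-1)!<0.$$ Consequently, the graphs $F_t$, for $t\ge 4$, form an infinite family of counterexamples to the conjecture that every claw-free graph is Schur-positive.
   Context: All graphs are finite and simple. The chromatic symmetric function of a graph $G$ is $X_G=\sum_{\kappa}\prod_{u\in V(G)}x_{\kappa(u)}$, where the sum is over all proper colorings $\kappa\colon V(G)\to\mathbb Z_{>0}$. For a partition $\lambda$, $[s_\lambda]X_G$ denotes the coefficient of the Schur function $s_\lambda$ in the Schur expansion of $X_G$; $1^{k}$ denotes $k$ parts equal to $1$. A graph is Schur-positive if all these coefficients are nonnegative. A graph is claw-free if it has no induced subgraph isomorphic to $K_{1,3}$. The line graph $L(H)$ of a (finite simple) graph $H$ has vertex set $E(H)$, two distinct edges being adjacent when they share an endpoint; a graph is a line graph if it is isomorphic to $L(H)$ for some finite simple graph $H$. The graph $H_2$ has vertex set $\{1,\dots,10\}$ and edge set $\{v_1,\dots,v_{12}\}$ with $v_1=\{1,8\}$, $v_2=\{1,9\}$, $v_3=\{2,7\}$, $v_4=\{3,6\}$, $v_5=\{3,10\}$, $v_6=\{4,5\}$, $v_7=\{4,9\}$, $v_8=\{5,9\}$, $v_9=\{6,10\}$, $v_{10}=\{7,9\}$, $v_{11}=\{7,10\}$, $v_{12}=\{8,10\}$. Set $G_2=L(H_2)$, with vertices $v_1,\dots,v_{12}$. For $t\ge4$, $F_t$ is obtained from the disjoint union of $G_2$ and a complete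 graph $K_t$ with a distinguished vertex $w\in V(K_t)$ by adding the single edge $v_3w$. -}

module Defs where

open import Data.Fin as Fin using (Fin; toℕ; splitAt; #_)
open import Data.Fin.Properties using (all?)
open import Data.Integer as ℤ using (ℤ; +_; 0ℤ)
open import Data.List using (List; []; _∷_; [_]; map; filter; length; concat; concatMap;
  foldr; allFin; upTo; lookup; cartesianProduct; cartesianProductWith)
open import Data.List.Relation.Binary.Prefix.Heterogeneous using (Prefix)
open import Data.List.Relation.Binary.Prefix.Heterogeneous.Properties using (prefix?)
open import Data.List.Relation.Unary.All as All using (All)
open import Data.List.Relation.Unary.Linked using (Linked; linked?)
open import Data.Nat as ℕ using (ℕ; suc; _+_; _≤_; _<_; _≥_)
open import Data.Nat.ListAction using (sum)
open import Data.Product using (Σ; ∃; _×_; _,_)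
open import Data.Product.Properties using (≡-dec)
open import Data.Sum using (_⊎_; inj₁; inj₂; swap)
open import Data.Vec as Vec using (Vec; []; _∷_; toList)
open import Function using (_∘_; flip)
open import Function.Bundles using (_↔_; _⇔_; Inverse)
open import Function.Definitions using (Injective)
open import Relation.Binary.Construct.Closure.ReflexiveTransitive using (Star)
open import Relation.Binary.Definitions using (Decidable; Symmetric; Irreflexive)
open import Relation.Binary.PropositionalEquality using (_≡_; _≢_; refl; sym)
open import Relation.Nullary using (Dec; ¬_; ¬?; _×-dec_; _⊎-dec_; _→-dec_)
import Data.List.Membership.DecPropositional as DecMembership
open DecMembership (≡-dec ℕ._≟_ ℕ._≟_) using (_∈_; _∈?_)

------------------------------------------------------------------------
-- Graphs

record Graph : Set₁ where
  field
    order  : ℕ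
    Adj    : Fin order → Fin order → Set
    adj?   : Decidable Adj
    adjSym : Symmetric Adj
    irrefl : Irreflexive _≡_ Adj

  Vertex : Set
  Vertex = Fin order

open Graph public using (order; Adj; adj?; Vertex)

_≅_ : Graph → Graph → Set
G ≅ H = Σ (Vertex G ↔ Vertex H) λ f →
  ∀ u v → Adj G u v ⇔ Adj H (Inverse.to f u) (Inverse.to f v)

InducedSubgraph : Graph → Graph → Set
InducedSubgraph H G = Σ (Vertex H → Vertex G) λ f →
  Injective _≡_ _≡_ f × (∀ u v → Adj H u v ⇔ Adj G (f u) (f v))

Connected : Graph → Set
Connected G = 0 < order G × (∀ u v → Star (Adj G) u v)

-- Vertex i of the graph carries the label suc (toℕ i), so the labels are 1, …, n.
label : ∀ {n} → Fin n → ℕ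
label i = suc (toℕ i)

fromEdges : ℕ → List (ℕ × ℕ) → Graph
fromEdges n es = record
  { order  = n
  ; Adj    = λ i j → i ≢ j × ((label i , label j) ∈ es ⊎ (label j , label i) ∈ es)
  ; adj?   = λ i j → ¬? (i Fin.≟ j)
                     ×-dec (((label i , label j) ∈? es) ⊎-dec ((label j , label i) ∈? es))
  ; adjSym = λ (i≢j , e) → i≢j ∘ sym , swap e
  ; irrefl = λ i≡j (i≢j , _) → i≢j i≡j
  }

complete : ℕ → Graph
complete n = record
  { order  = n
  ; Adj    = _≢_
  ; adj?   = λ i j → ¬? (i Fin.≟ j)
  ; adjSym = λ i≢j → i≢j ∘ sym
  ; irrefl = λ i≡j i≢j → i≢j i≡j
  }

claw : Graph
claw = fromEdges 4 ((1 , 2) ∷ (1 , 3) ∷ (1 , 4) ∷ [])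

ClawFree : Graph → Set
ClawFree G = ¬ InducedSubgraph claw G

-- Each edge occurs exactly once, as the pair of its endpoints in increasing
-- order; the list is in lexicographic order.
edges : (G : Graph) → List (Vertex G × Vertex G)
edges G = filter (λ (i , j) → (i Fin.<? j) ×-dec adj? G i j)
                 (cartesianProduct (allFin (order G)) (allFin (order G)))

ShareEndpoint : ∀ {n} → Fin n × Fin n → Fin n × Fin n → Set
ShareEndpoint (i , j) (k , l) = (i ≡ k ⊎ j ≡ l) ⊎ (i ≡ l ⊎ j ≡ k)

shareEndpoint? : ∀ {n} → Decidable (ShareEndpoint {n})
shareEndpoint? (i , j) (k , l) =
  ((i Fin.≟ k) ⊎-dec (j Fin.≟ l)) ⊎-dec ((i Fin.≟ l) ⊎-dec (j Fin.≟ k))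

shareEndpoint-sym : ∀ {n} → Symmetric (ShareEndpoint {n})
shareEndpoint-sym (inj₁ (inj₁ p)) = inj₁ (inj₁ (sym p))
shareEndpoint-sym (inj₁ (inj₂ p)) = inj₁ (inj₂ (sym p))
shareEndpoint-sym (inj₂ (inj₁ p)) = inj₂ (inj₂ (sym p))
shareEndpoint-sym (inj₂ (inj₂ p)) = inj₂ (inj₁ (sym p))

-- Vertex a of the line graph is the a-th entry of edges H.
lineGraph : Graph → Graph
lineGraph H = record
  { order  = length (edges H)
  ; Adj    = λ a b → a ≢ b × ShareEndpoint (lookup (edges H) a) (lookup (edges H) b)
  ; adj?   = λ a b → ¬? (a Fin.≟ b)
                     ×-dec shareEndpoint? (lookup (edges H) a) (lookup (edges H) b)
  ; adjSym = λ (a≢b , s) → a≢b ∘ sym , shareEndpoint-sym s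
  ; irrefl = λ a≡b (a≢b , _) → a≢b a≡b
  }

IsLineGraph : Graph → Set₁
IsLineGraph G = ∃ λ H → G ≅ lineGraph H

module JoinByEdge (G H : Graph) (u : Vertex G) (w : Vertex H) where

  SumAdj : Vertex G ⊎ Vertex H → Vertex G ⊎ Vertex H → Set
  SumAdj (inj₁ a) (inj₁ b) = Adj G a b
  SumAdj (inj₂ a) (inj₂ b) = Adj H a b
  SumAdj (inj₁ a) (inj₂ b) = a ≡ u × b ≡ w
  SumAdj (inj₂ b) (inj₁ a) = a ≡ u × b ≡ w

  sumAdj? : Decidable SumAdj
  sumAdj? (inj₁ a) (inj₁ b) = adj? G a b
  sumAdj? (inj₂ a) (inj₂ b) = adj? H a b
  sumAdj? (inj₁ a) (inj₂ b) = (a Fin.≟ u) ×-dec (b Fin.≟ w)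
  sumAdj? (inj₂ b) (inj₁ a) = (a Fin.≟ u) ×-dec (b Fin.≟ w)

  sumAdj-sym : ∀ x y → SumAdj x y → SumAdj y x
  sumAdj-sym (inj₁ _) (inj₁ _) e = Graph.adjSym G e
  sumAdj-sym (inj₂ _) (inj₂ _) e = Graph.adjSym H e
  sumAdj-sym (inj₁ _) (inj₂ _) e = e
  sumAdj-sym (inj₂ _) (inj₁ _) e = e

  sumAdj-irrefl : ∀ x → ¬ SumAdj x x
  sumAdj-irrefl (inj₁ _) = Graph.irrefl G refl
  sumAdj-irrefl (inj₂ _) = Graph.irrefl H refl

  graph : Graph
  graph = record
    { order  = order G + order H
    ; Adj    = λ x y → SumAdj (splitAt (order G) x) (splitAt (order G) y)
    ; adj?   = λ x y → sumAdj? (splitAt (order G) x) (splitAt (order G) y)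
    ; adjSym = λ {x} {y} → sumAdj-sym (splitAt (order G) x) (splitAt (order G) y)
    ; irrefl = λ { {x} refl → sumAdj-irrefl (splitAt (order G) x) }
    }

-- The disjoint union of G and H together with the single edge uw.
joinByEdge : (G H : Graph) → Vertex G → Vertex H → Graph
joinByEdge = JoinByEdge.graph

E₂ : List (ℕ × ℕ)
E₂ = (1 , 8) ∷ (1 , 9) ∷ (2 , 7) ∷ (3 , 6) ∷ (3 , 10) ∷ (4 , 5) ∷ (4 , 9)
   ∷ (5 , 9) ∷ (6 , 10) ∷ (7 , 9) ∷ (7 , 10) ∷ (8 , 10) ∷ []

H₂ : Graph
H₂ = fromEdges 10 E₂

G₂ : Graph
G₂ = lineGraph H₂

-- E₂ is lexicographically sorted, so the i-th vertex of G₂ is the i-th entry of E₂.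
edges-H₂ : map (λ (i , j) → label i , label j) (edges H₂) ≡ E₂
edges-H₂ = refl

v₃ : Vertex G₂
v₃ = # 2

F : (t : ℕ) → Fin t → Graph
F t w = joinByEdge G₂ (complete t) v₃ w

------------------------------------------------------------------------
-- Chromatic symmetric functions and Schur functions

-- A formal power series in x₁, x₂, … with integer coefficients:
-- f N α is the coefficient of x₁^α₁ ⋯ x_N^α_N.
PowerSeries : Set
PowerSeries = (N : ℕ) → Vec ℕ N → ℤ

multiplicity : ∀ {N} → Fin N → List (Fin N) → ℕ
multiplicity i xs = length (filter (i Fin.≟_) xs)

HasContent : ∀ {N} → Vec ℕ N → List (Fin N) → Set
HasContent α xs = ∀ i → multiplicity i xs ≡ Vec.lookup α i

hasContent? : ∀ {N} (α : Vec ℕ N) xs → Dec (HasContent α xs)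
hasContent? α xs = all? λ i → multiplicity i xs ℕ.≟ Vec.lookup α i

vectors : ∀ {A : Set} → List A → (k : ℕ) → List (Vec A k)
vectors as 0       = [ [] ]
vectors as (suc k) = cartesianProductWith _∷_ as (vectors as k)

Proper : ∀ {N} (G : Graph) → Vec (Fin N) (order G) → Set
Proper G κ = ∀ u v → Adj G u v → Vec.lookup κ u ≢ Vec.lookup κ v

proper? : ∀ {N} (G : Graph) (κ : Vec (Fin N) (order G)) → Dec (Proper G κ)
proper? G κ = all? λ u → all? λ v →
  adj? G u v →-dec ¬? (Vec.lookup κ u Fin.≟ Vec.lookup κ v)

-- A colouring with positive integers contributes the monomial x₁^α₁ ⋯ x_N^α_N
-- only if it uses no colour beyond N; the colours 1, …, N are the elements of Fin N.
chromaticSymmetricFunction : Graph → PowerSeries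
chromaticSymmetricFunction G N α =
  + length (filter (λ κ → proper? G κ ×-dec hasContent? α (toList κ))
                   (vectors (allFin N) (order G)))

-- Fillings, given row by row, of the Young diagram with row lengths lam.
fillings : (N : ℕ) → List ℕ → List (List (List (Fin N)))
fillings N []        = [ [] ]
fillings N (r ∷ lam) =
  cartesianProductWith _∷_ (map toList (vectors (allFin N) r)) (fillings N lam)

-- Rows weakly increase; every entry exceeds the one directly above it
-- (English notation).
Semistandard : ∀ {N} → List (List (Fin N)) → Set
Semistandard T = All (Linked Fin._≤_) T
               × Linked (λ upper lower → Prefix Fin._>_ lower upper) T

semistandard? : ∀ {N} (T : List (List (Fin N))) → Dec (Semistandard T)
semistandard? T = All.all? (linked? Fin._≤?_) T
  ×-dec linked? (λ upper lower → prefix? (flip Fin._<?_) lower upper) T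

-- The generating function of semistandard Young tableaux of shape lam.
schur : List ℕ → PowerSeries
schur lam N α =
  + length (filter (λ T → semistandard? T ×-dec hasContent? α (concat T)) (fillings N lam))

IsPartition : ℕ → List ℕ → Set
IsPartition n lam = (Linked _≥_ lam × All (1 ≤_) lam) × sum lam ≡ n

isPartition? : ∀ n lam → Dec (IsPartition n lam)
isPartition? n lam =
  (linked? ℕ._≥?_ lam ×-dec All.all? (1 ℕ.≤?_) lam) ×-dec (sum lam ℕ.≟ n)

-- A partition of n has at most n parts, each at most n.
partitions : (n : ℕ) → List (List ℕ)
partitions n = filter (isPartition? n)
  (concatMap (λ k → map toList (vectors (upTo (suc n)) k)) (upTo (suc n)))

-- X_G = Σ c(λ) s_λ; X_G is homogeneous of degree |V(G)|, so λ runs over the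
-- partitions of |V(G)|.
IsSchurExpansion : Graph → (List ℕ → ℤ) → Set
IsSchurExpansion G c = ∀ N α →
  chromaticSymmetricFunction G N α
    ≡ foldr ℤ._+_ 0ℤ (map (λ lam → c lam ℤ.* schur lam N α) (partitions (order G)))

-- [s_lam] X_G = k.  The Schur expansion is required to exist, so that this is
-- not vacuous, and every Schur expansion must have k as its coefficient at lam.
SchurCoefficient : Graph → List ℕ → ℤ → Set
SchurCoefficient G lam k =
  (∃ λ c → IsSchurExpansion G c) × (∀ c → IsSchurExpansion G c → c lam ≡ k)

SchurPositive : Graph → Set
SchurPositive G = ∃ λ c →
  IsSchurExpansion G c × (∀ lam → IsPartition (order G) lam → 0ℤ ℤ.≤ c lam)

{-# OPTIONS --safe #-}
module Submission where

-- The Schur expansion of a symmetric function exists and is unique because the Kostka matrix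
-- is unitriangular: removing the largest letter of a tableau again and again turns Kostka
-- numbers into counts of chains of horizontal strips, the Bender–Knuth involution shows that
-- they are symmetric in the content, and the weight Σ i λᵢ that they are triangular.
--
-- In F_t the clique K_t needs t colours and, with exactly t colours, uses each of them once.
-- Hence X_{F_t} involves only shapes with at least t rows, and in t variables
-- X_{F_t} = (t-1) (t-1)! x₁⋯x_t X_{G₂}, the factor counting the bijections K_t → {1,…,t} that
-- avoid the colour of v₃ at w.  Comparing coefficients at contents (1,…,1,γ) strips the column
-- of length t-4 from every shape and leaves [s_{(3,3,3,3)}] X_{G₂}, which the Jacobi–Trudi
-- alternating sum expresses through sixteen numbers of 4-colourings of G₂.

open import Defs
open import Data.Bool using (true; false; if_then_else_)
open import Data.Empty using (⊥)
open import Data.Fin as Fin using (Fin; zero; suc; toℕ; splitAt; inject₁; fromℕ; _↑ˡ_; _↑ʳ_; #_)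
open import Data.Fin.Permutation as Permutation using (Permutation; _⟨$⟩ʳ_; _⟨$⟩ˡ_)
import Data.Fin.Permutation.Components as Transposition
import Data.Fin.Properties as Finₚ
open import Data.Fin.Relation.Unary.Top using (view; view-fromℕ; view-inject₁; ‵fromℕ; ‵inject₁)
open import Data.Integer as ℤ using (ℤ; +_; -_; 0ℤ)
import Data.Integer.Properties as ℤₚ
import Data.Integer.Tactic.RingSolver as ℤ-Ring
open import Data.List as List using (List; []; _∷_; [_]; _++_; _∷ʳ_; map; filter; length; concat;
  concatMap; foldr; allFin; upTo; lookup; cartesianProduct; cartesianProductWith; replicate)
import Data.List.Membership.DecPropositional as DecMembership
open import Data.List.Membership.Propositional using (_∈_; _∉_)
import Data.List.Membership.Propositional.Properties as ∈ₚ
open import Data.List.Membership.Propositional.Properties.WithK using (unique∧set⇒bag)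
import Data.List.Properties as Listₚ
open import Data.List.Relation.Binary.BagAndSetEquality using (∼bag⇒↭)
import Data.List.Relation.Binary.Permutation.Homogeneous as Homogeneous
open import Data.List.Relation.Binary.Permutation.Propositional as Perm using (_↭_; ↭-sym)
import Data.List.Relation.Binary.Permutation.Propositional.Properties as Permₚ
import Data.List.Relation.Binary.Permutation.Setoid.Properties as Permₛ
open import Data.List.Relation.Binary.Prefix.Heterogeneous using (Prefix; []; _∷_)
open import Data.List.Relation.Unary.All as All using (All; []; _∷_)
import Data.List.Relation.Unary.All.Properties as Allₚ
open import Data.List.Relation.Unary.AllPairs as AllPairs using ([]; _∷_)
import Data.List.Relation.Unary.AllPairs.Properties as AllPairsₚ
open import Data.List.Relation.Unary.Any as Any using (here; there)
import Data.List.Relation.Unary.Any.Properties as Anyₚ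
open import Data.List.Relation.Unary.Linked as Linked using (Linked; []; [-]; _∷_)
import Data.List.Relation.Unary.Unique.DecPropositional as DecUnique
open import Data.List.Relation.Unary.Unique.Propositional using (Unique)
import Data.List.Relation.Unary.Unique.Propositional.Properties as Uniqueₚ
import Data.List.Sort as Sort
open import Data.Maybe using (Maybe; just; nothing)
open import Data.Nat as ℕ using (ℕ; zero; suc; _+_; _*_; _∸_; _≤_; _<_; _≥_; _⊔_; _⊓_; _!; z≤n; s≤s; z<s)
open import Data.Nat.ListAction using (sum)
import Data.Nat.ListAction.Properties as Sumₚ
import Data.Nat.Properties as ℕₚ
open import Data.Nat.Tactic.RingSolver using (solve-∀)
open import Data.Product using (∃; ∃₂; _×_; _,_; proj₁; proj₂; uncurry)
import Data.Product.Properties as Productₚ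
open import Data.Sum as Sum using (_⊎_; inj₁; inj₂; [_,_]′)
open import Data.Unit using (⊤; tt)
open import Data.Vec as Vec using (Vec; []; _∷_; toList; fromList)
import Data.Vec.Properties as Vecₚ
open import Function using (_∘_; id; const; case_of_)
open import Function.Bundles using (Equivalence; mk⇔; mk↔ₛ′)
import Relation.Binary.Construct.Flip.EqAndOrd as Flip
open import Relation.Binary.Construct.Closure.ReflexiveTransitive as Star using (Star; ε; _◅_; _◅◅_)
open import Relation.Binary.Definitions using (DecidableEquality)
open import Relation.Binary.PropositionalEquality using (_≡_; _≢_; refl; sym; trans; cong; cong₂;
  subst; subst₂; setoid; module ≡-Reasoning)
open import Relation.Nullary using (Dec; yes; no; does; ¬_; ¬?; _×-dec_; contradiction)
open import Relation.Nullary.Decidable using (dec-true; dec-false; True; toWitness; toSum;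
  decidable-stable; _⊎-dec_; _→-dec_)
open import Relation.Unary using () renaming (Decidable to Decidable₁)

-- The definitions count by listing every vector or every filling: 4^12 candidate colourings for a
-- single four-colour content of `G₂`, and nothing uniform in t. So each count is first made
-- recursive, tableaux by `kostka` and colourings of `G₂` by a pruned `search`. Contents with
-- exactly t entries isolate the shapes with t rows: longer shapes have no tableau there, shorter
-- ones have coefficient 0. With t rows and t letters only the largest letter can reach the last
-- row, and if it occurs once that row is a single box; repeating this t-4 times leaves a four-row
-- partition of 16, a finite check independent of t. The sixteen numbers come from the 24
-- permutations of δ = (3,2,1,0): the exponents 3+δᵢ-δⱼ lie between 0 and 6, sorting them leaves 16
-- classes, and within a class all signs agree. For the line graph property, vertex 2 of `H₂` lies
-- on no edge but v₃, so a star whose line graph is K_t can be hung there without creating further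
-- adjacencies.

private variable
  A B C : Set

-- Counting

count : {P : A → Set} → Decidable₁ P → List A → ℕ
count P? xs = length (filter P? xs)

lookup-injective : {xs : List A} → Unique xs → ∀ {i j} → lookup xs i ≡ lookup xs j → i ≡ j
lookup-injective (x≢ ∷ _) {zero}  {zero}  _  = refl
lookup-injective {xs = _ ∷ xs} (x≢ ∷ _) {zero}  {suc j} eq = contradiction eq (All.lookup x≢ (∈ₚ.∈-lookup j))
lookup-injective {xs = _ ∷ xs} (x≢ ∷ _) {suc i} {zero}  eq = contradiction (sym eq) (All.lookup x≢ (∈ₚ.∈-lookup i))
lookup-injective (_ ∷ u)  {suc i} {suc j} eq = cong suc (lookup-injective u eq)

-- Duplicate-free lists with the same elements are permutations of each other. Inverting on the
-- lists is enough, so `f` and `g` may take arbitrary values elsewhere.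
bijection-↭ : {xs : List A} {ys : List B} → Unique xs → Unique ys → (f : A → B) (g : B → A) →
  (∀ {x} → x ∈ xs → f x ∈ ys × g (f x) ≡ x) →
  (∀ {y} → y ∈ ys → g y ∈ xs × f (g y) ≡ y) →
  map f xs ↭ ys
bijection-↭ {xs = xs} {ys} uxs uys f g to from = ∼bag⇒↭ (unique∧set⇒bag umap uys (mk⇔ into onto))
  where
  umap : Unique (map f xs)
  umap = Uniqueₚ.map⁻ {f = g} (subst Unique (sym (trans (sym (Listₚ.map-∘ xs))
    (Listₚ.map-id-local (All.tabulate (proj₂ ∘ to))))) uxs)
  into : ∀ {y} → y ∈ map f xs → y ∈ ys
  into y∈ with _ , x∈ , refl ← ∈ₚ.∈-map⁻ f y∈ = proj₁ (to x∈)
  onto : ∀ {y} → y ∈ ys → y ∈ map f xs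
  onto y∈ = subst (_∈ map f xs) (proj₂ (from y∈)) (∈ₚ.∈-map⁺ f (proj₁ (from y∈)))

module _ {P : A → Set} {Q : B → Set} (P? : Decidable₁ P) (Q? : Decidable₁ Q) where

  count-bijection : {xs : List A} {ys : List B} → Unique xs → Unique ys →
    (f : A → B) (g : B → A) →
    (∀ {x} → x ∈ xs → P x → f x ∈ ys × Q (f x) × g (f x) ≡ x) →
    (∀ {y} → y ∈ ys → Q y → g y ∈ xs × P (g y) × f (g y) ≡ y) →
    count P? xs ≡ count Q? ys
  count-bijection {xs} {ys} uxs uys f g to from = trans (sym (Listₚ.length-map f (filter P? xs)))
    (Permₚ.↭-length (bijection-↭ (Uniqueₚ.filter⁺ P? uxs) (Uniqueₚ.filter⁺ Q? uys) f g
      (λ x∈ → let x∈xs , px = ∈ₚ.∈-filter⁻ P? {xs = xs} x∈; fx∈ , qfx , gf = to x∈xs px in ∈ₚ.∈-filter⁺ Q? fx∈ qfx , gf)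
      (λ y∈ → let y∈ys , qy = ∈ₚ.∈-filter⁻ Q? {xs = ys} y∈; gy∈ , pgy , fg = from y∈ys qy in ∈ₚ.∈-filter⁺ P? gy∈ pgy , fg)))

-- Indicators and finite sums

𝟙 : {P : Set} → Dec P → ℕ
𝟙 P? = if does P? then 1 else 0

∑ : List A → (A → ℕ) → ℕ
∑ xs f = sum (map f xs)

∑-cong : ∀ {f g : A → ℕ} xs → (∀ {x} → x ∈ xs → f x ≡ g x) → ∑ xs f ≡ ∑ xs g
∑-cong []       _   = refl
∑-cong (x ∷ xs) f≡g = cong₂ _+_ (f≡g (here refl)) (∑-cong xs (f≡g ∘ there))

∑-zero : ∀ (xs : List A) → ∑ xs (const 0) ≡ 0
∑-zero []       = refl
∑-zero (x ∷ xs) = ∑-zero xs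

∑-const : ∀ (xs : List A) k → ∑ xs (const k) ≡ length xs * k
∑-const []       k = refl
∑-const (x ∷ xs) k = cong (k ℕ.+_) (∑-const xs k)

∑-++ : ∀ (f : A → ℕ) xs ys → ∑ (xs ++ ys) f ≡ ∑ xs f + ∑ ys f
∑-++ f xs ys = trans (cong sum (Listₚ.map-++ f xs ys)) (Sumₚ.sum-++ (map f xs) (map f ys))

∑-map : ∀ (f : B → ℕ) (g : A → B) xs → ∑ (map g xs) f ≡ ∑ xs (f ∘ g)
∑-map f g xs = cong sum (sym (Listₚ.map-∘ xs))

∑-+ : ∀ (f g : A → ℕ) xs → ∑ xs (λ x → f x + g x) ≡ ∑ xs f + ∑ xs g
∑-+ f g []       = refl
∑-+ f g (x ∷ xs) = begin
  (f x + g x) + ∑ xs (λ x → f x + g x)  ≡⟨ cong ((f x + g x) ℕ.+_) (∑-+ f g xs) ⟩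
  (f x + g x) + (∑ xs f + ∑ xs g)       ≡⟨ regroup (f x) (g x) (∑ xs f) (∑ xs g) ⟩
  (f x + ∑ xs f) + (g x + ∑ xs g)       ∎
  where
  open ≡-Reasoning
  regroup : ∀ a b c d → (a + b) + (c + d) ≡ (a + c) + (b + d)
  regroup = solve-∀

∑-swap : ∀ (f : A → B → ℕ) xs ys → ∑ xs (λ x → ∑ ys (f x)) ≡ ∑ ys (λ y → ∑ xs (λ x → f x y))
∑-swap f []       ys = sym (∑-zero ys)
∑-swap f (x ∷ xs) ys = trans (cong (∑ ys (f x) ℕ.+_) (∑-swap f xs ys)) (sym (∑-+ (f x) _ ys))

∑-cartesianProductWith : ∀ (f : C → ℕ) (g : A → B → C) xs ys →
  ∑ (cartesianProductWith g xs ys) f ≡ ∑ xs (λ x → ∑ ys (λ y → f (g x y)))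
∑-cartesianProductWith f g []       ys = refl
∑-cartesianProductWith f g (x ∷ xs) ys = trans (∑-++ f (map (g x) ys) _)
  (cong₂ _+_ (∑-map f (g x) ys) (∑-cartesianProductWith f g xs ys))

∑-↭ : ∀ (f : A → ℕ) {xs ys} → xs ↭ ys → ∑ xs f ≡ ∑ ys f
∑-↭ f p = Sumₚ.sum-↭ (Permₚ.map⁺ f p)

∑-single : ∀ (f : A → ℕ) {x xs} → Unique xs → x ∈ xs →
  (∀ {y} → y ∈ xs → y ≢ x → f y ≡ 0) → ∑ xs f ≡ f x
∑-single f {xs = _ ∷ xs} (x≢ ∷ _) (here refl) h = trans
  (cong (f _ ℕ.+_) (trans (∑-cong xs (λ y∈ → h (there y∈) (All.lookup x≢ y∈ ∘ sym))) (∑-zero xs)))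
  (ℕₚ.+-identityʳ _)
∑-single f {xs = _ ∷ xs} (y≢ ∷ u) (there x∈) h = trans
  (cong (_+ ∑ xs f) (h (here refl) (All.lookup y≢ x∈)))
  (∑-single f u x∈ (h ∘ there))

∑≢0 : ∀ (f : A → ℕ) xs → ∑ xs f ≢ 0 → ∃ λ x → x ∈ xs × f x ≢ 0
∑≢0 f []       ne = contradiction refl ne
∑≢0 f (x ∷ xs) ne with f x ℕ.≟ 0
... | no fx≢0  = x , here refl , fx≢0
... | yes fx≡0 = let y , y∈ , fy≢0 = ∑≢0 f xs (λ eq → ne (cong₂ _+_ fx≡0 eq)) in y , there y∈ , fy≢0

𝟙-yes : {P : Set} (P? : Dec P) → P → 𝟙 P? ≡ 1
𝟙-yes P? p rewrite dec-true P? p = refl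

𝟙-no : {P : Set} (P? : Dec P) → ¬ P → 𝟙 P? ≡ 0
𝟙-no P? ¬p rewrite dec-false P? ¬p = refl

𝟙-⇔ : {P Q : Set} (P? : Dec P) (Q? : Dec Q) → (P → Q) → (Q → P) → 𝟙 P? ≡ 𝟙 Q?
𝟙-⇔ (yes p) Q? f g = sym (𝟙-yes Q? (f p))
𝟙-⇔ (no ¬p) Q? f g = sym (𝟙-no Q? (¬p ∘ g))

𝟙-× : {P Q : Set} (P? : Dec P) (Q? : Dec Q) → 𝟙 (P? ×-dec Q?) ≡ 𝟙 P? * 𝟙 Q?
𝟙-× (yes _) (yes _) = refl
𝟙-× (yes _) (no _)  = refl
𝟙-× (no _)  _       = refl

∑-*ʳ : ∀ (f : A → ℕ) k xs → ∑ xs (λ x → f x * k) ≡ ∑ xs f * k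
∑-*ʳ f k []       = refl
∑-*ʳ f k (x ∷ xs) = trans (cong (f x * k ℕ.+_) (∑-*ʳ f k xs)) (sym (ℕₚ.*-distribʳ-+ k (f x) (∑ xs f)))

∑-*ˡ : ∀ (f : A → ℕ) k xs → ∑ xs (λ x → k * f x) ≡ k * ∑ xs f
∑-*ˡ f k xs = trans (∑-cong xs (λ {x} _ → ℕₚ.*-comm k (f x))) (trans (∑-*ʳ f k xs) (ℕₚ.*-comm _ k))

count-∑ : {P : A → Set} (P? : Decidable₁ P) → ∀ xs → count P? xs ≡ ∑ xs (𝟙 ∘ P?)
count-∑ P? []       = refl
count-∑ P? (x ∷ xs) with does (P? x)
... | true  = cong suc (count-∑ P? xs)
... | false = count-∑ P? xs

module _ {P : A → Set} (P? : Decidable₁ P) where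

  ∑-filter : ∀ (f : A → ℕ) xs → ∑ (filter P? xs) f ≡ ∑ xs (λ x → 𝟙 (P? x) * f x)
  ∑-filter f []       = refl
  ∑-filter f (x ∷ xs) with does (P? x)
  ... | true  = cong₂ _+_ (sym (ℕₚ.+-identityʳ (f x))) (∑-filter f xs)
  ... | false = ∑-filter f xs

  count-none : ∀ xs → (∀ {x} → x ∈ xs → ¬ P x) → count P? xs ≡ 0
  count-none xs h = cong length (Listₚ.filter-none P? (All.tabulate h))

  count≢0 : ∀ xs → count P? xs ≢ 0 → ∃ λ x → x ∈ xs × P x
  count≢0 xs ne with filter P? xs in eq
  ... | []    = contradiction refl ne
  ... | y ∷ _ = y , ∈ₚ.∈-filter⁻ P? (subst (y ∈_) (sym eq) (here refl))

  -- Double counting: each counted `x` lies over exactly one entry of `ys`, its key.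
  count-fibres : (_≟_ : DecidableEquality B) (key : A → B) {ys : List B} → Unique ys → ∀ xs →
    (∀ {x} → x ∈ xs → P x → key x ∈ ys) →
    count P? xs ≡ ∑ ys (λ y → count (λ x → P? x ×-dec (key x ≟ y)) xs)
  count-fibres _≟_ key {ys} u xs key∈ = sym (begin
    ∑ ys (λ y → count (λ x → P? x ×-dec (key x ≟ y)) xs)
      ≡⟨ ∑-cong ys (λ {y} _ → count-∑ (λ x → P? x ×-dec (key x ≟ y)) xs) ⟩
    ∑ ys (λ y → ∑ xs (λ x → 𝟙 (P? x ×-dec (key x ≟ y))))
      ≡⟨ ∑-swap (λ y x → 𝟙 (P? x ×-dec (key x ≟ y))) ys xs ⟩
    ∑ xs (λ x → ∑ ys (λ y → 𝟙 (P? x ×-dec (key x ≟ y))))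
      ≡⟨ ∑-cong xs fibre ⟩
    ∑ xs (𝟙 ∘ P?)
      ≡⟨ count-∑ P? xs ⟨
    count P? xs ∎)
    where
    open ≡-Reasoning
    fibre : ∀ {x} → x ∈ xs → ∑ ys (λ y → 𝟙 (P? x ×-dec (key x ≟ y))) ≡ 𝟙 (P? x)
    fibre {x} x∈ with P? x
    ... | no _  = trans (∑-cong ys (λ _ → refl)) (∑-zero ys)
    ... | yes p = trans
      (∑-single _ u (key∈ x∈ p) (λ {y} _ y≢ → 𝟙-no (yes p ×-dec (key x ≟ y)) (λ (_ , eq) → y≢ (sym eq))))
      (𝟙-yes (yes p ×-dec (key x ≟ key x)) (p , refl))

-- Kostka numbers

head₀ : List ℕ → ℕ
head₀ []      = 0
head₀ (x ∷ _) = x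

interval : ℕ → ℕ → List ℕ
interval l u = filter (l ℕ.≤?_) (upTo (suc u))

-- The shapes μ, padded to as many rows as lam, such that lam/μ is a horizontal strip.
strips : List ℕ → List (List ℕ)
strips []        = [ [] ]
strips (x ∷ lam) = cartesianProductWith _∷_ (interval (head₀ lam) x) (strips lam)

layer : ℕ → List ℕ → List (List ℕ)
layer a lam = filter (λ μ → sum μ + a ℕ.≟ sum lam) (strips lam)

-- The content is listed from the largest letter down.
kostka : List ℕ → List ℕ → ℕ
kostka lam []      = 𝟙 (sum lam ℕ.≟ 0)
kostka lam (a ∷ α) = ∑ (layer a lam) (λ μ → kostka μ α)

-- Interlacing lam₁ ≥ μ₁ ≥ lam₂ ≥ μ₂ ≥ ..., with 0 past the end. The bounds on `μ` come from `lam`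
-- alone, so its parts vary independently; a strip exists only if `lam` is weakly decreasing.
data Strip : List ℕ → List ℕ → Set where
  []  : Strip [] []
  _∷_ : ∀ {m μ x lam} → head₀ lam ≤ m × m ≤ x → Strip μ lam → Strip (m ∷ μ) (x ∷ lam)

∈-interval⁺ : ∀ {l u m} → l ≤ m → m ≤ u → m ∈ interval l u
∈-interval⁺ {l} l≤m m≤u = ∈ₚ.∈-filter⁺ (l ℕ.≤?_) (∈ₚ.∈-upTo⁺ (s≤s m≤u)) l≤m

∈-interval⁻ : ∀ {l u m} → m ∈ interval l u → l ≤ m × m ≤ u
∈-interval⁻ {l} {u} m∈ = let m∈′ , l≤m = ∈ₚ.∈-filter⁻ (l ℕ.≤?_) {xs = upTo (suc u)} m∈
                         in l≤m , ℕₚ.≤-pred (∈ₚ.∈-upTo⁻ m∈′)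

∈-strips⁺ : ∀ {μ lam} → Strip μ lam → μ ∈ strips lam
∈-strips⁺ []              = here refl
∈-strips⁺ ((l≤ , ≤u) ∷ s) = ∈ₚ.∈-cartesianProductWith⁺ _∷_ (∈-interval⁺ l≤ ≤u) (∈-strips⁺ s)

∈-strips⁻ : ∀ {μ} lam → μ ∈ strips lam → Strip μ lam
∈-strips⁻ []        (here refl) = []
∈-strips⁻ (x ∷ lam) μ∈
  with _ , _ , m∈ , μ∈′ , refl ← ∈ₚ.∈-cartesianProductWith⁻ _∷_ (interval (head₀ lam) x) (strips lam) μ∈
  = ∈-interval⁻ {head₀ lam} {x} m∈ ∷ ∈-strips⁻ lam μ∈′

∈-layer⁺ : ∀ {a μ lam} → Strip μ lam → sum μ + a ≡ sum lam → μ ∈ layer a lam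
∈-layer⁺ s eq = ∈ₚ.∈-filter⁺ _ (∈-strips⁺ s) eq

∈-layer⁻ : ∀ {a μ} lam → μ ∈ layer a lam → Strip μ lam × sum μ + a ≡ sum lam
∈-layer⁻ lam μ∈ = let μ∈′ , eq = ∈ₚ.∈-filter⁻ _ {xs = strips lam} μ∈ in ∈-strips⁻ lam μ∈′ , eq

unique-strips : ∀ lam → Unique (strips lam)
unique-strips []        = [] ∷ []
unique-strips (x ∷ lam) = Uniqueₚ.cartesianProductWith⁺ _∷_ Listₚ.∷-injective
  (Uniqueₚ.filter⁺ (head₀ lam ℕ.≤?_) (Uniqueₚ.upTo⁺ (suc x))) (unique-strips lam)

unique-layer : ∀ a lam → Unique (layer a lam)
unique-layer a lam = Uniqueₚ.filter⁺ _ (unique-strips lam)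

-- Chain p lam ν μ: both lam/ν and ν/μ are horizontal strips and ν₁ ≤ p.  The constraints on
-- ν given lam and μ are separate interval constraints on its parts.
data Chain : ℕ → List ℕ → List ℕ → List ℕ → Set where
  []  : ∀ {p} → Chain p [] [] []
  _∷_ : ∀ {p x n m lam ν μ} → head₀ lam ⊔ m ≤ n × n ≤ x ⊓ p → Chain m lam ν μ →
        Chain p (x ∷ lam) (n ∷ ν) (m ∷ μ)

chain⁺ : ∀ {p lam ν μ} → Strip ν lam → Strip μ ν → head₀ ν ≤ p → Chain p lam ν μ
chain⁺ []               []               _   = []
chain⁺ ((l≤n , n≤x) ∷ s) ((h≤m , m≤n) ∷ s′) n≤p = (ℕₚ.⊔-lub l≤n m≤n , ℕₚ.⊓-glb n≤x n≤p) ∷ chain⁺ s s′ h≤m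

chain⁻ : ∀ {p lam ν μ} → Chain p lam ν μ → Strip ν lam × Strip μ ν × head₀ ν ≤ p
chain⁻ [] = [] , [] , z≤n
chain⁻ {p} ((l≤n , n≤u) ∷ c) = let s , s′ , h≤m = chain⁻ c in
  (ℕₚ.≤-trans (ℕₚ.m≤m⊔n _ _) l≤n , ℕₚ.≤-trans n≤u (ℕₚ.m⊓n≤m _ p)) ∷ s ,
  (h≤m , ℕₚ.≤-trans (ℕₚ.m≤n⊔m _ _) l≤n) ∷ s′ ,
  ℕₚ.≤-trans n≤u (ℕₚ.m⊓n≤n _ p)

-- The Bender–Knuth involution, in Gelfand–Tsetlin form: each part of ν is reflected in its interval.
reflect : ℕ → List ℕ → List ℕ → List ℕ → List ℕ
reflect p (x ∷ lam) (n ∷ ν) (m ∷ μ) = ((head₀ lam ⊔ m) + (x ⊓ p) ∸ n) ∷ reflect m lam ν μ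
reflect _ _         _       _       = []

-- The interval of each part of `ν` is determined by `lam`, `μ` and `p`, none of which is moved.
chain-reflect : ∀ {p lam ν μ} → Chain p lam ν μ → Chain p lam (reflect p lam ν μ) μ
chain-reflect [] = []
chain-reflect {p} {x ∷ lam} {n ∷ _} {m ∷ _} ((l≤n , n≤u) ∷ c) = (lower , upper) ∷ chain-reflect c
  where
  l u : ℕ
  l = head₀ lam ⊔ m
  u = x ⊓ p
  lower : l ≤ l + u ∸ n
  lower = subst (_≤ l + u ∸ n) (ℕₚ.m+n∸n≡m l u) (ℕₚ.∸-monoʳ-≤ (l + u) n≤u)
  upper : l + u ∸ n ≤ u
  upper = subst (l + u ∸ n ≤_) (ℕₚ.m+n∸m≡n l u) (ℕₚ.∸-monoʳ-≤ (l + u) l≤n)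

reflect-involutive : ∀ {p lam ν μ} → Chain p lam ν μ → reflect p lam (reflect p lam ν μ) μ ≡ ν
reflect-involutive [] = refl
reflect-involutive {p} {x ∷ lam} {n ∷ _} {m ∷ _} ((_ , n≤u) ∷ c) = cong₂ _∷_
  (ℕₚ.m∸[m∸n]≡n (ℕₚ.≤-trans n≤u (ℕₚ.m≤n+m (x ⊓ p) (head₀ lam ⊔ m)))) (reflect-involutive c)

⊔+⊓ : ∀ m n → (m ⊔ n) + (m ⊓ n) ≡ m + n
⊔+⊓ m n with ℕₚ.≤-total m n
... | inj₁ m≤n rewrite ℕₚ.m≤n⇒m⊔n≡n m≤n | ℕₚ.m≤n⇒m⊓n≡m m≤n = ℕₚ.+-comm n m
... | inj₂ n≤m rewrite ℕₚ.m≥n⇒m⊔n≡m n≤m | ℕₚ.m≥n⇒m⊓n≡n n≤m = refl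

-- A part and its reflection add up to the two ends of their interval. The lower end max(lamᵢ₊₁, μᵢ)
-- pairs with the next upper end min(lamᵢ₊₁, μᵢ), and max + min = sum, so the total telescopes.
-- `head₀ lam` stands on the left to avoid subtraction.
sum-reflect : ∀ {p lam ν μ} → Chain p lam ν μ →
  sum ν + sum (reflect p lam ν μ) + head₀ lam ≡ (head₀ lam ⊓ p) + sum lam + sum μ
sum-reflect [] = refl
sum-reflect {p} {x ∷ lam} {n ∷ ν} {m ∷ μ} ((_ , n≤u) ∷ c) = ℕₚ.+-cancelʳ-≡ h _ _ (begin
  (n + sum ν) + (n* + r) + x + h   ≡⟨ eq₁ n (sum ν) n* r x h ⟩
  (n + n*) + (sum ν + r + h) + x   ≡⟨ cong₂ (λ a b → a + b + x) (ℕₚ.m+[n∸m]≡n n≤lu) (sum-reflect c) ⟩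
  ((h ⊔ m) + u) + ((h ⊓ m) + sum lam + sum μ) + x
    ≡⟨ eq₂ (h ⊔ m) (h ⊓ m) u (sum lam) (sum μ) x ⟩
  ((h ⊔ m) + (h ⊓ m)) + (u + (x + sum lam) + sum μ)
    ≡⟨ cong (ℕ._+ (u + (x + sum lam) + sum μ)) (⊔+⊓ h m) ⟩
  (h + m) + (u + (x + sum lam) + sum μ)  ≡⟨ eq₃ h m u (x + sum lam) (sum μ) ⟩
  u + (x + sum lam) + (m + sum μ) + h ∎)
  where
  open ≡-Reasoning
  h u n* r : ℕ
  h = head₀ lam
  u = x ⊓ p
  n* = (h ⊔ m) + u ∸ n
  r = sum (reflect m lam ν μ)
  n≤lu : n ≤ (h ⊔ m) + u
  n≤lu = ℕₚ.≤-trans n≤u (ℕₚ.m≤n+m u (h ⊔ m))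
  eq₁ : ∀ a b c d e f → (a + b) + (c + d) + e + f ≡ (a + c) + (b + d + f) + e
  eq₁ = solve-∀
  eq₂ : ∀ a b u s t x → (a + u) + (b + s + t) + x ≡ (a + b) + (u + (x + s) + t)
  eq₂ = solve-∀
  eq₃ : ∀ h m u s t → (h + m) + (u + s + t) ≡ u + s + (m + t) + h
  eq₃ = solve-∀

-- Symmetry of Kostka numbers in the content

∑-bijection : {xs : List A} {ys : List B} → Unique xs → Unique ys → (f : A → B) (g : B → A) →
  (∀ {x} → x ∈ xs → f x ∈ ys × g (f x) ≡ x) →
  (∀ {y} → y ∈ ys → g y ∈ xs × f (g y) ≡ y) →
  (h : B → ℕ) → ∑ xs (h ∘ f) ≡ ∑ ys h
∑-bijection {xs = xs} uxs uys f g to from h = trans (sym (∑-map h f xs))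
  (∑-↭ h (bijection-↭ uxs uys f g to from))

-- Turns a nested sum, whose inner range depends on the outer index, into a sum over one
-- duplicate-free list, to which `∑-bijection` applies.
dependentPairs : (A → List B) → List A → List (A × B)
dependentPairs f []       = []
dependentPairs f (x ∷ xs) = map (x ,_) (f x) ++ dependentPairs f xs

∈-dependentPairs⁺ : ∀ {f : A → List B} {x y xs} → x ∈ xs → y ∈ f x → (x , y) ∈ dependentPairs f xs
∈-dependentPairs⁺ {f = f} (here refl) y∈ = ∈ₚ.∈-++⁺ˡ (∈ₚ.∈-map⁺ _ y∈)
∈-dependentPairs⁺ {f = f} {xs = x′ ∷ _} (there x∈) y∈ =
  ∈ₚ.∈-++⁺ʳ (map (x′ ,_) (f x′)) (∈-dependentPairs⁺ {f = f} x∈ y∈)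

∈-dependentPairs⁻ : ∀ {f : A → List B} {x y} xs → (x , y) ∈ dependentPairs f xs → x ∈ xs × y ∈ f x
∈-dependentPairs⁻ {f = f} (x′ ∷ xs) p with ∈ₚ.∈-++⁻ (map (x′ ,_) (f x′)) p
... | inj₁ q with _ , y∈ , refl ← ∈ₚ.∈-map⁻ _ q = here refl , y∈
... | inj₂ q = let x∈ , y∈ = ∈-dependentPairs⁻ xs q in there x∈ , y∈

unique-dependentPairs : ∀ {f : A → List B} → (∀ x → Unique (f x)) → ∀ {xs} → Unique xs → Unique (dependentPairs f xs)
unique-dependentPairs uf []                  = []
unique-dependentPairs uf {x ∷ xs} (x≢ ∷ uxs) = Uniqueₚ.++⁺
  (Uniqueₚ.map⁺ (λ { refl → refl }) (uf x)) (unique-dependentPairs uf uxs)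
  (λ (p , q) → case ∈ₚ.∈-map⁻ _ p of λ { (_ , _ , refl) → All.lookup x≢ (proj₁ (∈-dependentPairs⁻ xs q)) refl })

∑-dependentPairs : ∀ (f : A → List B) (h : A → B → ℕ) xs →
  ∑ (dependentPairs f xs) (uncurry h) ≡ ∑ xs (λ x → ∑ (f x) (h x))
∑-dependentPairs f h []       = refl
∑-dependentPairs f h (x ∷ xs) = trans (∑-++ (uncurry h) (map (x ,_) (f x)) _)
  (cong₂ _+_ (∑-map (uncurry h) (x ,_) (f x)) (∑-dependentPairs f h xs))

strip-head : ∀ {μ lam} → Strip μ lam → head₀ μ ≤ head₀ lam
strip-head []            = z≤n
strip-head ((_ , ≤x) ∷ _) = ≤x

chains : ℕ → ℕ → List ℕ → List (List ℕ × List ℕ)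
chains a b lam = dependentPairs (layer b) (layer a lam)

reflectMiddle : List ℕ → List ℕ × List ℕ → List ℕ × List ℕ
reflectMiddle lam (ν , μ) = reflect (head₀ lam) lam ν μ , μ

-- For `p` = `head₀ lam` the bound on the first part is vacuous and `sum-reflect` becomes sum ν +
-- sum ν* = sum lam + sum μ, which exchanges the sizes of lam/ν and ν/μ.
reflectMiddle-chains : ∀ a b lam {p} → p ∈ chains a b lam →
  reflectMiddle lam p ∈ chains b a lam × reflectMiddle lam (reflectMiddle lam p) ≡ p
reflectMiddle-chains a b lam {ν , μ} p∈ =
  let ν∈ , μ∈  = ∈-dependentPairs⁻ (layer a lam) p∈
      s  , eq  = ∈-layer⁻ lam ν∈
      s′ , eq′ = ∈-layer⁻ ν μ∈
      c        = chain⁺ s s′ (strip-head s)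
      t , t′ , _ = chain⁻ (chain-reflect c)
      total    = ℕₚ.+-cancelʳ-≡ h _ _ (trans (sum-reflect c)
        (trans (cong (λ z → z + sum lam + sum μ) (ℕₚ.⊓-idem h)) (rotate h (sum lam) (sum μ))))
  in ∈-dependentPairs⁺ {f = layer a} (∈-layer⁺ t (outer eq eq′ total)) (∈-layer⁺ t′ (inner eq total)) ,
     cong (_, μ) (reflect-involutive c)
  where
  h = head₀ lam
  ν* = reflect h lam ν μ
  rotate : ∀ h s t → h + s + t ≡ s + t + h
  rotate = solve-∀
  inner : sum ν + a ≡ sum lam → sum ν + sum ν* ≡ sum lam + sum μ → sum μ + a ≡ sum ν*
  inner eq total = ℕₚ.+-cancelˡ-≡ (sum ν) _ _ (begin
    sum ν + (sum μ + a)  ≡⟨ lemma (sum ν) (sum μ) a ⟩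
    (sum ν + a) + sum μ  ≡⟨ cong (ℕ._+ sum μ) eq ⟩
    sum lam + sum μ      ≡⟨ total ⟨
    sum ν + sum ν*       ∎)
    where
    open ≡-Reasoning
    lemma : ∀ n m a → n + (m + a) ≡ (n + a) + m
    lemma = solve-∀
  outer : sum ν + a ≡ sum lam → sum μ + b ≡ sum ν → sum ν + sum ν* ≡ sum lam + sum μ → sum ν* + b ≡ sum lam
  outer eq eq′ total = ℕₚ.+-cancelˡ-≡ (sum μ) _ _ (begin
    sum μ + (sum ν* + b)  ≡⟨ lemma (sum μ) (sum ν*) b ⟩
    (sum μ + b) + sum ν*  ≡⟨ cong (ℕ._+ sum ν*) eq′ ⟩
    sum ν + sum ν*        ≡⟨ total ⟩
    sum lam + sum μ       ≡⟨ ℕₚ.+-comm (sum lam) (sum μ) ⟩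
    sum μ + sum lam       ∎)
    where
    open ≡-Reasoning
    lemma : ∀ n m a → n + (m + a) ≡ (n + a) + m
    lemma = solve-∀

kostka-swap : ∀ lam a b α → kostka lam (a ∷ b ∷ α) ≡ kostka lam (b ∷ a ∷ α)
kostka-swap lam a b α = begin
  ∑ (layer a lam) (λ ν → ∑ (layer b ν) f)  ≡⟨ ∑-dependentPairs (layer b) (λ _ → f) (layer a lam) ⟨
  ∑ (chains a b lam) (f ∘ proj₂)           ≡⟨ ∑-bijection (unique a b) (unique b a) (reflectMiddle lam) (reflectMiddle lam)
                                               (reflectMiddle-chains a b lam) (reflectMiddle-chains b a lam) (f ∘ proj₂) ⟩
  ∑ (chains b a lam) (f ∘ proj₂)           ≡⟨ ∑-dependentPairs (layer a) (λ _ → f) (layer b lam) ⟩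
  ∑ (layer b lam) (λ ν → ∑ (layer a ν) f)  ∎
  where
  open ≡-Reasoning
  f : List ℕ → ℕ
  f μ = kostka μ α
  unique : ∀ a b → Unique (chains a b lam)
  unique a b = unique-dependentPairs (unique-layer b) (unique-layer a lam)

kostka-↭ : ∀ {α β} → α ↭ β → ∀ lam → kostka lam α ≡ kostka lam β
kostka-↭ Perm.refl           lam = refl
kostka-↭ (Perm.prep x p)     lam = ∑-cong (layer x lam) (λ {μ} _ → kostka-↭ p μ)
kostka-↭ {x ∷ y ∷ α} (Perm.swap x y p) lam = trans (kostka-swap lam x y α)
  (∑-cong (layer y lam) (λ {ν} _ → ∑-cong (layer x ν) (λ {μ} _ → kostka-↭ p μ)))
kostka-↭ (Perm.trans p q)    lam = trans (kostka-↭ p lam) (kostka-↭ q lam)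

-- Kostka numbers: vanishing and triangularity

∑-layer≢0 : ∀ lam a α → kostka lam (a ∷ α) ≢ 0 →
  ∃ λ μ → Strip μ lam × sum μ + a ≡ sum lam × kostka μ α ≢ 0
∑-layer≢0 lam a α ne =
  let μ , μ∈ , ne′ = ∑≢0 (λ μ → kostka μ α) (layer a lam) ne
      s , eq = ∈-layer⁻ lam μ∈
  in μ , s , eq , ne′

𝟙≢0 : {P : Set} (P? : Dec P) → 𝟙 P? ≢ 0 → P
𝟙≢0 (yes p) _  = p
𝟙≢0 (no _)  ne = contradiction refl ne

kostka-sum : ∀ lam α → kostka lam α ≢ 0 → sum lam ≡ sum α
kostka-sum lam []      ne = 𝟙≢0 (sum lam ℕ.≟ 0) ne
kostka-sum lam (a ∷ α) ne =
  let μ , _ , eq , ne′ = ∑-layer≢0 lam a α ne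
  in trans (sym eq) (trans (cong (ℕ._+ a) (kostka-sum μ α ne′)) (ℕₚ.+-comm (sum α) a))

strip-sum≤ : ∀ {μ lam} → Strip μ lam → sum μ ≤ sum lam
strip-sum≤ []              = z≤n
strip-sum≤ ((_ , m≤x) ∷ s) = ℕₚ.+-mono-≤ m≤x (strip-sum≤ s)

+-mono-≤-≡ : ∀ {a b c d} → a ≤ b → c ≤ d → a + c ≡ b + d → a ≡ b × c ≡ d
+-mono-≤-≡ {a} {b} {c} {d} a≤b c≤d eq = a≡b , ℕₚ.+-cancelˡ-≡ a _ _ (trans eq (cong (ℕ._+ d) (sym a≡b)))
  where
  a≡b : a ≡ b
  a≡b = ℕₚ.≤-antisym a≤b (ℕₚ.≮⇒≥ λ a<b → ℕₚ.<-irrefl eq (ℕₚ.+-mono-<-≤ a<b c≤d))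

strip-sum≡ : ∀ {μ lam} → Strip μ lam → sum μ ≡ sum lam → μ ≡ lam
strip-sum≡ []              _  = refl
strip-sum≡ ((_ , m≤x) ∷ s) eq =
  let m≡x , eq′ = +-mono-≤-≡ m≤x (strip-sum≤ s) eq in cong₂ _∷_ m≡x (strip-sum≡ s eq′)

head₀-≤ : ∀ {x lam} → Linked _≥_ (x ∷ lam) → head₀ lam ≤ x
head₀-≤ [-]     = z≤n
head₀-≤ (y≤x ∷ _) = y≤x

strip-refl : ∀ {lam} → Linked _≥_ lam → Strip lam lam
strip-refl {[]}    _ = []
strip-refl {x ∷ _} l = (head₀-≤ l , ℕₚ.≤-refl) ∷ strip-refl (Linked.tail l)

kostka-0∷ : ∀ {lam} → Linked _≥_ lam → ∀ α → kostka lam (0 ∷ α) ≡ kostka lam α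
kostka-0∷ {lam} l α = ∑-single (λ μ → kostka μ α) (unique-layer 0 lam)
  (∈-layer⁺ (strip-refl l) (ℕₚ.+-identityʳ (sum lam)))
  (λ μ∈ μ≢ → let s , eq = ∈-layer⁻ lam μ∈ in
    contradiction (strip-sum≡ s (trans (sym (ℕₚ.+-identityʳ _)) eq)) μ≢)

part : List ℕ → ℕ → ℕ
part []        _       = 0
part (x ∷ lam) zero    = x
part (x ∷ lam) (suc i) = part lam i

head₀≡part : ∀ lam → head₀ lam ≡ part lam 0
head₀≡part []      = refl
head₀≡part (_ ∷ _) = refl

part-positive : ∀ {lam} → All (1 ≤_) lam → ∀ {i} → i < length lam → 1 ≤ part lam i
part-positive (1≤x ∷ _)  {zero}  _         = 1≤x
part-positive (_ ∷ pos)  {suc i} (s≤s i<n) = part-positive pos i<n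

sum≡0⇒part≡0 : ∀ lam → sum lam ≡ 0 → ∀ i → part lam i ≡ 0
sum≡0⇒part≡0 []        _  _       = refl
sum≡0⇒part≡0 (x ∷ lam) eq zero    = ℕₚ.m+n≡0⇒m≡0 x eq
sum≡0⇒part≡0 (x ∷ lam) eq (suc i) = sum≡0⇒part≡0 lam (ℕₚ.m+n≡0⇒n≡0 x eq) i

part≡0⇒sum≡0 : ∀ lam → (∀ i → part lam i ≡ 0) → sum lam ≡ 0
part≡0⇒sum≡0 []        _ = refl
part≡0⇒sum≡0 (x ∷ lam) h = cong₂ _+_ (h 0) (part≡0⇒sum≡0 lam (h ∘ suc))

infix 4 _≈_

-- Equality up to trailing zeros: strips keep emptied rows as zeros, whereas partitions have none.
_≈_ : List ℕ → List ℕ → Set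
lam ≈ μ = ∀ i → part lam i ≡ part μ i

≈⇒≡ : ∀ {lam μ} → All (1 ≤_) lam → All (1 ≤_) μ → lam ≈ μ → lam ≡ μ
≈⇒≡ []        []        _ = refl
≈⇒≡ []        (1≤y ∷ _) h = contradiction (h 0) (ℕₚ.<⇒≢ 1≤y)
≈⇒≡ (1≤x ∷ _) []        h = contradiction (sym (h 0)) (ℕₚ.<⇒≢ 1≤x)
≈⇒≡ (_ ∷ p)   (_ ∷ q)   h = cong₂ _∷_ (h 0) (≈⇒≡ p q (h ∘ suc))

≈∧length⇒≡ : ∀ lam μ → length lam ≡ length μ → lam ≈ μ → lam ≡ μ
≈∧length⇒≡ []        []      _  _ = refl
≈∧length⇒≡ (_ ∷ lam) (_ ∷ μ) eq h = cong₂ _∷_ (h 0) (≈∧length⇒≡ lam μ (ℕₚ.suc-injective eq) (h ∘ suc))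

strip-length : ∀ {μ lam} → Strip μ lam → length μ ≡ length lam
strip-length []      = refl
strip-length (_ ∷ s) = cong suc (strip-length s)

strip-part : ∀ {μ lam} → Strip μ lam → ∀ i → part lam (suc i) ≤ part μ i
strip-part []                              _       = z≤n
strip-part (_∷_ {lam = lam} (h≤m , _) s)   zero    = subst (_≤ _) (head₀≡part lam) h≤m
strip-part (_ ∷ s)                         (suc i) = strip-part s i

-- Removing a letter loses at most one row, because row i+1 of `lam` is bounded by row i of `μ`
-- (`strip-part`).
kostka-length : ∀ lam α → kostka lam α ≢ 0 → ∀ i → length α ≤ i → part lam i ≡ 0
kostka-length lam []      ne i       _         = sum≡0⇒part≡0 lam (𝟙≢0 (sum lam ℕ.≟ 0) ne) i
kostka-length lam (a ∷ α) ne (suc i) (s≤s n≤i) =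
  let μ , s , _ , ne′ = ∑-layer≢0 lam a α ne
  in ℕₚ.n≤0⇒n≡0 (subst (part lam (suc i) ≤_) (kostka-length μ α ne′ i n≤i) (strip-part s i))

kostka-too-long : ∀ {lam} α → All (1 ≤_) lam → length α < length lam → kostka lam α ≡ 0
kostka-too-long {lam} α pos α<lam with kostka lam α ℕ.≟ 0
... | yes eq = eq
... | no ne  = contradiction (sym (kostka-length lam α ne (length α) ℕₚ.≤-refl)) (ℕₚ.<⇒≢ (part-positive pos α<lam))

-- The statistic n(λ) = Σ (i-1) λᵢ, as the sum of the proper tail sums of λ. It decreases strictly
-- when a partition grows in dominance order, so one number can replace that partial order in the
-- triangularity argument.
weight : List ℕ → ℕ
weight []        = 0
weight (_ ∷ lam) = weight lam + sum lam

weight-zero : ∀ lam → sum lam ≡ 0 → weight lam ≡ 0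
weight-zero []        _  = refl
weight-zero (x ∷ lam) eq = let eq′ = ℕₚ.m+n≡0⇒n≡0 x eq in cong₂ _+_ (weight-zero lam eq′) eq′

Shift : List ℕ → List ℕ → Set
Shift μ lam = ∀ i → part μ i ≡ part lam (suc i)

sum-head-tail : ∀ lam → sum lam ≡ head₀ lam + sum (List.drop 1 lam)
sum-head-tail []      = refl
sum-head-tail (_ ∷ _) = refl

strip-tail : ∀ {μ lam} → Strip μ lam → sum (List.drop 1 lam) ≤ sum μ
strip-tail [] = z≤n
strip-tail (_∷_ {lam = lam} (h≤m , _) s) =
  subst (_≤ _) (sym (sum-head-tail lam)) (ℕₚ.+-mono-≤ h≤m (strip-tail s))

strip-tail≡ : ∀ {μ lam} → Strip μ lam → sum (List.drop 1 lam) ≡ sum μ → Shift μ lam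
strip-tail≡ []                                    _  _ = refl
strip-tail≡ (_∷_ {m} {μ} {lam = lam} (h≤m , _) s) eq =
  let h≡m , eq′ = +-mono-≤-≡ h≤m (strip-tail s) (trans (sym (sum-head-tail lam)) eq)
  in λ { zero → trans (sym h≡m) (head₀≡part lam) ; (suc i) → strip-tail≡ s eq′ i }

strip-weight : ∀ {μ lam} → Strip μ lam → weight lam ≤ weight μ + sum μ
strip-weight []         = z≤n
strip-weight s@(_ ∷ s′) = ℕₚ.+-mono-≤ (strip-weight s′) (strip-tail s)

strip-weight≡ : ∀ {μ lam} → Strip μ lam → weight lam ≡ weight μ + sum μ → sum (List.drop 1 lam) ≡ sum μ
strip-weight≡ []         _  = refl
strip-weight≡ s@(_ ∷ s′) eq = proj₂ (+-mono-≤-≡ (strip-weight s′) (strip-tail s) eq)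

-- Prepending a letter raises the weight of the content by exactly `sum α` = `sum μ`, and that of
-- the shape by at most this (`strip-weight`). If equality holds at every step, each strip removes
-- as much as possible, leaving `μ` equal to `lam` without its first row; so the removed rows are
-- the entries of `α`.
kostka-weight : ∀ lam α → kostka lam α ≢ 0 → weight lam < weight α ⊎ (weight lam ≡ weight α × lam ≈ α)
kostka-weight lam [] ne =
  let eq = 𝟙≢0 (sum lam ℕ.≟ 0) ne in inj₂ (weight-zero lam eq , sum≡0⇒part≡0 lam eq)
kostka-weight lam (a ∷ α) ne with ∑-layer≢0 lam a α ne
... | μ , s , eq , ne′ with kostka-sum μ α ne′ | kostka-weight μ α ne′
... | sμ≡sα | inj₁ wμ<wα = inj₁ (ℕₚ.≤-<-trans (strip-weight s) (ℕₚ.+-mono-<-≤ wμ<wα (ℕₚ.≤-reflexive sμ≡sα)))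
... | sμ≡sα | inj₂ (wμ≡wα , μ≈α) with ℕₚ.m≤n⇒m<n∨m≡n (strip-weight s)
... | inj₁ lt  = inj₁ (subst (weight lam <_) (cong₂ _+_ wμ≡wα sμ≡sα) lt)
... | inj₂ eqw = inj₂ (trans eqw (cong₂ _+_ wμ≡wα sμ≡sα) , lam≈)
  where
  tail≡ : sum (List.drop 1 lam) ≡ sum μ
  tail≡ = strip-weight≡ s eqw
  lam≈ : lam ≈ a ∷ α
  lam≈ (suc i) = trans (sym (strip-tail≡ s tail≡ i)) (μ≈α i)
  lam≈ zero    = trans (sym (head₀≡part lam)) (ℕₚ.+-cancelʳ-≡ (sum μ) _ _ (begin
    head₀ lam + sum μ                    ≡⟨ cong (head₀ lam ℕ.+_) tail≡ ⟨
    head₀ lam + sum (List.drop 1 lam)    ≡⟨ sum-head-tail lam ⟨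
    sum lam                              ≡⟨ eq ⟨
    sum μ + a                            ≡⟨ ℕₚ.+-comm (sum μ) a ⟩
    a + sum μ                            ∎))
    where open ≡-Reasoning

-- Drops the first row; the final 0 preserves the number of rows, as membership in `strips` demands.
shift : List ℕ → List ℕ
shift []        = []
shift (_ ∷ lam) = lam ∷ʳ 0

part-∷ʳ0 : ∀ lam i → part (lam ∷ʳ 0) i ≡ part lam i
part-∷ʳ0 []        zero    = refl
part-∷ʳ0 []        (suc i) = refl
part-∷ʳ0 (x ∷ lam) zero    = refl
part-∷ʳ0 (x ∷ lam) (suc i) = part-∷ʳ0 lam i

sum-∷ʳ : ∀ lam x → sum (lam ∷ʳ x) ≡ sum lam + x
sum-∷ʳ lam x = trans (Sumₚ.sum-++ lam [ x ]) (cong (sum lam ℕ.+_) (ℕₚ.+-identityʳ x))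

shift-part : ∀ lam → Shift (shift lam) lam
shift-part []        i = refl
shift-part (x ∷ lam) i = part-∷ʳ0 lam i

linked-∷ʳ0 : ∀ {lam} → Linked _≥_ lam → Linked _≥_ (lam ∷ʳ 0)
linked-∷ʳ0 []      = [-]
linked-∷ʳ0 [-]     = z≤n ∷ [-]
linked-∷ʳ0 (r ∷ l) = r ∷ linked-∷ʳ0 l

shift-linked : ∀ {lam} → Linked _≥_ lam → Linked _≥_ (shift lam)
shift-linked {[]}    l = []
shift-linked {_ ∷ _} l = linked-∷ʳ0 (Linked.tail l)

shift-strip : ∀ {lam} → Linked _≥_ lam → Strip (shift lam) lam
shift-strip []      = []
shift-strip [-]     = (z≤n , z≤n) ∷ []
shift-strip (r ∷ l) = (ℕₚ.≤-refl , r) ∷ shift-strip l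

sum-shift : ∀ lam → sum (shift lam) ≡ sum (List.drop 1 lam)
sum-shift []        = refl
sum-shift (x ∷ lam) = trans (sum-∷ʳ lam 0) (ℕₚ.+-identityʳ (sum lam))

-- A horizontal strip leaves at least the tail sum of `lam`. Removing `head₀ lam` boxes attains this
-- minimum, which forces the remainder to be `shift lam`, so there is a single chain.
kostka-diagonal : ∀ {lam} → Linked _≥_ lam → ∀ α → lam ≈ α → kostka lam α ≡ 1
kostka-diagonal {lam} l []      h = 𝟙-yes (sum lam ℕ.≟ 0) (part≡0⇒sum≡0 lam h)
kostka-diagonal {lam} l (a ∷ α) h = trans
  (∑-single (λ μ → kostka μ α) (unique-layer a lam) (∈-layer⁺ (shift-strip l) shift-sum) only)
  (kostka-diagonal (shift-linked l) α (λ i → trans (shift-part lam i) (h (suc i))))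
  where
  a≡ : head₀ lam ≡ a
  a≡ = trans (head₀≡part lam) (h 0)
  shift-sum : sum (shift lam) + a ≡ sum lam
  shift-sum = trans (ℕₚ.+-comm (sum (shift lam)) a)
    (trans (cong₂ _+_ (sym a≡) (sum-shift lam)) (sym (sum-head-tail lam)))
  only : ∀ {μ} → μ ∈ layer a lam → μ ≢ shift lam → kostka μ α ≡ 0
  only {μ} μ∈ μ≢ = contradiction
    (≈∧length⇒≡ μ (shift lam) (trans (strip-length s) (sym (strip-length (shift-strip l))))
      (λ i → trans (strip-tail≡ s (trans (sym (sum-shift lam)) (ℕₚ.+-cancelʳ-≡ a _ _ (trans shift-sum (sym eq)))) i)
                   (sym (shift-part lam i))))
    μ≢
    where
    s = proj₁ (∈-layer⁻ lam μ∈)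
    eq = proj₂ (∈-layer⁻ lam μ∈)

map-cartesianProductWith : ∀ {D E : Set} (h : C → D) (h′ : B → E) {f : A → B → C} {f′ : A → E → D} →
  (∀ x y → h (f x y) ≡ f′ x (h′ y)) → ∀ xs ys →
  map h (cartesianProductWith f xs ys) ≡ cartesianProductWith f′ xs (map h′ ys)
map-cartesianProductWith h h′ eq []       ys = refl
map-cartesianProductWith h h′ {f} {f′} eq (x ∷ xs) ys = trans
  (Listₚ.map-++ h (map (f x) ys) _)
  (cong₂ _++_ (trans (sym (Listₚ.map-∘ ys)) (trans (Listₚ.map-cong (eq x) ys) (Listₚ.map-∘ ys)))
    (map-cartesianProductWith h h′ eq xs ys))

-- Kostka numbers and the last row of a shape

strips-∷ʳ0 : ∀ lam → strips (lam ∷ʳ 0) ≡ map (_∷ʳ 0) (strips lam)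
strips-∷ʳ0 []        = refl
strips-∷ʳ0 (x ∷ lam) = sym (trans
  (map-cartesianProductWith (_∷ʳ 0) (_∷ʳ 0) (λ _ _ → refl) (interval (head₀ lam) x) (strips lam))
  (cong₂ (λ h s → cartesianProductWith _∷_ (interval h x) s) (head₀-∷ʳ0 lam) (sym (strips-∷ʳ0 lam))))
  where
  head₀-∷ʳ0 : ∀ lam → head₀ lam ≡ head₀ (lam ∷ʳ 0)
  head₀-∷ʳ0 []      = refl
  head₀-∷ʳ0 (_ ∷ _) = refl

kostka-∷ʳ0 : ∀ lam α → kostka (lam ∷ʳ 0) α ≡ kostka lam α
kostka-∷ʳ0 lam [] = cong (λ z → 𝟙 (z ℕ.≟ 0)) (trans (sum-∷ʳ lam 0) (ℕₚ.+-identityʳ (sum lam)))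
kostka-∷ʳ0 lam (a ∷ α) = begin
  ∑ (layer a (lam ∷ʳ 0)) (λ μ → kostka μ α)  ≡⟨ ∑-filter _ (λ μ → kostka μ α) (strips (lam ∷ʳ 0)) ⟩
  ∑ (strips (lam ∷ʳ 0)) f                    ≡⟨ cong (λ s → ∑ s f) (strips-∷ʳ0 lam) ⟩
  ∑ (map (_∷ʳ 0) (strips lam)) f             ≡⟨ ∑-map f (_∷ʳ 0) (strips lam) ⟩
  ∑ (strips lam) (f ∘ (_∷ʳ 0))               ≡⟨ ∑-cong (strips lam) (λ {μ} _ → cong₂ _*_
                                                  (cong₂ (λ m n → 𝟙 (m + a ℕ.≟ n)) (sum-∷ʳ0 μ) (sum-∷ʳ0 lam)) (kostka-∷ʳ0 μ α)) ⟩
  ∑ (strips lam) g                           ≡⟨ ∑-filter _ (λ μ → kostka μ α) (strips lam) ⟨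
  ∑ (layer a lam) (λ μ → kostka μ α)         ∎
  where
  open ≡-Reasoning
  f g : List ℕ → ℕ
  f μ = 𝟙 (sum μ + a ℕ.≟ sum (lam ∷ʳ 0)) * kostka μ α
  g μ = 𝟙 (sum μ + a ℕ.≟ sum lam) * kostka μ α
  sum-∷ʳ0 : ∀ xs → sum (xs ∷ʳ 0) ≡ sum xs
  sum-∷ʳ0 xs = trans (sum-∷ʳ xs 0) (ℕₚ.+-identityʳ (sum xs))

strip-last≡0 : ∀ lam {x μ} → Strip μ (lam ∷ʳ x) → part μ (length lam) ≡ 0 →
  sum μ ≤ sum lam × (sum μ ≡ sum lam → μ ≡ lam ∷ʳ 0)
strip-last≡0 []        (_ ∷ [])        refl = z≤n , λ _ → refl
strip-last≡0 (y ∷ lam) ((_ , m≤y) ∷ s) h    = let le , eq = strip-last≡0 lam s h in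
  ℕₚ.+-mono-≤ m≤y le ,
  λ e → let e₁ , e₂ = +-mono-≤-≡ m≤y le e in cong₂ _∷_ e₁ (eq e₂)

strip-∷ʳ0 : ∀ lam {x} → Linked _≥_ (lam ∷ʳ x) → Strip (lam ∷ʳ 0) (lam ∷ʳ x)
strip-∷ʳ0 []        l = (z≤n , z≤n) ∷ []
strip-∷ʳ0 (y ∷ lam) l = (head₀-≤ l , ℕₚ.≤-refl) ∷ strip-∷ʳ0 lam (Linked.tail l)

module _ (lam α : List ℕ) (len : length lam ≡ length α) where

  -- Once the largest letter is removed, `α` has too few letters to reach the last row, so that row
  -- must be empty. Its one box is all that the letter may take.
  kostka-∷ʳ1 : Linked _≥_ (lam ∷ʳ 1) → kostka (lam ∷ʳ 1) (1 ∷ α) ≡ kostka lam α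
  kostka-∷ʳ1 l = trans
    (∑-single (λ μ → kostka μ α) (unique-layer 1 (lam ∷ʳ 1))
      (∈-layer⁺ (strip-∷ʳ0 lam l) (trans (cong (ℕ._+ 1) (trans (sum-∷ʳ lam 0) (ℕₚ.+-identityʳ (sum lam)))) (sym (sum-∷ʳ lam 1)))) only)
    (kostka-∷ʳ0 lam α)
    where
    only : ∀ {μ} → μ ∈ layer 1 (lam ∷ʳ 1) → μ ≢ lam ∷ʳ 0 → kostka μ α ≡ 0
    only {μ} μ∈ μ≢ with kostka μ α ℕ.≟ 0
    ... | yes z = z
    ... | no ne = let s , eq = ∈-layer⁻ (lam ∷ʳ 1) μ∈ in contradiction
      (proj₂ (strip-last≡0 lam s (kostka-length μ α ne (length lam) (ℕₚ.≤-reflexive (sym len))))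
        (ℕₚ.+-cancelʳ-≡ 1 _ _ (trans eq (sum-∷ʳ lam 1))))
      μ≢

  -- The single occurrence of the largest letter would have to empty a row of at least two boxes.
  kostka-∷ʳ2+ : ∀ x → kostka (lam ∷ʳ suc (suc x)) (1 ∷ α) ≡ 0
  kostka-∷ʳ2+ x with kostka (lam ∷ʳ suc (suc x)) (1 ∷ α) ℕ.≟ 0
  ... | yes z = z
  ... | no ne = let μ , s , eq , ne′ = ∑-layer≢0 (lam ∷ʳ suc (suc x)) 1 α ne in contradiction
    (trans eq (sum-∷ʳ lam (suc (suc x))))
    (ℕₚ.<⇒≢ (ℕₚ.+-mono-≤-< (proj₁ (strip-last≡0 lam s (kostka-length μ α ne′ (length lam) (ℕₚ.≤-reflexive (sym len)))))
                           (s≤s z<s)))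

-- Schur functions

∈-vectors : ∀ {as : List A} {k} (v : Vec A k) → All (_∈ as) (toList v) → v ∈ vectors as k
∈-vectors []      []         = here refl
∈-vectors (x ∷ v) (x∈ ∷ v∈) = ∈ₚ.∈-cartesianProductWith⁺ _∷_ x∈ (∈-vectors v v∈)

∈-vectors-allFin : ∀ {N k} (v : Vec (Fin N) k) → v ∈ vectors (allFin N) k
∈-vectors-allFin v = ∈-vectors v (All.universal ∈ₚ.∈-allFin (toList v))

unique-vectors : ∀ {as : List A} → Unique as → ∀ k → Unique (vectors as k)
unique-vectors u zero    = [] ∷ []
unique-vectors u (suc k) = Uniqueₚ.cartesianProductWith⁺ _∷_ Vecₚ.∷-injective u (unique-vectors u k)

unique-colourings : ∀ N k → Unique (vectors (allFin N) k)
unique-colourings N k = unique-vectors (Uniqueₚ.allFin⁺ N) k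

toList-injective : ∀ {n} (xs ys : Vec A n) → toList xs ≡ toList ys → xs ≡ ys
toList-injective xs ys eq = trans (sym (Vecₚ.cast-is-id refl xs)) (Vecₚ.toList-injective refl xs ys eq)

Tableau : ℕ → Set
Tableau N = List (List (Fin N))

unique-fillings : ∀ N lam → Unique (fillings N lam)
unique-fillings N []        = [] ∷ []
unique-fillings N (r ∷ lam) = Uniqueₚ.cartesianProductWith⁺ _∷_ Listₚ.∷-injective
  (Uniqueₚ.map⁺ (λ {x} {y} → toList-injective x y) (unique-colourings N r)) (unique-fillings N lam)

∈-fillings⁺ : ∀ {N} (T : Tableau N) → T ∈ fillings N (map length T)
∈-fillings⁺ []      = here refl
∈-fillings⁺ (r ∷ T) = ∈ₚ.∈-cartesianProductWith⁺ _∷_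
  (subst (_∈ map toList (vectors (allFin _) (length r))) (Vecₚ.toList∘fromList r)
    (∈ₚ.∈-map⁺ toList (∈-vectors-allFin (fromList r))))
  (∈-fillings⁺ T)

∈-fillings⁻ : ∀ {N} lam {T : Tableau N} → T ∈ fillings N lam → map length T ≡ lam
∈-fillings⁻ []        (here refl) = refl
∈-fillings⁻ {N} (r ∷ lam) T∈
  with _ , _ , r∈ , T∈′ , refl ← ∈ₚ.∈-cartesianProductWith⁻ _∷_ (map toList (vectors (allFin N) r)) (fillings N lam) T∈
  with v , _ , refl ← ∈ₚ.∈-map⁻ toList r∈
  = cong₂ _∷_ (Vecₚ.length-toList v) (∈-fillings⁻ lam T∈′)

module _ {N : ℕ} where

  low : Fin (suc N) → Maybe (Fin N)
  low i with view i
  ... | ‵fromℕ     = nothing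
  ... | ‵inject₁ j = just j

  low-fromℕ : low (fromℕ N) ≡ nothing
  low-fromℕ rewrite view-fromℕ N = refl

  low-inject₁ : ∀ j → low (inject₁ j) ≡ just j
  low-inject₁ j rewrite view-inject₁ j = refl

  lowerRow : List (Fin (suc N)) → List (Fin N)
  lowerRow = List.mapMaybe low

  padRow : ℕ → List (Fin N) → List (Fin (suc N))
  padRow k r = map inject₁ r ++ replicate k (fromℕ N)

  lowerRow-padRow : ∀ k r → lowerRow (padRow k r) ≡ r
  lowerRow-padRow zero    []      = refl
  lowerRow-padRow (suc k) []      rewrite low-fromℕ = lowerRow-padRow k []
  lowerRow-padRow k       (x ∷ r) rewrite low-inject₁ x = cong (x ∷_) (lowerRow-padRow k r)

  length-padRow : ∀ k r → length (padRow k r) ≡ length r + k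
  length-padRow k r = trans (Listₚ.length-++ (map inject₁ r))
    (cong₂ _+_ (Listₚ.length-map inject₁ r) (Listₚ.length-replicate k))

  inject₁<fromℕ : ∀ (j : Fin N) → inject₁ j Fin.< fromℕ N
  inject₁<fromℕ j = subst₂ _<_ (sym (Finₚ.toℕ-inject₁ j)) (sym (Finₚ.toℕ-fromℕ N)) (Finₚ.toℕ<n j)

  inject₁-mono : ∀ {i j : Fin N} → i Fin.≤ j → inject₁ i Fin.≤ inject₁ j
  inject₁-mono {i} {j} = subst₂ _≤_ (sym (Finₚ.toℕ-inject₁ i)) (sym (Finₚ.toℕ-inject₁ j))

  inject₁-cancel : ∀ {i j : Fin N} → inject₁ i Fin.≤ inject₁ j → i Fin.≤ j
  inject₁-cancel {i} {j} = subst₂ _≤_ (Finₚ.toℕ-inject₁ i) (Finₚ.toℕ-inject₁ j)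

  inject₁-mono-< : ∀ {i j : Fin N} → i Fin.< j → inject₁ i Fin.< inject₁ j
  inject₁-mono-< {i} {j} = subst₂ _<_ (sym (Finₚ.toℕ-inject₁ i)) (sym (Finₚ.toℕ-inject₁ j))

  inject₁-cancel-< : ∀ {i j : Fin N} → inject₁ i Fin.< inject₁ j → i Fin.< j
  inject₁-cancel-< {i} {j} = subst₂ _<_ (Finₚ.toℕ-inject₁ i) (Finₚ.toℕ-inject₁ j)

  -- In a weakly increasing row all copies of the largest letter stand at the end.
  padRow-lowerRow : ∀ {r} → Linked Fin._≤_ r → ∃ λ k → r ≡ padRow k (lowerRow r)
  padRow-lowerRow {r} l = let k , r′ , eq = decompose r l in
    k , trans eq (cong (padRow k) (sym (trans (cong lowerRow eq) (lowerRow-padRow k r′))))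
    where
    decompose : ∀ r → Linked Fin._≤_ r → ∃₂ λ k r′ → r ≡ padRow k r′
    decompose []      _ = 0 , [] , refl
    decompose (x ∷ r) l with decompose r (Linked.tail l) | view x
    ... | k , r′     , refl | ‵inject₁ j = k , j ∷ r′ , refl
    ... | k , []     , refl | ‵fromℕ     = suc k , [] , refl
    ... | k , j ∷ r′ , refl | ‵fromℕ     = contradiction (Linked.head l) (ℕₚ.<⇒≱ (inject₁<fromℕ j))

  linked-padRow⁺ : ∀ k {r} → Linked Fin._≤_ r → Linked Fin._≤_ (padRow k r)
  linked-padRow⁺ zero          []  = []
  linked-padRow⁺ (suc zero)    []  = [-]
  linked-padRow⁺ (suc (suc k)) []  = ℕₚ.≤-refl ∷ linked-padRow⁺ (suc k) []
  linked-padRow⁺ zero          [-] = [-]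
  linked-padRow⁺ (suc k) {x ∷ _} [-] = ℕₚ.<⇒≤ (inject₁<fromℕ x) ∷ linked-padRow⁺ (suc k) []
  linked-padRow⁺ k (x≤y ∷ l)       = inject₁-mono x≤y ∷ linked-padRow⁺ k l

  linked-padRow⁻ : ∀ k r → Linked Fin._≤_ (padRow k r) → Linked Fin._≤_ r
  linked-padRow⁻ k []          _         = []
  linked-padRow⁻ k (x ∷ [])    _         = [-]
  linked-padRow⁻ k (x ∷ y ∷ r) (x≤y ∷ l) = inject₁-cancel x≤y ∷ linked-padRow⁻ k (y ∷ r) l

  -- Copies of the largest letter in the lower row must sit under entries of `u`, never under the
  -- copies appended to `u`. The resulting bound `length l + k ≤ length u` is the horizontal strip
  -- condition.
  prefix-padRow⁺ : ∀ {k k′ l u} → Prefix Fin._>_ l u → length l + k ≤ length u →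
    Prefix Fin._>_ (padRow k l) (padRow k′ u)
  prefix-padRow⁺ {zero}              []      _        = []
  prefix-padRow⁺ {suc k} {u = x ∷ u} []      (s≤s le) = inject₁<fromℕ x ∷ prefix-padRow⁺ {k} {u = u} [] le
  prefix-padRow⁺                     (r ∷ p) (s≤s le) = inject₁-mono-< r ∷ prefix-padRow⁺ p le

  prefix-padRow⁻ : ∀ k k′ l u → Prefix Fin._>_ (padRow k l) (padRow k′ u) →
    Prefix Fin._>_ l u × length l + k ≤ length u
  prefix-padRow⁻ zero    k′      []      u       _       = [] , z≤n
  prefix-padRow⁻ (suc k) (suc _) []      []      (r ∷ _) = contradiction r (ℕₚ.<-irrefl refl)
  prefix-padRow⁻ (suc k) k′      []      (x ∷ u) (_ ∷ p) = [] , s≤s (proj₂ (prefix-padRow⁻ k k′ [] u p))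
  prefix-padRow⁻ k       (suc _) (y ∷ l) []      (r ∷ _) = contradiction r (ℕₚ.<-asym (inject₁<fromℕ y))
  prefix-padRow⁻ k       k′      (y ∷ l) (x ∷ u) (r ∷ p) =
    let q , le = prefix-padRow⁻ k k′ l u p in inject₁-cancel-< r ∷ q , s≤s le

  lowerTableau : Tableau (suc N) → Tableau N
  lowerTableau = map lowerRow

  padTableau : List ℕ → Tableau N → Tableau (suc N)
  padTableau = List.zipWith (λ x r → padRow (x ∸ length r) r)

  private
    Columns : ∀ {N} → Tableau N → Set
    Columns = Linked (λ upper lower → Prefix Fin._>_ lower upper)

  padTableau-semistandard : ∀ {lam T} → Strip (map length T) lam → Semistandard T → Semistandard (padTableau lam T)
  padTableau-semistandard s (rs , cs) = rows s rs , columns s cs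
    where
    rows : ∀ {lam T} → Strip (map length T) lam → All (Linked Fin._≤_) T → All (Linked Fin._≤_) (padTableau lam T)
    rows {T = []}    []      []       = []
    rows {T = _ ∷ _} (_ ∷ s) (l ∷ ls) = linked-padRow⁺ _ l ∷ rows s ls
    columns : ∀ {lam T} → Strip (map length T) lam → Columns T → Columns (padTableau lam T)
    columns {T = []}        []            []      = []
    columns {T = _ ∷ []}    (_ ∷ [])      [-]     = [-]
    columns {T = r₁ ∷ r₂ ∷ _} ((x₂≤r₁ , _) ∷ s@((_ , r₂≤x₂) ∷ _)) (p ∷ ps) =
      prefix-padRow⁺ p (subst (_≤ length r₁) (sym (ℕₚ.m+[n∸m]≡n r₂≤x₂)) x₂≤r₁) ∷ columns s ps

  length-padTableau : ∀ {lam T} → Strip (map length T) lam → map length (padTableau lam T) ≡ lam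
  length-padTableau {T = []}    []                = refl
  length-padTableau {T = r ∷ T} ((_ , r≤x) ∷ s) = cong₂ _∷_
    (trans (length-padRow _ r) (ℕₚ.m+[n∸m]≡n r≤x)) (length-padTableau s)

  lowerTableau-padTableau : ∀ {lam T} → Strip (map length T) lam → lowerTableau (padTableau lam T) ≡ T
  lowerTableau-padTableau {T = []}    []      = refl
  lowerTableau-padTableau {T = r ∷ T} (_ ∷ s) = cong₂ _∷_ (lowerRow-padRow _ r) (lowerTableau-padTableau s)

  lowerRow-length : ∀ {r} → (l : Linked Fin._≤_ r) → length r ≡ length (lowerRow r) + proj₁ (padRow-lowerRow l)
  lowerRow-length {r} l = let k , eq = padRow-lowerRow l in trans (cong length eq) (length-padRow k (lowerRow r))

  lowerTableau-semistandard : ∀ {T} → Semistandard T →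
    Semistandard (lowerTableau T) × Strip (map length (lowerTableau T)) (map length T)
  lowerTableau-semistandard (rs , cs) = let cs′ , s = columns rs cs in (rows rs , cs′) , s
    where
    rows : ∀ {T} → All (Linked Fin._≤_) T → All (Linked Fin._≤_) (lowerTableau T)
    rows []       = []
    rows (l ∷ ls) = let k , eq = padRow-lowerRow l in linked-padRow⁻ k _ (subst (Linked Fin._≤_) eq l) ∷ rows ls
    shorter : ∀ {r} → Linked Fin._≤_ r → length (lowerRow r) ≤ length r
    shorter {r} l = subst (length (lowerRow r) ≤_) (sym (lowerRow-length l)) (ℕₚ.m≤m+n (length (lowerRow r)) _)
    columns : ∀ {T} → All (Linked Fin._≤_) T → Columns T →
      Columns (lowerTableau T) × Strip (map length (lowerTableau T)) (map length T)
    columns []       []  = [] , []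
    columns (l ∷ []) [-] = [-] , (z≤n , shorter l) ∷ []
    columns (l₁ ∷ ls@(l₂ ∷ _)) (p ∷ ps) =
      let k₁ , eq₁ = padRow-lowerRow l₁
          k₂ , eq₂ = padRow-lowerRow l₂
          q , le   = prefix-padRow⁻ k₂ k₁ _ _ (subst₂ (Prefix Fin._>_) eq₂ eq₁ p)
          cs , s   = columns ls ps
      in q ∷ cs , (subst (_≤ _) (sym (lowerRow-length l₂)) le , shorter l₁) ∷ s

  padTableau-lowerTableau : ∀ {T} → All (Linked Fin._≤_) T → padTableau (map length T) (lowerTableau T) ≡ T
  padTableau-lowerTableau []                = refl
  padTableau-lowerTableau {r ∷ _} (l ∷ ls) = let k , eq = padRow-lowerRow l in cong₂ _∷_
    (trans (cong (λ z → padRow z (lowerRow r))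
        (trans (cong (_∸ length (lowerRow r)) (lowerRow-length l)) (ℕₚ.m+n∸m≡n (length (lowerRow r)) k)))
      (sym eq))
    (padTableau-lowerTableau ls)

-- Multiplicities of letters in padded tableaux

multiplicity-∑ : ∀ {N} (i : Fin N) xs → multiplicity i xs ≡ ∑ xs (λ x → 𝟙 (i Fin.≟ x))
multiplicity-∑ i xs = count-∑ (i Fin.≟_) xs

multiplicity-++ : ∀ {N} (i : Fin N) xs ys → multiplicity i (xs ++ ys) ≡ multiplicity i xs + multiplicity i ys
multiplicity-++ i xs ys = trans (cong length (Listₚ.filter-++ (i Fin.≟_) xs ys)) (Listₚ.length-++ (filter (i Fin.≟_) xs))

multiplicity-map : ∀ {M N} {f : Fin M → Fin N} → (∀ {i j} → f i ≡ f j → i ≡ j) →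
  ∀ i xs → multiplicity (f i) (map f xs) ≡ multiplicity i xs
multiplicity-map {f = f} inj i xs = begin
  multiplicity (f i) (map f xs)             ≡⟨ multiplicity-∑ (f i) (map f xs) ⟩
  ∑ (map f xs) (λ y → 𝟙 (f i Fin.≟ y))      ≡⟨ ∑-map _ f xs ⟩
  ∑ xs (λ x → 𝟙 (f i Fin.≟ f x))            ≡⟨ ∑-cong xs (λ {x} _ → 𝟙-⇔ (f i Fin.≟ f x) (i Fin.≟ x) inj (cong f)) ⟩
  ∑ xs (λ x → 𝟙 (i Fin.≟ x))                ≡⟨ multiplicity-∑ i xs ⟨
  multiplicity i xs                         ∎
  where open ≡-Reasoning

multiplicity-∉ : ∀ {N} (i : Fin N) xs → i ∉ xs → multiplicity i xs ≡ 0
multiplicity-∉ i xs i∉ = count-none (i Fin.≟_) xs (λ x∈ i≡x → i∉ (subst (_∈ xs) (sym i≡x) x∈))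

∈-replicate⁻ : ∀ {x y : A} k → x ∈ replicate k y → x ≡ y
∈-replicate⁻ (suc k) (here eq) = eq
∈-replicate⁻ (suc k) (there p) = ∈-replicate⁻ k p

multiplicity-replicate : ∀ {N} (i : Fin N) k → multiplicity i (replicate k i) ≡ k
multiplicity-replicate i k = trans
  (cong length (Listₚ.filter-all (i Fin.≟_) (All.tabulate (sym ∘ ∈-replicate⁻ k)))) (Listₚ.length-replicate k)

module _ {N : ℕ} where

  multiplicity-inject₁-padTableau : ∀ (j : Fin N) {lam} T → Strip (map length T) lam →
    multiplicity (inject₁ j) (concat (padTableau lam T)) ≡ multiplicity j (concat T)
  multiplicity-inject₁-padTableau j         []      []              = refl
  multiplicity-inject₁-padTableau j {x ∷ lam} (r ∷ T) (_ ∷ s) = begin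
    multiplicity (inject₁ j) (padRow k r ++ concat (padTableau lam T))
      ≡⟨ multiplicity-++ (inject₁ j) (padRow k r) _ ⟩
    multiplicity (inject₁ j) (padRow k r) + multiplicity (inject₁ j) (concat (padTableau lam T))
      ≡⟨ cong₂ _+_ row (multiplicity-inject₁-padTableau j T s) ⟩
    multiplicity j r + multiplicity j (concat T)
      ≡⟨ multiplicity-++ j r (concat T) ⟨
    multiplicity j (r ++ concat T) ∎
    where
    open ≡-Reasoning
    k : ℕ
    k = x ∸ length r
    row : multiplicity (inject₁ j) (padRow k r) ≡ multiplicity j r
    row = trans (multiplicity-++ (inject₁ j) (map inject₁ r) (replicate k (fromℕ N))) (trans
      (cong₂ _+_ (multiplicity-map Finₚ.inject₁-injective j r)
        (multiplicity-∉ (inject₁ j) (replicate k (fromℕ N)) (Finₚ.fromℕ≢inject₁ ∘ sym ∘ ∈-replicate⁻ k)))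
      (ℕₚ.+-identityʳ _))

  multiplicity-fromℕ-padTableau : ∀ {lam} (T : Tableau N) → Strip (map length T) lam →
    sum (map length T) + multiplicity (fromℕ N) (concat (padTableau lam T)) ≡ sum lam
  multiplicity-fromℕ-padTableau           []      []              = refl
  multiplicity-fromℕ-padTableau {x ∷ lam} (r ∷ T) ((_ , r≤x) ∷ s) = begin
    length r + sum (map length T) + multiplicity (fromℕ N) (padRow k r ++ concat (padTableau lam T))
      ≡⟨ cong (length r + sum (map length T) ℕ.+_) (trans (multiplicity-++ (fromℕ N) (padRow k r) _) (cong (ℕ._+ m) row)) ⟩
    length r + sum (map length T) + (k + m)   ≡⟨ regroup (length r) (sum (map length T)) k m ⟩
    (length r + k) + (sum (map length T) + m) ≡⟨ cong₂ _+_ (ℕₚ.m+[n∸m]≡n r≤x) (multiplicity-fromℕ-padTableau T s) ⟩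
    x + sum lam ∎
    where
    open ≡-Reasoning
    k m : ℕ
    k = x ∸ length r
    m = multiplicity (fromℕ N) (concat (padTableau lam T))
    regroup : ∀ a b c d → a + b + (c + d) ≡ (a + c) + (b + d)
    regroup = solve-∀
    row : multiplicity (fromℕ N) (padRow k r) ≡ k
    row = trans (multiplicity-++ (fromℕ N) (map inject₁ r) (replicate k (fromℕ N)))
      (cong₂ _+_ (multiplicity-∉ (fromℕ N) (map inject₁ r)
                   (λ p → let _ , _ , eq = ∈ₚ.∈-map⁻ inject₁ p in Finₚ.fromℕ≢inject₁ eq))
                 (multiplicity-replicate (fromℕ N) k))

lookup-∷ʳ-inject₁ : ∀ {n} (xs : Vec A n) x i → Vec.lookup (xs Vec.∷ʳ x) (inject₁ i) ≡ Vec.lookup xs i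
lookup-∷ʳ-inject₁ (y ∷ xs) x zero    = refl
lookup-∷ʳ-inject₁ (y ∷ xs) x (suc i) = lookup-∷ʳ-inject₁ xs x i

lookup-∷ʳ-fromℕ : ∀ {n} (xs : Vec A n) x → Vec.lookup (xs Vec.∷ʳ x) (fromℕ n) ≡ x
lookup-∷ʳ-fromℕ []       x = refl
lookup-∷ʳ-fromℕ (y ∷ xs) x = lookup-∷ʳ-fromℕ xs x

SemistandardOfContent : ∀ {N} → Vec ℕ N → Tableau N → Set
SemistandardOfContent α T = Semistandard T × HasContent α (concat T)

semistandardOfContent? : ∀ {N} (α : Vec ℕ N) → Decidable₁ (SemistandardOfContent α)
semistandardOfContent? α T = semistandard? T ×-dec hasContent? α (concat T)

tableauCount : List ℕ → (N : ℕ) → Vec ℕ N → ℕ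
tableauCount lam N α = count (semistandardOfContent? α) (fillings N lam)

_≟ˢ_ : DecidableEquality (List ℕ)
_≟ˢ_ = Listₚ.≡-dec ℕ._≟_

content-padTableau⁺ : ∀ {N lam} {α : Vec ℕ N} {a} (T : Tableau N) → Strip (map length T) lam →
  sum (map length T) + a ≡ sum lam → HasContent α (concat T) → HasContent (α Vec.∷ʳ a) (concat (padTableau lam T))
content-padTableau⁺ {α = α} {a} T s eq h i with view i
... | ‵fromℕ     = trans
  (ℕₚ.+-cancelˡ-≡ (sum (map length T)) _ _ (trans (multiplicity-fromℕ-padTableau T s) (sym eq)))
  (sym (lookup-∷ʳ-fromℕ α a))
... | ‵inject₁ j = trans (multiplicity-inject₁-padTableau j T s) (trans (h j) (sym (lookup-∷ʳ-inject₁ α a j)))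

content-padTableau⁻ : ∀ {N lam} {α : Vec ℕ N} {a} (T : Tableau N) → Strip (map length T) lam →
  HasContent (α Vec.∷ʳ a) (concat (padTableau lam T)) →
  sum (map length T) + a ≡ sum lam × HasContent α (concat T)
content-padTableau⁻ {N} {α = α} {a} T s h =
  trans (cong (sum (map length T) ℕ.+_) (sym (trans (h (fromℕ N)) (lookup-∷ʳ-fromℕ α a)))) (multiplicity-fromℕ-padTableau T s) ,
  λ j → trans (sym (multiplicity-inject₁-padTableau j T s)) (trans (h (inject₁ j)) (lookup-∷ʳ-inject₁ α a j))

lowerTableau-ofContent : ∀ {N lam} {α : Vec ℕ N} {a T} → map length T ≡ lam → SemistandardOfContent (α Vec.∷ʳ a) T →
  SemistandardOfContent α (lowerTableau T) × map length (lowerTableau T) ∈ layer a lam ×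
  padTableau lam (lowerTableau T) ≡ T
lowerTableau-ofContent {α = α} {a} {T} refl (sst , content) =
  let sst′ , s = lowerTableau-semistandard sst
      inv      = padTableau-lowerTableau (proj₁ sst)
      eq , content′ = content-padTableau⁻ {α = α} (lowerTableau T) s (subst (HasContent (α Vec.∷ʳ a) ∘ concat) (sym inv) content)
  in (sst′ , content′) , ∈-layer⁺ s eq , inv

-- Tableaux are sorted by the shape `μ` that the letters below the largest occupy. Over a fixed `μ`,
-- deleting the largest letter and padding back to `lam` are mutually inverse.
tableauCount-∷ʳ : ∀ {N} lam (α : Vec ℕ N) a →
  tableauCount lam (suc N) (α Vec.∷ʳ a) ≡ ∑ (layer a lam) (λ μ → tableauCount μ N α)
tableauCount-∷ʳ {N} lam α a = trans
  (count-fibres P? _≟ˢ_ key (unique-layer a lam) (fillings (suc N) lam)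
    (λ T∈ p → proj₁ (proj₂ (lowerTableau-ofContent {α = α} (∈-fillings⁻ lam T∈) p))))
  (∑-cong (layer a lam) fibre)
  where
  P? = semistandardOfContent? (α Vec.∷ʳ a)
  key : Tableau (suc N) → List ℕ
  key T = map length (lowerTableau T)
  fibre : ∀ {μ} → μ ∈ layer a lam →
    count (λ T → P? T ×-dec (key T ≟ˢ μ)) (fillings (suc N) lam) ≡ tableauCount μ N α
  fibre {μ} μ∈ = count-bijection (λ T → P? T ×-dec (key T ≟ˢ μ)) (semistandardOfContent? α)
    (unique-fillings (suc N) lam) (unique-fillings N μ) lowerTableau (padTableau lam)
    (λ { {T} T∈ (p , refl) → let q , _ , inv = lowerTableau-ofContent {α = α} (∈-fillings⁻ lam T∈) p in
         ∈-fillings⁺ (lowerTableau T) , q , inv })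
    from
    where
    from : ∀ {T} → T ∈ fillings N μ → SemistandardOfContent α T →
      padTableau lam T ∈ fillings (suc N) lam ×
      (SemistandardOfContent (α Vec.∷ʳ a) (padTableau lam T) × key (padTableau lam T) ≡ μ) ×
      lowerTableau (padTableau lam T) ≡ T
    from {T} T∈ (sst , content) with refl ← ∈-fillings⁻ μ T∈ =
      let s , eq = ∈-layer⁻ lam μ∈
          inv    = lowerTableau-padTableau {lam = lam} {T} s
      in subst (λ z → padTableau lam T ∈ fillings (suc N) z) (length-padTableau s) (∈-fillings⁺ (padTableau lam T)) ,
         ((padTableau-semistandard s sst , content-padTableau⁺ {α = α} T s eq content) , cong (map length) inv) ,
         inv

tableauCount-[] : ∀ lam → tableauCount lam 0 [] ≡ kostka lam []
tableauCount-[] lam with sum lam ℕ.≟ 0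
... | no ne = trans (count-none (semistandardOfContent? []) (fillings 0 lam)
  (λ {T} T∈ _ → ne (trans (cong sum (sym (∈-fillings⁻ lam T∈))) (empty T))))
  (sym (𝟙-no (sum lam ℕ.≟ 0) ne))
  where
  empty : (T : Tableau 0) → sum (map length T) ≡ 0
  empty []       = refl
  empty ([] ∷ T) = empty T
... | yes eq = trans (count-bijection (semistandardOfContent? []) (λ (_ : ⊤) → yes tt) {ys = [ tt ]}
  (unique-fillings 0 lam) ([] ∷ []) (const tt) (const (map (const []) lam))
  (λ {T} T∈ _ → here refl , tt , rows lam T (∈-fillings⁻ lam T∈))
  (λ _ _ → subst (λ z → map (const []) lam ∈ fillings 0 z) (lengths lam eq) (∈-fillings⁺ (map (const []) lam)) ,
           ((sorted lam , columns lam) , λ ()) , refl))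
  (sym (𝟙-yes (sum lam ℕ.≟ 0) eq))
  where
  rows : ∀ lam (T : Tableau 0) → map length T ≡ lam → map (const []) lam ≡ T
  rows []        []       _  = refl
  rows (x ∷ lam) ([] ∷ T) eq = cong ([] ∷_) (rows lam T (Listₚ.∷-injectiveʳ eq))
  lengths : ∀ lam → sum lam ≡ 0 → map length (map (const (List.[] {A = Fin 0})) lam) ≡ lam
  lengths []        _  = refl
  lengths (x ∷ lam) eq = cong₂ _∷_ (sym (ℕₚ.m+n≡0⇒m≡0 x eq)) (lengths lam (ℕₚ.m+n≡0⇒n≡0 x eq))
  sorted : ∀ lam → All (Linked Fin._≤_) (map (const (List.[] {A = Fin 0})) lam)
  sorted []        = []
  sorted (x ∷ lam) = [] ∷ sorted lam
  columns : ∀ lam → Linked (λ upper lower → Prefix Fin._>_ lower upper) (map (const (List.[] {A = Fin 0})) lam)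
  columns []            = []
  columns (x ∷ [])      = [-]
  columns (x ∷ y ∷ lam) = [] ∷ columns (y ∷ lam)

tableauCount≡kostka : ∀ N lam (α : Vec ℕ N) → tableauCount lam N α ≡ kostka lam (toList α)
tableauCount≡kostka zero    lam []  = tableauCount-[] lam
tableauCount≡kostka (suc N) lam α with Vec.initLast α
... | α′ , a , refl = begin
  tableauCount lam (suc N) (α′ Vec.∷ʳ a)             ≡⟨ tableauCount-∷ʳ lam α′ a ⟩
  ∑ (layer a lam) (λ μ → tableauCount μ N α′)        ≡⟨ ∑-cong (layer a lam) (λ {μ} _ → tableauCount≡kostka N μ α′) ⟩
  -- Peeling off the largest letter puts its multiplicity first, whereas `toList α` has it last; the
  -- Bender-Knuth symmetry lets the order be changed.
  kostka lam (a ∷ toList α′)                         ≡⟨ kostka-↭ (Permₚ.∷↭∷ʳ a (toList α′)) lam ⟩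
  kostka lam (toList α′ ∷ʳ a)                        ≡⟨ cong (kostka lam) (Vecₚ.toList-∷ʳ a α′) ⟨
  kostka lam (toList (α′ Vec.∷ʳ a))                  ∎
  where open ≡-Reasoning

schur≡kostka : ∀ lam {N} (α : Vec ℕ N) → schur lam N α ≡ + kostka lam (toList α)
schur≡kostka lam {N} α = cong +_ (tableauCount≡kostka N lam α)

-- Chromatic symmetric functions

module _ {P : A → Set} {Q : B → Set} (P? : Decidable₁ P) (Q? : Decidable₁ Q) where

  -- For maps such as `Vec.map suc`, whose inverse is defined only on part of the codomain:
  -- preimages need only exist.
  count-image : {xs : List A} {ys : List B} → Unique xs → Unique ys →
    (f : B → A) → (∀ {y z} → f y ≡ f z → y ≡ z) →
    (∀ {x} → x ∈ xs → P x → ∃ λ y → y ∈ ys × Q y × f y ≡ x) →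
    (∀ {y} → y ∈ ys → Q y → f y ∈ xs × P (f y)) →
    count P? xs ≡ count Q? ys
  count-image {xs} {ys} uxs uys f inj from to = trans
    (Permₚ.↭-length (∼bag⇒↭ (unique∧set⇒bag (Uniqueₚ.filter⁺ P? uxs) (Uniqueₚ.map⁺ inj (Uniqueₚ.filter⁺ Q? uys))
      (mk⇔ into onto))))
    (Listₚ.length-map f (filter Q? ys))
    where
    into : ∀ {x} → x ∈ filter P? xs → x ∈ map f (filter Q? ys)
    into x∈ with x∈xs , px ← ∈ₚ.∈-filter⁻ P? {xs = xs} x∈
            with _ , y∈ , qy , refl ← from x∈xs px = ∈ₚ.∈-map⁺ f (∈ₚ.∈-filter⁺ Q? y∈ qy)
    onto : ∀ {x} → x ∈ map f (filter Q? ys) → x ∈ filter P? xs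
    onto x∈ with _ , y∈ , refl ← ∈ₚ.∈-map⁻ f x∈ =
      let y∈ys , qy = ∈ₚ.∈-filter⁻ Q? {xs = ys} y∈; fy∈ , pfy = to y∈ys qy in ∈ₚ.∈-filter⁺ P? fy∈ pfy

vec-map-injective : ∀ {f : A → B} → (∀ {x y} → f x ≡ f y → x ≡ y) →
  ∀ {n} {xs ys : Vec A n} → Vec.map f xs ≡ Vec.map f ys → xs ≡ ys
vec-map-injective inj {xs = []}     {[]}     _  = refl
vec-map-injective inj {xs = x ∷ xs} {y ∷ ys} eq =
  cong₂ _∷_ (inj (Vecₚ.∷-injectiveˡ eq)) (vec-map-injective inj (Vecₚ.∷-injectiveʳ eq))

ProperOfContent : ∀ G {N} → Vec ℕ N → Vec (Fin N) (order G) → Set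
ProperOfContent G α κ = Proper G κ × HasContent α (toList κ)

properOfContent? : ∀ G {N} (α : Vec ℕ N) → Decidable₁ (ProperOfContent G α)
properOfContent? G α κ = proper? G κ ×-dec hasContent? α (toList κ)

colouringCount : Graph → (N : ℕ) → Vec ℕ N → ℕ
colouringCount G N α = count (properOfContent? G α) (vectors (allFin N) (order G))

module _ (G : Graph) where

  proper-map : ∀ {M N} {f : Fin M → Fin N} → (∀ {i j} → f i ≡ f j → i ≡ j) →
    ∀ {κ} → Proper G κ → Proper G (Vec.map f κ)
  proper-map {f = f} inj {κ} proper u v uv eq = proper u v uv
    (inj (trans (sym (Vecₚ.lookup-map u f κ)) (trans eq (Vecₚ.lookup-map v f κ))))

  proper-unmap : ∀ {M N} {f : Fin M → Fin N} {κ} → Proper G (Vec.map f κ) → Proper G κ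
  proper-unmap {f = f} {κ} proper u v uv eq = proper u v uv
    (trans (Vecₚ.lookup-map u f κ) (trans (cong f eq) (sym (Vecₚ.lookup-map v f κ))))

  multiplicity-vec-map : ∀ {M N n} {f : Fin M → Fin N} → (∀ {i j} → f i ≡ f j → i ≡ j) →
    ∀ i (κ : Vec (Fin M) n) → multiplicity (f i) (toList (Vec.map f κ)) ≡ multiplicity i (toList κ)
  multiplicity-vec-map {f = f} inj i κ =
    trans (cong (multiplicity (f i)) (Vecₚ.toList-map f κ)) (multiplicity-map inj i (toList κ))

  colouringCount-permute : ∀ {M N} (σ : Permutation M N) {α β} →
    (∀ i → Vec.lookup α i ≡ Vec.lookup β (σ ⟨$⟩ʳ i)) → colouringCount G M α ≡ colouringCount G N β
  colouringCount-permute {M} {N} σ {α} {β} αβ = count-bijection (properOfContent? G α) (properOfContent? G β)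
    (unique-colourings M _) (unique-colourings N _) (Vec.map (σ ⟨$⟩ʳ_)) (Vec.map (σ ⟨$⟩ˡ_))
    (λ {κ} _ (proper , content) → ∈-vectors-allFin _ ,
      (proper-map to-injective {κ} proper , λ j → begin
        multiplicity j (toList (Vec.map to κ))              ≡⟨ cong (λ z → multiplicity z (toList (Vec.map to κ))) (Permutation.inverseʳ σ) ⟨
        multiplicity (to (from j)) (toList (Vec.map to κ))  ≡⟨ multiplicity-vec-map to-injective (from j) κ ⟩
        multiplicity (from j) (toList κ)                    ≡⟨ content (from j) ⟩
        Vec.lookup α (from j)                               ≡⟨ αβ (from j) ⟩
        Vec.lookup β (to (from j))                          ≡⟨ cong (Vec.lookup β) (Permutation.inverseʳ σ) ⟩
        Vec.lookup β j                                      ∎) ,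
      undo (λ _ → Permutation.inverseˡ σ) κ)
    (λ {κ} _ (proper , content) → ∈-vectors-allFin _ ,
      (proper-map from-injective {κ} proper , λ i → begin
        multiplicity i (toList (Vec.map from κ))              ≡⟨ cong (λ z → multiplicity z (toList (Vec.map from κ))) (Permutation.inverseˡ σ) ⟨
        multiplicity (from (to i)) (toList (Vec.map from κ))  ≡⟨ multiplicity-vec-map from-injective (to i) κ ⟩
        multiplicity (to i) (toList κ)                        ≡⟨ content (to i) ⟩
        Vec.lookup β (to i)                                   ≡⟨ αβ i ⟨
        Vec.lookup α i                                        ∎) ,
      undo (λ _ → Permutation.inverseʳ σ) κ)
    where
    open ≡-Reasoning
    to : Fin M → Fin N
    to = σ ⟨$⟩ʳ_
    from : Fin N → Fin M
    from = σ ⟨$⟩ˡ_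
    to-injective : ∀ {i j} → to i ≡ to j → i ≡ j
    to-injective eq = trans (sym (Permutation.inverseˡ σ)) (trans (cong from eq) (Permutation.inverseˡ σ))
    from-injective : ∀ {i j} → from i ≡ from j → i ≡ j
    from-injective eq = trans (sym (Permutation.inverseʳ σ)) (trans (cong to eq) (Permutation.inverseʳ σ))
    undo : ∀ {K L n} {f : Fin K → Fin L} {g : Fin L → Fin K} → (∀ i → g (f i) ≡ i) →
      (κ : Vec (Fin K) n) → Vec.map g (Vec.map f κ) ≡ κ
    undo {f = f} {g} gf κ = trans (sym (Vecₚ.map-∘ g f κ)) (trans (Vecₚ.map-cong gf κ) (Vecₚ.map-id κ))

  colourings : List ℕ → ℕ
  colourings xs = colouringCount G (length xs) (fromList xs)

  colouringCount-toList : ∀ {M N} (α : Vec ℕ M) (β : Vec ℕ N) → toList α ≡ toList β →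
    colouringCount G M α ≡ colouringCount G N β
  colouringCount-toList α β eq
    with refl ← trans (sym (Vecₚ.length-toList α)) (trans (cong length eq) (Vecₚ.length-toList β))
    = cong (colouringCount G _) (toList-injective α β eq)

  colouringCount≡colourings : ∀ {N} (α : Vec ℕ N) → colouringCount G N α ≡ colourings (toList α)
  colouringCount≡colourings α = colouringCount-toList α (fromList (toList α)) (sym (Vecₚ.toList∘fromList (toList α)))

  lookup-fromList : ∀ (xs : List A) i → Vec.lookup (fromList xs) i ≡ lookup xs i
  lookup-fromList (x ∷ xs) zero    = refl
  lookup-fromList (x ∷ xs) (suc i) = lookup-fromList xs i

  colourings-↭ : ∀ {xs ys} → xs ↭ ys → colourings xs ≡ colourings ys
  colourings-↭ {xs} {ys} p = colouringCount-permute (Homogeneous.onIndices q) {fromList xs} {fromList ys} λ i →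
    trans (lookup-fromList xs i) (trans (Permₛ.onIndices-lookup (setoid ℕ) q i) (sym (lookup-fromList ys _)))
    where q = Perm.↭⇒↭ₛ p

  colouringCount-0∷ : ∀ {N} (α : Vec ℕ N) → colouringCount G (suc N) (0 ∷ α) ≡ colouringCount G N α
  colouringCount-0∷ {N} α = count-image (properOfContent? G (0 ∷ α)) (properOfContent? G α)
    (unique-colourings (suc N) _) (unique-colourings N _) (Vec.map suc) (vec-map-injective Finₚ.suc-injective)
    (λ {κ} _ (proper , content) → case avoids κ (content zero) of λ { (κ′ , refl) →
      κ′ , ∈-vectors-allFin κ′ ,
      (proper-unmap {κ = κ′} proper ,
       λ i → trans (sym (multiplicity-vec-map Finₚ.suc-injective i κ′)) (content (suc i))) , refl })
    (λ {κ} _ (proper , content) → ∈-vectors-allFin _ ,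
      proper-map Finₚ.suc-injective {κ} proper ,
      λ { zero    → trans (cong (multiplicity zero) (Vecₚ.toList-map suc κ))
                          (multiplicity-∉ zero (map suc (toList κ)) (λ p → case ∈ₚ.∈-map⁻ suc p of λ ()))
        ; (suc i) → trans (multiplicity-vec-map Finₚ.suc-injective i κ) (content i) })
    where
    avoids : ∀ {n} (κ : Vec (Fin (suc N)) n) → multiplicity zero (toList κ) ≡ 0 → ∃ λ κ′ → Vec.map suc κ′ ≡ κ
    avoids []          _  = [] , refl
    avoids (zero  ∷ κ) ()
    avoids (suc i ∷ κ) eq = let κ′ , eq′ = avoids κ eq in i ∷ κ′ , cong (suc i ∷_) eq′

  colourings-zeros : ∀ k xs → colourings (replicate k 0 ++ xs) ≡ colourings xs
  colourings-zeros zero    xs = refl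
  colourings-zeros (suc k) xs = trans (colouringCount-0∷ (fromList (replicate k 0 ++ xs))) (colourings-zeros k xs)

∑-allFin-suc : ∀ {N} (f : Fin (suc N) → ℕ) → ∑ (allFin (suc N)) f ≡ f zero + ∑ (allFin N) (f ∘ suc)
∑-allFin-suc f = cong (λ xs → f zero + sum xs) (trans (Listₚ.map-tabulate suc f) (sym (Listₚ.map-tabulate id (f ∘ suc))))

∑-lookup : ∀ {N} (α : Vec ℕ N) → ∑ (allFin N) (Vec.lookup α) ≡ sum (toList α)
∑-lookup []      = refl
∑-lookup (a ∷ α) = trans (∑-allFin-suc (Vec.lookup (a ∷ α))) (cong (a ℕ.+_) (∑-lookup α))

∑-multiplicity : ∀ {N} (xs : List (Fin N)) → ∑ (allFin N) (λ i → multiplicity i xs) ≡ length xs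
∑-multiplicity {N} xs = begin
  ∑ (allFin N) (λ i → multiplicity i xs)           ≡⟨ ∑-cong (allFin N) (λ {i} _ → multiplicity-∑ i xs) ⟩
  ∑ (allFin N) (λ i → ∑ xs (λ x → 𝟙 (i Fin.≟ x)))  ≡⟨ ∑-swap (λ i x → 𝟙 (i Fin.≟ x)) (allFin N) xs ⟩
  ∑ xs (λ x → ∑ (allFin N) (λ i → 𝟙 (i Fin.≟ x)))  ≡⟨ ∑-cong xs (λ {x} _ → trans
                                                         (∑-single _ (Uniqueₚ.allFin⁺ N) (∈ₚ.∈-allFin x) (λ {i} _ → 𝟙-no (i Fin.≟ x)))
                                                         (𝟙-yes (x Fin.≟ x) refl)) ⟩
  ∑ xs (const 1)                                   ≡⟨ ∑-const xs 1 ⟩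
  length xs * 1                                    ≡⟨ ℕₚ.*-identityʳ (length xs) ⟩
  length xs                                        ∎
  where open ≡-Reasoning

content-sum : ∀ {N} (α : Vec ℕ N) xs → HasContent α xs → sum (toList α) ≡ length xs
content-sum {N} α xs h = trans (sym (∑-lookup α))
  (trans (∑-cong (allFin N) (λ {i} _ → sym (h i))) (∑-multiplicity xs))

colourings-sum : ∀ G xs → colourings G xs ≢ 0 → sum xs ≡ order G
colourings-sum G xs ne =
  let κ , _ , _ , content = count≢0 (properOfContent? G (fromList xs)) (vectors (allFin (length xs)) (order G)) ne
  in trans (cong sum (sym (Vecₚ.toList∘fromList xs)))
     (trans (content-sum (fromList xs) (toList κ) content) (Vecₚ.length-toList κ))

-- Schur expansions

∑ℤ : List A → (A → ℤ) → ℤ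
∑ℤ xs f = foldr ℤ._+_ 0ℤ (map f xs)

∑ℤ-cong : ∀ {f g : A → ℤ} xs → (∀ {x} → x ∈ xs → f x ≡ g x) → ∑ℤ xs f ≡ ∑ℤ xs g
∑ℤ-cong []       _   = refl
∑ℤ-cong (x ∷ xs) f≡g = cong₂ ℤ._+_ (f≡g (here refl)) (∑ℤ-cong xs (f≡g ∘ there))

∑ℤ-zero : ∀ {f : A → ℤ} xs → (∀ {x} → x ∈ xs → f x ≡ 0ℤ) → ∑ℤ xs f ≡ 0ℤ
∑ℤ-zero []       _ = refl
∑ℤ-zero (x ∷ xs) h = cong₂ ℤ._+_ (h (here refl)) (∑ℤ-zero xs (h ∘ there))

∑ℤ-single : ∀ (f : A → ℤ) {x xs} → Unique xs → x ∈ xs →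
  (∀ {y} → y ∈ xs → y ≢ x → f y ≡ 0ℤ) → ∑ℤ xs f ≡ f x
∑ℤ-single f {xs = _ ∷ xs} (x≢ ∷ _) (here refl) h = trans
  (cong (λ z → f _ ℤ.+ z) (∑ℤ-zero xs (λ y∈ → h (there y∈) (All.lookup x≢ y∈ ∘ sym))))
  (ℤₚ.+-identityʳ _)
∑ℤ-single f {xs = _ ∷ xs} (y≢ ∷ u) (there x∈) h = trans
  (cong₂ ℤ._+_ (h (here refl) (All.lookup y≢ x∈)) (∑ℤ-single f u x∈ (h ∘ there)))
  (ℤₚ.+-identityˡ _)

∑ℤ-+ : ∀ (f g : A → ℤ) xs → ∑ℤ xs (λ x → f x ℤ.+ g x) ≡ ∑ℤ xs f ℤ.+ ∑ℤ xs g
∑ℤ-+ f g []       = refl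
∑ℤ-+ f g (x ∷ xs) = trans (cong (λ z → (f x ℤ.+ g x) ℤ.+ z) (∑ℤ-+ f g xs))
  (regroup (f x) (g x) (∑ℤ xs f) (∑ℤ xs g))
  where
  regroup : ∀ a b c d → (a ℤ.+ b) ℤ.+ (c ℤ.+ d) ≡ (a ℤ.+ c) ℤ.+ (b ℤ.+ d)
  regroup = ℤ-Ring.solve-∀

∑ℤ-*ˡ : ∀ k (f : A → ℤ) xs → ∑ℤ xs (λ x → k ℤ.* f x) ≡ k ℤ.* ∑ℤ xs f
∑ℤ-*ˡ k f []       = sym (ℤₚ.*-zeroʳ k)
∑ℤ-*ˡ k f (x ∷ xs) = trans (cong (λ z → k ℤ.* f x ℤ.+ z) (∑ℤ-*ˡ k f xs)) (sym (ℤₚ.*-distribˡ-+ k (f x) (∑ℤ xs f)))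

∑ℤ-swap : ∀ (f : A → B → ℤ) xs ys → ∑ℤ xs (λ x → ∑ℤ ys (f x)) ≡ ∑ℤ ys (λ y → ∑ℤ xs (λ x → f x y))
∑ℤ-swap f []       ys = sym (∑ℤ-zero ys (λ _ → refl))
∑ℤ-swap f (x ∷ xs) ys = trans (cong (λ z → ∑ℤ ys (f x) ℤ.+ z) (∑ℤ-swap f xs ys)) (sym (∑ℤ-+ (f x) _ ys))

-- Unitriangular linear systems over the integers

module UnitriangularSystem
  {xs : List A} (unique : Unique xs) (K : A → A → ℕ) (w : A → ℕ)
  (diagonal : ∀ {a} → a ∈ xs → K a a ≡ 1)
  (triangular : ∀ {a b} → a ∈ xs → b ∈ xs → K a b ≢ 0 → w a < w b ⊎ a ≡ b)
  where

  private
    vanishes : ∀ {a b} → a ∈ xs → b ∈ xs → a ≢ b → w b ≤ w a → K a b ≡ 0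
    vanishes {a} {b} a∈ b∈ a≢b wb≤wa with K a b ℕ.≟ 0
    ... | yes eq = eq
    ... | no ne  = [ (λ wa<wb → contradiction wa<wb (ℕₚ.≤⇒≯ wb≤wa)) , (λ a≡b → contradiction a≡b a≢b) ]′ (triangular a∈ b∈ ne)

    combination : (A → ℤ) → A → ℤ
    combination c b = ∑ℤ xs (λ a → c a ℤ.* + K a b)

    diagonal-term : ∀ (c : A → ℤ) {b} → b ∈ xs →
      (∀ {a} → a ∈ xs → a ≢ b → w a < w b → c a ≡ 0ℤ) → combination c b ≡ c b
    diagonal-term c {b} b∈ h = trans
      (∑ℤ-single (λ a → c a ℤ.* + K a b) unique b∈ other)
      (trans (cong (λ k → c b ℤ.* + k) (diagonal b∈)) (ℤₚ.*-identityʳ (c b)))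
      where
      other : ∀ {a} → a ∈ xs → a ≢ b → c a ℤ.* + K a b ≡ 0ℤ
      other {a} a∈ a≢b with w a ℕ.<? w b
      ... | yes wa<wb = trans (cong (ℤ._* + K a b) (h a∈ a≢b wa<wb)) refl
      ... | no wa≮wb  = trans (cong (λ k → c a ℤ.* + k) (vanishes a∈ b∈ a≢b (ℕₚ.≮⇒≥ wa≮wb))) (ℤₚ.*-zeroʳ (c a))

  -- Induction on `w b`: once the coefficients of smaller weight vanish, the equation at `b` reduces
  -- to its diagonal term `c b`.
  kernel-trivial : ∀ c → (∀ {b} → b ∈ xs → combination c b ≡ 0ℤ) → ∀ {b} → b ∈ xs → c b ≡ 0ℤ
  kernel-trivial c h {b} b∈ = below (suc (w b)) b∈ ℕₚ.≤-refl
    where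
    below : ∀ n {b} → b ∈ xs → w b < n → c b ≡ 0ℤ
    below (suc n) b∈ (s≤s wb≤n) = trans
      (sym (diagonal-term c b∈ (λ a∈ _ wa<wb → below n a∈ (ℕₚ.<-≤-trans wa<wb wb≤n)))) (h b∈)

  solvable : ∀ (f : A → ℤ) → ∃ λ c → ∀ {b} → b ∈ xs → combination c b ≡ f b
  -- The sum of all weights bounds each of them, so these levels exhaust `xs`.
  solvable f = let c , h = below (suc (sum (map w xs))) in c , λ b∈ → h b∈ (s≤s (bound b∈))
    where
    bound : ∀ {b} → b ∈ xs → w b ≤ sum (map w xs)
    bound b∈ = go b∈
      where
      go : ∀ {b ys} → b ∈ ys → w b ≤ sum (map w ys)
      go (here refl)            = ℕₚ.m≤m+n _ _
      go {ys = y ∷ _} (there p) = ℕₚ.≤-trans (go p) (ℕₚ.m≤n+m _ (w y))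
    below : ∀ n → ∃ λ c → ∀ {b} → b ∈ xs → w b < n → combination c b ≡ f b
    below zero    = const 0ℤ , λ _ ()
    below (suc n) with below n
    ... | c , h = (λ a → c a ℤ.+ d a) , solved
      where
      d : A → ℤ
      -- The correction lives on weight `n` only. By triangularity it leaves the equations of
      -- smaller weight intact, and distinct entries of equal weight do not interact, so the whole
      -- level is repaired at once.
      d a = if does (w a ℕ.≟ n) then f a ℤ.- combination c a else 0ℤ
      d-zero : ∀ {a} → w a ≢ n → d a ≡ 0ℤ
      d-zero {a} ne rewrite dec-false (w a ℕ.≟ n) ne = refl
      d-residual : ∀ {a} → w a ≡ n → d a ≡ f a ℤ.- combination c a
      d-residual {a} eq rewrite dec-true (w a ℕ.≟ n) eq = refl
      split : ∀ b → combination (λ a → c a ℤ.+ d a) b ≡ combination c b ℤ.+ combination d b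
      split b = trans (∑ℤ-cong xs (λ {a} _ → ℤₚ.*-distribʳ-+ (+ K a b) (c a) (d a)))
                      (∑ℤ-+ (λ a → c a ℤ.* + K a b) _ xs)
      solved : ∀ {b} → b ∈ xs → w b < suc n → combination (λ a → c a ℤ.+ d a) b ≡ f b
      solved {b} b∈ (s≤s wb≤n) with
        trans (split b) (cong (λ z → combination c b ℤ.+ z)
          (diagonal-term d b∈ (λ _ _ wa<wb → d-zero (ℕₚ.<⇒≢ (ℕₚ.<-≤-trans wa<wb wb≤n)))))
        | ℕₚ.m≤n⇒m<n∨m≡n wb≤n
      ... | eq | inj₁ wb<n = trans eq (trans (cong₂ ℤ._+_ (h b∈ wb<n) (d-zero (ℕₚ.<⇒≢ wb<n))) (ℤₚ.+-identityʳ (f b)))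
      ... | eq | inj₂ wb≡n = trans eq (trans (cong (λ z → combination c b ℤ.+ z) (d-residual wb≡n))
                               (cancel (combination c b) (f b)))
        where
        cancel : ∀ x y → x ℤ.+ (y ℤ.- x) ≡ y
        cancel = ℤ-Ring.solve-∀

-- Enumeration of partitions and sorting of contents

∈-partitions⁻ : ∀ n {lam} → lam ∈ partitions n → IsPartition n lam
∈-partitions⁻ n lam∈ = proj₂ (∈ₚ.∈-filter⁻ (isPartition? n)
  {xs = concatMap (λ k → map toList (vectors (upTo (suc n)) k)) (upTo (suc n))} lam∈)

∈-partitions⁺ : ∀ {n lam} → IsPartition n lam → lam ∈ partitions n
∈-partitions⁺ {n} {lam} p@((_ , pos) , total) = ∈ₚ.∈-filter⁺ (isPartition? n) {xs = concatMap byLength (upTo (suc n))}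
  (∈ₚ.∈-concat⁺′ {xss = map byLength (upTo (suc n))}
    (subst (_∈ map toList (vectors (upTo (suc n)) (length lam))) (Vecₚ.toList∘fromList lam)
      (∈ₚ.∈-map⁺ toList (∈-vectors (fromList lam)
        (subst (All (_∈ upTo (suc n))) (sym (Vecₚ.toList∘fromList lam)) (bounded lam (ℕₚ.≤-reflexive total))))))
    (∈ₚ.∈-map⁺ byLength (∈ₚ.∈-upTo⁺ (s≤s (subst (length lam ≤_) total (length≤sum pos))))))
  p
  where
  byLength : ℕ → List (List ℕ)
  byLength k = map toList (vectors (upTo (suc n)) k)
  length≤sum : ∀ {lam} → All (1 ≤_) lam → length lam ≤ sum lam
  length≤sum []          = z≤n
  length≤sum (1≤x ∷ pos) = ℕₚ.+-mono-≤ 1≤x (length≤sum pos)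
  bounded : ∀ lam → sum lam ≤ n → All (_∈ upTo (suc n)) lam
  bounded []        _  = []
  bounded (x ∷ lam) le = ∈ₚ.∈-upTo⁺ (s≤s (ℕₚ.m+n≤o⇒m≤o x le)) ∷ bounded lam (ℕₚ.m+n≤o⇒n≤o x le)

unique-partitions : ∀ n → Unique (partitions n)
unique-partitions n = Uniqueₚ.filter⁺ (isPartition? n) (Uniqueₚ.concat⁺ {xss = map byLength (upTo (suc n))}
  (Allₚ.map⁺ (All.universal (λ k → Uniqueₚ.map⁺ (λ {x} {y} → toList-injective x y) (unique-vectors (Uniqueₚ.upTo⁺ (suc n)) k)) (upTo (suc n))))
  (AllPairsₚ.map⁺ (AllPairs.map disjoint (Uniqueₚ.upTo⁺ (suc n)))))
  where
  byLength : ℕ → List (List ℕ)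
  byLength k = map toList (vectors (upTo (suc n)) k)
  disjoint : ∀ {j k} → j ≢ k → ∀ {lam} →
    ¬ (lam ∈ map toList (vectors (upTo (suc n)) j) × lam ∈ map toList (vectors (upTo (suc n)) k))
  disjoint j≢k (p , q) with v , _ , refl ← ∈ₚ.∈-map⁻ toList p | v′ , _ , eq ← ∈ₚ.∈-map⁻ toList q =
    j≢k (trans (sym (Vecₚ.length-toList v)) (trans (cong length eq) (Vecₚ.length-toList v′)))

module KostkaSystem (n : ℕ) {xs : List (List ℕ)} (unique : Unique xs) (part : ∀ {lam} → lam ∈ xs → IsPartition n lam) =
  UnitriangularSystem unique kostka weight
    (λ {lam} lam∈ → kostka-diagonal (proj₁ (proj₁ (part lam∈))) lam (λ _ → refl))
    (λ {lam} {μ} lam∈ μ∈ ne → Sum.map₂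
      (λ (_ , lam≈μ) → ≈⇒≡ (proj₂ (proj₁ (part lam∈))) (proj₂ (proj₁ (part μ∈))) lam≈μ)
      (kostka-weight lam μ ne))

kostka-zeros : ∀ {lam} → Linked _≥_ lam → ∀ k xs → kostka lam (replicate k 0 ++ xs) ≡ kostka lam xs
kostka-zeros l zero    xs = refl
kostka-zeros l (suc k) xs = trans (kostka-0∷ l (replicate k 0 ++ xs)) (kostka-zeros l k xs)

module DescendingSort = Sort (Flip.decTotalOrder ℕₚ.≤-decTotalOrder)

sorted-content : ∀ xs → ∃₂ λ k μ → xs ↭ replicate k 0 ++ μ × IsPartition (sum xs) μ
sorted-content xs =
  let k , ys , p , pos = split xs
      q = DescendingSort.sort-↭ ys
      p′ = Perm.trans p (Permₚ.++⁺ˡ (replicate k 0) (↭-sym q))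
  in k , DescendingSort.sort ys , p′ ,
     (DescendingSort.sort-↗ ys , Permₚ.All-resp-↭ (↭-sym q) pos) ,
     sym (trans (Sumₚ.sum-↭ p′) (trans (Sumₚ.sum-++ (replicate k 0) _) (cong (ℕ._+ sum (DescendingSort.sort ys)) (zeros k))))
  where
  zeros : ∀ k → sum (replicate k 0) ≡ 0
  zeros zero    = refl
  zeros (suc k) = zeros k
  split : ∀ xs → ∃₂ λ k ys → xs ↭ replicate k 0 ++ ys × All (1 ≤_) ys
  split []           = 0 , [] , Perm.refl , []
  split (zero ∷ xs)  = let k , ys , p , pos = split xs in suc k , ys , Perm.prep 0 p , pos
  split (suc x ∷ xs) = let k , ys , p , pos = split xs in
    k , suc x ∷ ys , Perm.trans (Perm.prep (suc x) p) (↭-sym (Permₚ.shift (suc x) (replicate k 0) ys)) , z<s ∷ pos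

schurSum : (List ℕ → ℤ) → ℕ → List ℕ → ℤ
schurSum c n xs = ∑ℤ (partitions n) (λ lam → c lam ℤ.* + kostka lam xs)

schurSum≡ : ∀ c n {N} (α : Vec ℕ N) →
  foldr ℤ._+_ 0ℤ (map (λ lam → c lam ℤ.* schur lam N α) (partitions n)) ≡ schurSum c n (toList α)
schurSum≡ c n α = ∑ℤ-cong (partitions n) (λ {lam} _ → cong (c lam ℤ.*_) (schur≡kostka lam α))

module _ (G : Graph) where

  expansion⇒ : ∀ c → IsSchurExpansion G c → ∀ xs → + colourings G xs ≡ schurSum c (order G) xs
  expansion⇒ c h xs = trans (h (length xs) (fromList xs)) (trans (schurSum≡ c (order G) (fromList xs))
    (cong (schurSum c (order G)) (Vecₚ.toList∘fromList xs)))

  expansion⇐ : ∀ c → (∀ xs → + colourings G xs ≡ schurSum c (order G) xs) → IsSchurExpansion G c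
  expansion⇐ c h N α = trans (cong +_ (colouringCount≡colourings G α))
    (trans (h (toList α)) (sym (schurSum≡ c (order G) α)))

  -- The system is solved at partition contents alone. Every other content of sum n is a
  -- rearrangement of a partition padded with zeros, and both sides ignore order and zeros; if the
  -- sum is not n, both sides vanish.
  schurExpansion-exists : ∃ λ c → IsSchurExpansion G c
  schurExpansion-exists =
    let c , solved = KostkaSystem.solvable n (unique-partitions n) (λ lam∈ → ∈-partitions⁻ n lam∈) (λ μ → + colourings G μ)
    in c , expansion⇐ c (expand c solved)
    where
    n = order G
    expand : ∀ c → (∀ {μ} → μ ∈ partitions n → schurSum c n μ ≡ + colourings G μ) →
      ∀ xs → + colourings G xs ≡ schurSum c n xs
    expand c solved xs with sum xs ℕ.≟ n
    ... | no ne = trans (cong +_ vanish) (sym (∑ℤ-zero (partitions n) (λ {lam} lam∈ →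
                    trans (cong (λ k → c lam ℤ.* + k) (vanish′ lam∈)) (ℤₚ.*-zeroʳ (c lam)))))
      where
      vanish : colourings G xs ≡ 0
      vanish with colourings G xs ℕ.≟ 0
      ... | yes z = z
      ... | no nz = contradiction (colourings-sum G xs nz) ne
      vanish′ : ∀ {lam} → lam ∈ partitions n → kostka lam xs ≡ 0
      vanish′ {lam} lam∈ with kostka lam xs ℕ.≟ 0
      ... | yes z = z
      ... | no nz = contradiction (trans (sym (kostka-sum lam xs nz)) (proj₂ (∈-partitions⁻ n lam∈))) ne
    ... | yes refl with sorted-content xs
    ... | k , μ , p , isP = begin
      + colourings G xs                     ≡⟨ cong +_ (trans (colourings-↭ G p) (colourings-zeros G k μ)) ⟩
      + colourings G μ                      ≡⟨ solved (∈-partitions⁺ isP) ⟨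
      schurSum c n μ                        ≡⟨ ∑ℤ-cong (partitions n) (λ {lam} lam∈ → cong (λ z → c lam ℤ.* + z)
                                                 (sym (trans (kostka-↭ p lam) (kostka-zeros (proj₁ (proj₁ (∈-partitions⁻ n lam∈))) k μ)))) ⟩
      schurSum c n xs                       ∎
      where open ≡-Reasoning

  -- The Kostka matrix restricted to shapes with fewer than t rows is still unitriangular.
  coefficient-vanishes : ∀ c → IsSchurExpansion G c → ∀ t → (∀ xs → length xs < t → colourings G xs ≡ 0) →
    ∀ {lam} → IsPartition (order G) lam → length lam < t → c lam ≡ 0ℤ
  coefficient-vanishes c h t few {lam} isP lam<t =
    KostkaSystem.kernel-trivial n unique (proj₁ ∘ ∈-short⁻) c combination-zero (∈ₚ.∈-filter⁺ short? (∈-partitions⁺ isP) lam<t)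
    where
    n = order G
    short? : Decidable₁ (λ (lam : List ℕ) → length lam < t)
    short? lam = length lam ℕ.<? t
    short : List (List ℕ)
    short = filter short? (partitions n)
    unique : Unique short
    unique = Uniqueₚ.filter⁺ short? (unique-partitions n)
    ∈-short⁻ : ∀ {lam} → lam ∈ short → IsPartition n lam × length lam < t
    ∈-short⁻ lam∈ = let lam∈′ , lt = ∈ₚ.∈-filter⁻ short? {xs = partitions n} lam∈ in ∈-partitions⁻ n lam∈′ , lt
    ∑ℤ-filter : ∀ (f : List ℕ → ℤ) xs → (∀ {x} → x ∈ xs → ¬ length x < t → f x ≡ 0ℤ) →
      ∑ℤ (filter short? xs) f ≡ ∑ℤ xs f
    ∑ℤ-filter f []       _ = refl
    ∑ℤ-filter f (x ∷ xs) z with length x ℕ.<? t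
    ... | yes lt = trans (cong (λ ys → ∑ℤ ys f) (Listₚ.filter-accept short? lt))
                     (cong (λ y → f x ℤ.+ y) (∑ℤ-filter f xs (z ∘ there)))
    ... | no ge  = trans (cong (λ ys → ∑ℤ ys f) (Listₚ.filter-reject short? ge))
                     (trans (∑ℤ-filter f xs (z ∘ there))
                       (trans (sym (ℤₚ.+-identityˡ _)) (cong (ℤ._+ ∑ℤ xs f) (sym (z (here refl) ge)))))
    combination-zero : ∀ {μ} → μ ∈ short → ∑ℤ short (λ lam → c lam ℤ.* + kostka lam μ) ≡ 0ℤ
    combination-zero {μ} μ∈ =
      let _ , μ<t = ∈-short⁻ μ∈ in
      trans (∑ℤ-filter (λ lam → c lam ℤ.* + kostka lam μ) (partitions n) (λ {lam} lam∈ ge →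
        trans (cong (λ k → c lam ℤ.* + k)
          (kostka-too-long μ (proj₂ (proj₁ (∈-partitions⁻ n lam∈))) (ℕₚ.<-≤-trans μ<t (ℕₚ.≮⇒≥ ge))))
          (ℤₚ.*-zeroʳ (c lam))))
      (trans (sym (expansion⇒ c h μ)) (cong +_ (few μ μ<t)))

-- Colourings of complete graphs

unique? : ∀ {N} (xs : List (Fin N)) → Dec (Unique xs)
unique? = DecUnique.unique? Fin._≟_

_∈F?_ : ∀ {N} (x : Fin N) xs → Dec (x ∈ xs)
_∈F?_ = DecMembership._∈?_ Fin._≟_

∑-vectors-suc : ∀ (as : List A) {k} (f : Vec A (suc k) → ℕ) →
  ∑ (vectors as (suc k)) f ≡ ∑ as (λ x → ∑ (vectors as k) (λ v → f (x ∷ v)))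
∑-vectors-suc as f = ∑-cartesianProductWith f _∷_ as (vectors as _)

∑-vectors-+ : ∀ (as : List A) m {n} (f : Vec A (m + n) → ℕ) →
  ∑ (vectors as (m + n)) f ≡ ∑ (vectors as m) (λ v → ∑ (vectors as n) (λ v′ → f (v Vec.++ v′)))
∑-vectors-+ as zero    f = sym (ℕₚ.+-identityʳ _)
∑-vectors-+ as (suc m) {n} f = begin
  ∑ (vectors as (suc m + n)) f                                  ≡⟨ ∑-vectors-suc as f ⟩
  ∑ as (λ x → ∑ (vectors as (m + n)) (λ v → f (x ∷ v)))         ≡⟨ ∑-cong as (λ {x} _ → ∑-vectors-+ as m (λ v → f (x ∷ v))) ⟩
  ∑ as (λ x → ∑ (vectors as m) (λ v → g (x ∷ v)))               ≡⟨ ∑-vectors-suc as g ⟨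
  ∑ (vectors as (suc m)) g                                      ∎
  where
  open ≡-Reasoning
  g : Vec _ (suc m) → ℕ
  g v = ∑ (vectors as n) (λ v′ → f (v Vec.++ v′))

unique-multiplicity : ∀ {N} {i : Fin N} {xs} → Unique xs → i ∈ xs → multiplicity i xs ≡ 1
unique-multiplicity {i = i} {xs} u i∈ = trans (multiplicity-∑ i xs) (trans
  (∑-single _ u i∈ (λ {y} _ y≢i → 𝟙-no (i Fin.≟ y) (y≢i ∘ sym)))
  (𝟙-yes (i Fin.≟ i) refl))

unique-full : ∀ {N} {xs : List (Fin N)} → Unique xs → length xs ≡ N → ∀ i → i ∈ xs
unique-full {N} {xs} u len i with i ∈F? xs
... | yes i∈ = i∈
... | no i∉  = contradiction
  (Finₚ.injective⇒≤ {f = lookup (i ∷ xs)} (lookup-injective (All.tabulate (λ {y} y∈ i≡y → i∉ (subst (_∈ xs) (sym i≡y) y∈)) ∷ u)))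
  (ℕₚ.<⇒≱ (s≤s (ℕₚ.≤-reflexive (sym len))))

module _ (N : ℕ) where

  Injection? : ∀ {k} → Decidable₁ (λ (v : Vec (Fin N) k) → Unique (toList v))
  Injection? v = unique? (toList v)

  injectionCount : ℕ → ℕ
  injectionCount k = count Injection? (vectors (allFin N) k)

  count-∉ : ∀ {k} (v : Vec (Fin N) k) → Unique (toList v) → count (λ x → ¬? (x ∈F? toList v)) (allFin N) + k ≡ N
  count-∉ {k} v u = begin
    count ∉? (allFin N) + k                                       ≡⟨ cong₂ _+_ (count-∑ ∉? (allFin N)) (sym (trans (∑-multiplicity (toList v)) (Vecₚ.length-toList v))) ⟩
    ∑ (allFin N) (𝟙 ∘ ∉?) + ∑ (allFin N) (λ x → multiplicity x (toList v))  ≡⟨ ∑-+ (𝟙 ∘ ∉?) _ (allFin N) ⟨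
    ∑ (allFin N) (λ x → 𝟙 (∉? x) + multiplicity x (toList v))     ≡⟨ ∑-cong (allFin N) (λ {x} _ → complement x) ⟩
    ∑ (allFin N) (const 1)                                        ≡⟨ ∑-const (allFin N) 1 ⟩
    length (allFin N) * 1                                         ≡⟨ trans (ℕₚ.*-identityʳ _) (Listₚ.length-tabulate id) ⟩
    N                                                             ∎
    where
    open ≡-Reasoning
    ∉? : Decidable₁ (_∉ toList v)
    ∉? x = ¬? (x ∈F? toList v)
    complement : ∀ x → 𝟙 (∉? x) + multiplicity x (toList v) ≡ 1
    complement x with x ∈F? toList v
    ... | yes x∈ = unique-multiplicity u x∈
    ... | no x∉  = cong suc (multiplicity-∉ x (toList v) x∉)

  injectionCount-suc : ∀ k → injectionCount (suc k) ≡ injectionCount k * (N ∸ k)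
  injectionCount-suc k = begin
    injectionCount (suc k)                                                              ≡⟨ count-∑ Injection? (vectors (allFin N) (suc k)) ⟩
    ∑ (vectors (allFin N) (suc k)) (𝟙 ∘ Injection?)                                     ≡⟨ ∑-vectors-suc (allFin N) (𝟙 ∘ Injection?) ⟩
    ∑ (allFin N) (λ x → ∑ (vectors (allFin N) k) (λ v → 𝟙 (Injection? (x ∷ v))))        ≡⟨ ∑-swap (λ x v → 𝟙 (Injection? (x ∷ v))) (allFin N) (vectors (allFin N) k) ⟩
    ∑ (vectors (allFin N) k) (λ v → ∑ (allFin N) (λ x → 𝟙 (Injection? (x ∷ v))))        ≡⟨ ∑-cong (vectors (allFin N) k) (λ {v} _ → step v) ⟩
    ∑ (vectors (allFin N) k) (λ v → 𝟙 (Injection? v) * (N ∸ k))                         ≡⟨ ∑-*ʳ (𝟙 ∘ Injection?) (N ∸ k) (vectors (allFin N) k) ⟩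
    ∑ (vectors (allFin N) k) (𝟙 ∘ Injection?) * (N ∸ k)                                 ≡⟨ cong (ℕ._* (N ∸ k)) (count-∑ Injection? (vectors (allFin N) k)) ⟨
    injectionCount k * (N ∸ k)                                                          ∎
    where
    open ≡-Reasoning
    step : ∀ v → ∑ (allFin N) (λ x → 𝟙 (Injection? (x ∷ v))) ≡ 𝟙 (Injection? v) * (N ∸ k)
    step v = [ injective , notInjective ]′ (toSum (Injection? v))
      where
      notInjective : ¬ Unique (toList v) → ∑ (allFin N) (λ x → 𝟙 (Injection? (x ∷ v))) ≡ 𝟙 (Injection? v) * (N ∸ k)
      notInjective ¬u = trans
        (trans (∑-cong (allFin N) (λ {x} _ → 𝟙-no (Injection? (x ∷ v)) (λ { (_ ∷ u) → ¬u u }))) (∑-zero (allFin N)))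
        (cong (ℕ._* (N ∸ k)) (sym (𝟙-no (Injection? v) ¬u)))
      injective : Unique (toList v) → ∑ (allFin N) (λ x → 𝟙 (Injection? (x ∷ v))) ≡ 𝟙 (Injection? v) * (N ∸ k)
      injective u = begin
        ∑ (allFin N) (λ x → 𝟙 (Injection? (x ∷ v)))            ≡⟨ ∑-cong (allFin N) (λ {x} _ → 𝟙-⇔ (Injection? (x ∷ v)) (¬? (x ∈F? toList v))
                                                                   (λ { (x≢ ∷ _) x∈ → All.lookup x≢ x∈ refl })
                                                                   (λ x∉ → All.tabulate (λ y∈ x≡y → x∉ (subst (_∈ toList v) (sym x≡y) y∈)) ∷ u)) ⟩
        ∑ (allFin N) (λ x → 𝟙 (¬? (x ∈F? toList v)))           ≡⟨ count-∑ (λ x → ¬? (x ∈F? toList v)) (allFin N) ⟨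
        count (λ x → ¬? (x ∈F? toList v)) (allFin N)           ≡⟨ ℕₚ.m+n∸n≡m _ k ⟨
        count (λ x → ¬? (x ∈F? toList v)) (allFin N) + k ∸ k   ≡⟨ cong (_∸ k) (count-∉ v u) ⟩
        N ∸ k                                                  ≡⟨ ℕₚ.*-identityˡ (N ∸ k) ⟨
        1 * (N ∸ k)                                            ≡⟨ cong (ℕ._* (N ∸ k)) (𝟙-yes (Injection? v) u) ⟨
        𝟙 (Injection? v) * (N ∸ k)                             ∎

  -- The falling factorial N!/(N-k)!, stated without division.
  injectionCount-! : ∀ k → k ≤ N → injectionCount k * (N ∸ k) ! ≡ N !
  injectionCount-! zero    _   = ℕₚ.+-identityʳ (N !)
  injectionCount-! (suc k) k<N = begin
    injectionCount (suc k) * (N ∸ suc k) !        ≡⟨ cong (ℕ._* (N ∸ suc k) !) (injectionCount-suc k) ⟩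
    injectionCount k * (N ∸ k) * (N ∸ suc k) !    ≡⟨ ℕₚ.*-assoc (injectionCount k) (N ∸ k) _ ⟩
    injectionCount k * ((N ∸ k) * (N ∸ suc k) !)  ≡⟨ cong (injectionCount k ℕ.*_) (unfold (N ∸ k) (N ∸ suc k) (ℕₚ.+-∸-assoc 1 k<N)) ⟩
    injectionCount k * (N ∸ k) !                  ≡⟨ injectionCount-! k (ℕₚ.<⇒≤ k<N) ⟩
    N !                                           ∎
    where
    open ≡-Reasoning
    unfold : ∀ a b → a ≡ suc b → a * b ! ≡ a !
    unfold _ b refl = refl

  permutationCount : injectionCount N ≡ N !
  permutationCount = trans (sym (ℕₚ.*-identityʳ _))
    (trans (cong (λ z → injectionCount N * z !) (sym (ℕₚ.n∸n≡0 N))) (injectionCount-! N ℕₚ.≤-refl))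

module _ {N : ℕ} (w : Fin N) where

  Fixing? : ∀ c → Decidable₁ (λ (v : Vec (Fin N) N) → Unique (toList v) × Vec.lookup v w ≡ c)
  Fixing? c v = Injection? N v ×-dec (Vec.lookup v w Fin.≟ c)

  Avoiding? : ∀ c → Decidable₁ (λ (v : Vec (Fin N) N) → Unique (toList v) × Vec.lookup v w ≢ c)
  Avoiding? c v = Injection? N v ×-dec ¬? (Vec.lookup v w Fin.≟ c)

  fixingCount avoidingCount : Fin N → ℕ
  fixingCount c = count (Fixing? c) (vectors (allFin N) N)
  avoidingCount c = count (Avoiding? c) (vectors (allFin N) N)

  -- Composing with the transposition of `c` and `c′` exchanges the two families. Hence all N
  -- prescribed values at `w` are taken equally often, by N!/N bijections each.
  fixingCount-constant : ∀ c c′ → fixingCount c ≡ fixingCount c′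
  fixingCount-constant c c′ = count-bijection (Fixing? c) (Fixing? c′)
    (unique-colourings N N) (unique-colourings N N) (Vec.map (τ c c′)) (Vec.map (τ c′ c))
    (λ {v} _ → exchange c c′ v) (λ {v} _ → exchange c′ c v)
    where
    τ : Fin N → Fin N → Fin N → Fin N
    τ = Transposition.transpose
    τ-inverse : ∀ a b i → τ b a (τ a b i) ≡ i
    τ-inverse a b i = Transposition.transpose-inverse b a
    τ-match : ∀ a b → τ a b a ≡ b
    τ-match a b rewrite dec-true (a Fin.≟ a) refl = refl
    exchange : ∀ a b v → Unique (toList v) × Vec.lookup v w ≡ a →
      Vec.map (τ a b) v ∈ vectors (allFin N) N ×
      (Unique (toList (Vec.map (τ a b) v)) × Vec.lookup (Vec.map (τ a b) v) w ≡ b) ×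
      Vec.map (τ b a) (Vec.map (τ a b) v) ≡ v
    exchange a b v (u , eq) = ∈-vectors-allFin (Vec.map (τ a b) v) ,
      (subst Unique (sym (Vecₚ.toList-map (τ a b) v))
         (Uniqueₚ.map⁺ (λ {i} {j} e → trans (sym (τ-inverse a b i)) (trans (cong (τ b a) e) (τ-inverse a b j))) u) ,
       trans (Vecₚ.lookup-map w (τ a b) v) (trans (cong (τ a b) eq) (τ-match a b))) ,
      trans (sym (Vecₚ.map-∘ (τ b a) (τ a b) v)) (trans (Vecₚ.map-cong (τ-inverse a b) v) (Vecₚ.map-id v))

  fixingCount-total : ∀ c → N * fixingCount c ≡ N !
  fixingCount-total c = begin
    N * fixingCount c                     ≡⟨ cong (ℕ._* fixingCount c) (Listₚ.length-tabulate {n = N} id) ⟨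
    length (allFin N) * fixingCount c     ≡⟨ ∑-const (allFin N) (fixingCount c) ⟨
    ∑ (allFin N) (const (fixingCount c))  ≡⟨ ∑-cong (allFin N) (λ {c′} _ → fixingCount-constant c c′) ⟩
    ∑ (allFin N) fixingCount              ≡⟨ count-fibres (Injection? N) Fin._≟_ (λ v → Vec.lookup v w) (Uniqueₚ.allFin⁺ N)
                                               (vectors (allFin N) N) (λ {v} _ _ → ∈ₚ.∈-allFin (Vec.lookup v w)) ⟨
    injectionCount N N                    ≡⟨ permutationCount N ⟩
    N !                                   ∎
    where open ≡-Reasoning

  avoiding+fixing : ∀ c → avoidingCount c + fixingCount c ≡ N !
  avoiding+fixing c = begin
    avoidingCount c + fixingCount c                        ≡⟨ cong₂ _+_ (count-∑ (Avoiding? c) vs) (count-∑ (Fixing? c) vs) ⟩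
    ∑ vs (𝟙 ∘ Avoiding? c) + ∑ vs (𝟙 ∘ Fixing? c)          ≡⟨ ∑-+ (𝟙 ∘ Avoiding? c) (𝟙 ∘ Fixing? c) vs ⟨
    ∑ vs (λ v → 𝟙 (Avoiding? c v) + 𝟙 (Fixing? c v))       ≡⟨ ∑-cong vs (λ {v} _ → exclusive v) ⟩
    ∑ vs (𝟙 ∘ Injection? N)                                ≡⟨ count-∑ (Injection? N) vs ⟨
    injectionCount N N                                     ≡⟨ permutationCount N ⟩
    N !                                                    ∎
    where
    open ≡-Reasoning
    vs = vectors (allFin N) N
    exclusive : ∀ v → 𝟙 (Avoiding? c v) + 𝟙 (Fixing? c v) ≡ 𝟙 (Injection? N v)
    exclusive v with Injection? N v | Vec.lookup v w Fin.≟ c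
    ... | yes _ | yes _ = refl
    ... | yes _ | no _  = refl
    ... | no _  | _     = refl

-- (m+1)! - m! = m · m!. With m = t-1 this is the factor (t-1)(t-1)!, and it does not depend on the
-- forbidden colour.
avoidingCount-! : ∀ {m} (w c : Fin (suc m)) → avoidingCount w c ≡ m * m !
avoidingCount-! {m} w c = ℕₚ.+-cancelʳ-≡ (m !) _ _ (trans
  (cong (avoidingCount w c ℕ.+_) (sym (ℕₚ.*-cancelˡ-≡ (fixingCount w c) (m !) (suc m) (fixingCount-total w c))))
  (trans (avoiding+fixing w c) (ℕₚ.+-comm (m !) (m * m !))))

proper-complete⇒unique : ∀ {N t} (κ : Vec (Fin N) t) → Proper (complete t) κ → Unique (toList κ)
proper-complete⇒unique κ proper = subst Unique (tabulate-lookup κ)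
  (Uniqueₚ.tabulate⁺ (λ {i} {j} eq → decidable-stable (i Fin.≟ j) (λ i≢j → proper i j i≢j eq)))
  where
  tabulate-lookup : ∀ {n} (v : Vec A n) → List.tabulate (Vec.lookup v) ≡ toList v
  tabulate-lookup []      = refl
  tabulate-lookup (x ∷ v) = cong (x ∷_) (tabulate-lookup v)

lookup∈toList : ∀ {n} (v : Vec A n) i → Vec.lookup v i ∈ toList v
lookup∈toList (x ∷ v) zero    = here refl
lookup∈toList (x ∷ v) (suc i) = there (lookup∈toList v i)

unique⇒proper-complete : ∀ {N t} (κ : Vec (Fin N) t) → Unique (toList κ) → Proper (complete t) κ
unique⇒proper-complete (x ∷ κ) (x≢ ∷ u) zero    zero    i≢j = contradiction refl i≢j
unique⇒proper-complete (x ∷ κ) (x≢ ∷ u) zero    (suc j) _   = All.lookup x≢ (lookup∈toList κ j)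
unique⇒proper-complete (x ∷ κ) (x≢ ∷ u) (suc i) zero    _   = All.lookup x≢ (lookup∈toList κ i) ∘ sym
unique⇒proper-complete (x ∷ κ) (x≢ ∷ u) (suc i) (suc j) i≢j =
  unique⇒proper-complete κ u i j (i≢j ∘ cong suc)

-- A graph joined by an edge to a complete graph

module JoinComplete (G : Graph) (t : ℕ) (u : Vertex G) (w : Fin t) where

  open JoinByEdge G (complete t) u w using (SumAdj)

  J : Graph
  J = joinByEdge G (complete t) u w

  m : ℕ
  m = order G

  adj-split⁺ : ∀ {x y x′ y′} → splitAt m x ≡ x′ → splitAt m y ≡ y′ → SumAdj x′ y′ → Adj J x y
  adj-split⁺ refl refl a = a

  module _ {N : ℕ} (κ₁ : Vec (Fin N) m) (κ₂ : Vec (Fin N) t) where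

    κ : Vec (Fin N) (m + t)
    κ = κ₁ Vec.++ κ₂

    proper-++⁻ : Proper J κ → Proper G κ₁ × Proper (complete t) κ₂ × Vec.lookup κ₂ w ≢ Vec.lookup κ₁ u
    proper-++⁻ proper =
      (λ i j a eq → proper (i ↑ˡ t) (j ↑ˡ t) (adj-split⁺ (Finₚ.splitAt-↑ˡ m i t) (Finₚ.splitAt-↑ˡ m j t) a)
        (trans (Vecₚ.lookup-++ˡ κ₁ κ₂ i) (trans eq (sym (Vecₚ.lookup-++ˡ κ₁ κ₂ j))))) ,
      (λ i j a eq → proper (m ↑ʳ i) (m ↑ʳ j) (adj-split⁺ (Finₚ.splitAt-↑ʳ m t i) (Finₚ.splitAt-↑ʳ m t j) a)
        (trans (Vecₚ.lookup-++ʳ κ₁ κ₂ i) (trans eq (sym (Vecₚ.lookup-++ʳ κ₁ κ₂ j))))) ,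
      (λ eq → proper (m ↑ʳ w) (u ↑ˡ t) (adj-split⁺ (Finₚ.splitAt-↑ʳ m t w) (Finₚ.splitAt-↑ˡ m u t) (refl , refl))
        (trans (Vecₚ.lookup-++ʳ κ₁ κ₂ w) (trans eq (sym (Vecₚ.lookup-++ˡ κ₁ κ₂ u)))))

    proper-++⁺ : Proper G κ₁ → Proper (complete t) κ₂ → Vec.lookup κ₂ w ≢ Vec.lookup κ₁ u → Proper J κ
    proper-++⁺ p₁ p₂ w≢u x y a eq = onSum (splitAt m x) (splitAt m y) a
      (trans (sym (Vecₚ.lookup-splitAt m κ₁ κ₂ x)) (trans eq (Vecₚ.lookup-splitAt m κ₁ κ₂ y)))
      where
      colour : Fin m ⊎ Fin t → Fin N
      colour = [ Vec.lookup κ₁ , Vec.lookup κ₂ ]′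
      onSum : ∀ x y → SumAdj x y → colour x ≢ colour y
      onSum (inj₁ i) (inj₁ j) a             = p₁ i j a
      onSum (inj₂ i) (inj₂ j) a             = p₂ i j a
      onSum (inj₁ i) (inj₂ j) (refl , refl) = w≢u ∘ sym
      onSum (inj₂ i) (inj₁ j) (refl , refl) = w≢u

  few-colours : ∀ xs → length xs < t → colourings J xs ≡ 0
  few-colours xs lt with colourings J xs ℕ.≟ 0
  ... | yes z = z
  ... | no ne with count≢0 (properOfContent? J (fromList xs)) (vectors (allFin (length xs)) (m + t)) ne
  ... | κ , _ , proper , _ with Vec.splitAt m κ
  ... | κ₁ , κ₂ , refl = contradiction
    (Finₚ.injective⇒≤ {f = Vec.lookup κ₂} (λ {i} {j} eq → decidable-stable (i Fin.≟ j)
      (λ i≢j → proj₁ (proj₂ (proper-++⁻ κ₁ κ₂ proper)) i j i≢j eq)))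
    (ℕₚ.<⇒≱ lt)

  module _ (β : Vec ℕ t) where

    multiplicity-join : ∀ (κ₁ : Vec (Fin t) m) κ₂ → Unique (toList κ₂) → ∀ i →
      multiplicity i (toList (κ₁ Vec.++ κ₂)) ≡ suc (multiplicity i (toList κ₁))
    multiplicity-join κ₁ κ₂ u i = begin
      multiplicity i (toList (κ₁ Vec.++ κ₂))                     ≡⟨ cong (multiplicity i) (Vecₚ.toList-++ κ₁ κ₂) ⟩
      multiplicity i (toList κ₁ ++ toList κ₂)                    ≡⟨ multiplicity-++ i (toList κ₁) (toList κ₂) ⟩
      multiplicity i (toList κ₁) + multiplicity i (toList κ₂)    ≡⟨ cong (multiplicity i (toList κ₁) ℕ.+_)
                                                                      (unique-multiplicity u (unique-full u (Vecₚ.length-toList κ₂) i)) ⟩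
      multiplicity i (toList κ₁) + 1                             ≡⟨ ℕₚ.+-comm _ 1 ⟩
      suc (multiplicity i (toList κ₁))                           ∎
      where open ≡-Reasoning

    -- The clique uses every one of the t colours exactly once.
    colouringCount-join : ∀ {d} → (∀ c → avoidingCount w c ≡ d) →
      colouringCount J t (Vec.map suc β) ≡ colouringCount G t β * d
    colouringCount-join {d} avoiding = begin
      colouringCount J t (Vec.map suc β)                                  ≡⟨ count-∑ J? (vectors (allFin t) (m + t)) ⟩
      ∑ (vectors (allFin t) (m + t)) (𝟙 ∘ J?)                             ≡⟨ ∑-vectors-+ (allFin t) m (𝟙 ∘ J?) ⟩
      ∑ κ₁s (λ κ₁ → ∑ κ₂s (λ κ₂ → 𝟙 (J? (κ₁ Vec.++ κ₂))))                ≡⟨ ∑-cong κ₁s (λ {κ₁} _ → inner κ₁) ⟩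
      ∑ κ₁s (λ κ₁ → 𝟙 (properOfContent? G β κ₁) * d)                      ≡⟨ ∑-*ʳ (𝟙 ∘ properOfContent? G β) d κ₁s ⟩
      ∑ κ₁s (𝟙 ∘ properOfContent? G β) * d                                ≡⟨ cong (ℕ._* d) (count-∑ (properOfContent? G β) κ₁s) ⟨
      colouringCount G t β * d                                            ∎
      where
      open ≡-Reasoning
      J? = properOfContent? J (Vec.map suc β)
      κ₁s = vectors (allFin t) m
      κ₂s = vectors (allFin t) t
      inner : ∀ κ₁ → ∑ κ₂s (λ κ₂ → 𝟙 (J? (κ₁ Vec.++ κ₂))) ≡ 𝟙 (properOfContent? G β κ₁) * d
      inner κ₁ = begin
        ∑ κ₂s (λ κ₂ → 𝟙 (J? (κ₁ Vec.++ κ₂)))                        ≡⟨ ∑-cong κ₂s (λ {κ₂} _ → trans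
                                                                        (𝟙-⇔ (J? (κ₁ Vec.++ κ₂)) (G? ×-dec A? κ₂) (to κ₂) (from κ₂))
                                                                        (𝟙-× G? (A? κ₂))) ⟩
        ∑ κ₂s (λ κ₂ → 𝟙 G? * 𝟙 (A? κ₂))                             ≡⟨ ∑-*ˡ (𝟙 ∘ A?) (𝟙 G?) κ₂s ⟩
        𝟙 G? * ∑ κ₂s (𝟙 ∘ A?)                                       ≡⟨ cong (𝟙 G? ℕ.*_) (trans (sym (count-∑ A? κ₂s)) (avoiding (Vec.lookup κ₁ u))) ⟩
        𝟙 G? * d                                                    ∎
        where
        G? = properOfContent? G β κ₁
        A? = Avoiding? w (Vec.lookup κ₁ u)
        to : ∀ κ₂ → ProperOfContent J (Vec.map suc β) (κ₁ Vec.++ κ₂) →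
          ProperOfContent G β κ₁ × (Unique (toList κ₂) × Vec.lookup κ₂ w ≢ Vec.lookup κ₁ u)
        to κ₂ (proper , content) =
          let p₁ , p₂ , w≢u = proper-++⁻ κ₁ κ₂ proper
              uq = proper-complete⇒unique κ₂ p₂
          in (p₁ , λ i → ℕₚ.suc-injective (trans (sym (multiplicity-join κ₁ κ₂ uq i))
                           (trans (content i) (Vecₚ.lookup-map i suc β)))) , (uq , w≢u)
        from : ∀ κ₂ → ProperOfContent G β κ₁ × (Unique (toList κ₂) × Vec.lookup κ₂ w ≢ Vec.lookup κ₁ u) →
          ProperOfContent J (Vec.map suc β) (κ₁ Vec.++ κ₂)
        from κ₂ ((p₁ , content) , (uq , w≢u)) =
          proper-++⁺ κ₁ κ₂ p₁ (unique⇒proper-complete κ₂ uq) w≢u ,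
          λ i → trans (multiplicity-join κ₁ κ₂ uq i) (trans (cong suc (content i)) (sym (Vecₚ.lookup-map i suc β)))

colourings-join : ∀ G {t} (u : Vertex G) (w : Fin t) ys → length ys ≡ t →
  colourings (joinByEdge G (complete t) u w) (map suc ys) ≡ colourings G ys * ((t ∸ 1) * (t ∸ 1) !)
colourings-join G u () []       refl
colourings-join G u w  ys@(_ ∷ _) refl = trans
  (colouringCount-toList J (fromList (map suc ys)) (Vec.map suc (fromList ys))
    (trans (Vecₚ.toList∘fromList (map suc ys)) (sym (trans (Vecₚ.toList-map suc (fromList ys)) (cong (map suc) (Vecₚ.toList∘fromList ys))))))
  (JoinComplete.colouringCount-join G (length ys) u w (fromList ys) (avoidingCount-! w))
  where
  J = joinByEdge G (complete (length ys)) u w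

-- The coefficient of s_{(4,4,4,4,1,…,1)}

linked-++ˡ : ∀ {R : A → A → Set} xs {ys} → Linked R (xs ++ ys) → Linked R xs
linked-++ˡ []           _       = []
linked-++ˡ (x ∷ [])     _       = [-]
linked-++ˡ (x ∷ y ∷ xs) (r ∷ l) = r ∷ linked-++ˡ (y ∷ xs) l

ones : ℕ → List ℕ
ones s = replicate s 1

replicate-∷ʳ : ∀ k (x : A) → replicate (suc k) x ≡ replicate k x ∷ʳ x
replicate-∷ʳ zero    x = refl
replicate-∷ʳ (suc k) x = cong (x ∷_) (replicate-∷ʳ k x)

++-ones-suc : ∀ lam s → lam ++ ones (suc s) ≡ (lam ++ ones s) ∷ʳ 1
++-ones-suc lam s = trans (cong (lam ++_) (replicate-∷ʳ s 1)) (sym (Listₚ.++-assoc lam (ones s) [ 1 ]))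

length-++-ones : ∀ lam s γ → length lam ≡ length γ → length (lam ++ ones s) ≡ length (ones s ++ γ)
length-++-ones lam s γ eq = begin
  length (lam ++ ones s)         ≡⟨ Listₚ.length-++ lam ⟩
  length lam + length (ones s)   ≡⟨ cong (ℕ._+ length (ones s)) eq ⟩
  length γ + length (ones s)     ≡⟨ ℕₚ.+-comm (length γ) _ ⟩
  length (ones s) + length γ     ≡⟨ Listₚ.length-++ (ones s) ⟨
  length (ones s ++ γ)           ∎
  where open ≡-Reasoning

sum-ones : ∀ s → sum (ones s) ≡ s
sum-ones zero    = refl
sum-ones (suc s) = cong suc (sum-ones s)

length-ones-++ : ∀ s γ → length (ones s ++ γ) ≡ s + length γ
length-ones-++ s γ = trans (Listₚ.length-++ (ones s)) (cong (ℕ._+ length γ) (Listₚ.length-replicate s))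

-- Shape and content have equally many entries, so each of the `s` leading letters, occurring once,
-- must remove exactly the last box (`kostka-∷ʳ1`).
kostka-++-ones : ∀ s lam γ → length lam ≡ length γ → Linked _≥_ (lam ++ ones s) →
  kostka (lam ++ ones s) (ones s ++ γ) ≡ kostka lam γ
kostka-++-ones zero    lam γ len l = cong (λ z → kostka z γ) (Listₚ.++-identityʳ lam)
kostka-++-ones (suc s) lam γ len l = trans
  (cong (λ z → kostka z (1 ∷ ones s ++ γ)) (++-ones-suc lam s))
  (trans (kostka-∷ʳ1 (lam ++ ones s) (ones s ++ γ) (length-++-ones lam s γ len) l′)
    (kostka-++-ones s lam γ len (linked-++ˡ (lam ++ ones s) l′)))
  where
  l′ : Linked _≥_ ((lam ++ ones s) ∷ʳ 1)
  l′ = subst (Linked _≥_) (++-ones-suc lam s) l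

-- Decided by the last part of `lam`: if it is 2 or more, no tableau exists (`kostka-∷ʳ2+`); if it
-- is 1, it is stripped together with one letter and the argument repeats.
kostka-ones-support : ∀ s lam k → length lam ≡ s + k → Linked _≥_ lam → All (1 ≤_) lam →
  (∀ γ → length γ ≡ k → kostka lam (ones s ++ γ) ≡ 0) ⊎ ∃ λ lam′ → lam ≡ lam′ ++ ones s × length lam′ ≡ k
kostka-ones-support zero    lam k len l pos = inj₂ (lam , sym (Listₚ.++-identityʳ lam) , len)
kostka-ones-support (suc s) lam k len l pos with List.initLast lam
kostka-ones-support (suc s) .[] k () l pos | List.[]
... | lam″ List.∷ʳ′ x with trans (sym (trans (Listₚ.length-++ lam″) (ℕₚ.+-comm (length lam″) 1))) len
... | len′ with x | Allₚ.∷ʳ⁻ pos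
... | suc (suc y) | _ = inj₁ λ γ lenγ →
  kostka-∷ʳ2+ lam″ (ones s ++ γ) (trans (ℕₚ.suc-injective len′) (sym (trans (length-ones-++ s γ) (cong (s ℕ.+_) lenγ)))) y
... | suc zero | pos″ , _ with kostka-ones-support s lam″ k (ℕₚ.suc-injective len′) (linked-++ˡ lam″ l) pos″
... | inj₁ vanish = inj₁ λ γ lenγ → trans
  (kostka-∷ʳ1 lam″ (ones s ++ γ) (trans (ℕₚ.suc-injective len′) (sym (trans (length-ones-++ s γ) (cong (s ℕ.+_) lenγ)))) l) (vanish γ lenγ)
... | inj₂ (lam′ , refl , len″) = inj₂ (lam′ , sym (++-ones-suc lam′ s) , len″)

-- Opaque, so that conversion checking does not expand colouring counts.
opaque

  evaluate : List (List ℕ × ℤ) → (List ℕ → ℤ) → ℤ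
  evaluate terms f = ∑ℤ terms (λ (β , l) → l ℤ.* f β)

-- The terms of Σ_π sgn(π) x^{(3,3,3,3)+δ-π(δ)}, δ = (3,2,1,0), with exponents sorted; on
-- symmetric functions in four variables this reads off the coefficient of s_{(3,3,3,3)}.
jacobiTrudiTerms : List (List ℕ × ℤ)
jacobiTrudiTerms =
    (3 ∷ 3 ∷ 3 ∷ 3 ∷ [] , + 1)   ∷ (4 ∷ 3 ∷ 3 ∷ 2 ∷ [] , - + 3) ∷ (4 ∷ 4 ∷ 3 ∷ 1 ∷ [] , + 2)
  ∷ (5 ∷ 3 ∷ 2 ∷ 2 ∷ [] , + 2)   ∷ (5 ∷ 3 ∷ 3 ∷ 1 ∷ [] , - + 2) ∷ (4 ∷ 4 ∷ 2 ∷ 2 ∷ [] , + 1)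
  ∷ (4 ∷ 4 ∷ 4 ∷ 0 ∷ [] , - + 1) ∷ (5 ∷ 4 ∷ 2 ∷ 1 ∷ [] , - + 2) ∷ (5 ∷ 4 ∷ 3 ∷ 0 ∷ [] , + 2)
  ∷ (5 ∷ 5 ∷ 1 ∷ 1 ∷ [] , + 1)   ∷ (5 ∷ 5 ∷ 2 ∷ 0 ∷ [] , - + 1) ∷ (6 ∷ 2 ∷ 2 ∷ 2 ∷ [] , - + 1)
  ∷ (6 ∷ 3 ∷ 2 ∷ 1 ∷ [] , + 2)   ∷ (6 ∷ 3 ∷ 3 ∷ 0 ∷ [] , - + 1) ∷ (6 ∷ 4 ∷ 1 ∷ 1 ∷ [] , - + 1)
  ∷ (6 ∷ 4 ∷ 2 ∷ 0 ∷ [] , + 1)   ∷ []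

4444ˢ : List ℕ
4444ˢ = 4 ∷ 4 ∷ 4 ∷ 4 ∷ []

private
  -- A four-part partition of 16 is determined by its last three parts, which makes the claim below
  -- a finite check. When `b + c + d` exceeds 16 the truncated first part is 0 and the sum is not
  -- 16, so no spurious partition appears.
  quadruple : (b c d : Fin 17) → List ℕ
  quadruple b c d = 16 ∸ (toℕ b + toℕ c + toℕ d) ∷ toℕ b ∷ toℕ c ∷ toℕ d ∷ []

opaque
  unfolding evaluate

  -- Passing from β to map suc β multiplies by x₁x₂x₃x₄, i.e. shifts (3,3,3,3) to (4,4,4,4).
  jacobiTrudiTerms-4444 : evaluate jacobiTrudiTerms (λ β → + kostka 4444ˢ (map suc β)) ≡ + 1
  jacobiTrudiTerms-4444 = refl

  -- In four variables the coefficient of s_λ in f is that of x^{λ+δ} in a_δ f, where a_δ is the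
  -- Vandermonde alternant. With λ = (4,4,4,4) the terms, shifted by `map suc`, expand this, so
  -- every other Schur polynomial is sent to 0; here this is confirmed by evaluation.
  jacobiTrudiTerms-quadruple : ∀ b c d → IsPartition 16 (quadruple b c d) →
    quadruple b c d ≡ 4444ˢ ⊎ evaluate jacobiTrudiTerms (λ β → + kostka (quadruple b c d) (map suc β)) ≡ 0ℤ
  jacobiTrudiTerms-quadruple = toWitness {a? = Finₚ.all? λ b → Finₚ.all? λ c → Finₚ.all? λ d →
    isPartition? 16 (quadruple b c d) →-dec
      ((quadruple b c d ≟ˢ 4444ˢ) ⊎-dec (evaluate jacobiTrudiTerms (λ β → + kostka (quadruple b c d) (map suc β)) ℤₚ.≟ 0ℤ))} _

jacobiTrudiTerms-kostka : ∀ {lam} → IsPartition 16 lam → length lam ≡ 4 →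
  lam ≡ 4444ˢ ⊎ evaluate jacobiTrudiTerms (λ β → + kostka lam (map suc β)) ≡ 0ℤ
jacobiTrudiTerms-kostka {a ∷ b ∷ c ∷ d ∷ []} p refl = subst
  (λ z → z ≡ 4444ˢ ⊎ evaluate jacobiTrudiTerms (λ β → + kostka z (map suc β)) ≡ 0ℤ) eq
  (jacobiTrudiTerms-quadruple b′ c′ d′ (subst (IsPartition 16) (sym eq) p))
  where
  total : a + (b + (c + (d + 0))) ≡ 16
  total = proj₂ p
  b<17 : b < 17
  b<17 = s≤s (ℕₚ.m+n≤o⇒m≤o b (ℕₚ.m+n≤o⇒n≤o a (ℕₚ.≤-reflexive total)))
  c<17 : c < 17
  c<17 = s≤s (ℕₚ.m+n≤o⇒m≤o c (ℕₚ.m+n≤o⇒n≤o b (ℕₚ.m+n≤o⇒n≤o a (ℕₚ.≤-reflexive total))))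
  d<17 : d < 17
  d<17 = s≤s (ℕₚ.m+n≤o⇒m≤o d (ℕₚ.m+n≤o⇒n≤o c (ℕₚ.m+n≤o⇒n≤o b (ℕₚ.m+n≤o⇒n≤o a (ℕₚ.≤-reflexive total)))))
  b′ c′ d′ : Fin 17
  b′ = Fin.fromℕ< b<17
  c′ = Fin.fromℕ< c<17
  d′ = Fin.fromℕ< d<17
  a≡ : 16 ∸ (b + c + d) ≡ a
  a≡ = trans (cong (_∸ (b + c + d)) (trans (sym total) (regroup a b c d))) (ℕₚ.m+n∸n≡m a (b + c + d))
    where
    regroup : ∀ a b c d → a + (b + (c + (d + 0))) ≡ a + (b + c + d)
    regroup = solve-∀
  eq : quadruple b′ c′ d′ ≡ a ∷ b ∷ c ∷ d ∷ []
  eq rewrite Finₚ.toℕ-fromℕ< b<17 | Finₚ.toℕ-fromℕ< c<17 | Finₚ.toℕ-fromℕ< d<17 =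
    cong (λ z → z ∷ b ∷ c ∷ d ∷ []) a≡

jacobiTrudiTerms-length : All (λ (β , _) → length β ≡ 4) jacobiTrudiTerms
jacobiTrudiTerms-length = toWitness {a? = All.all? (λ (β , _) → length β ℕ.≟ 4) jacobiTrudiTerms} _

module _ (terms : List (List ℕ × ℤ)) where

  opaque
    unfolding evaluate

    evaluate-cong : ∀ {n f g} → All (λ (β , _) → length β ≡ n) terms →
      (∀ β → length β ≡ n → f β ≡ g β) → evaluate terms f ≡ evaluate terms g
    evaluate-cong len h = ∑ℤ-cong terms (λ {(β , l)} p → cong (l ℤ.*_) (h β (All.lookup len p)))

    evaluate-zero : ∀ {n f} → All (λ (β , _) → length β ≡ n) terms →
      (∀ β → length β ≡ n → f β ≡ 0ℤ) → evaluate terms f ≡ 0ℤ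
    evaluate-zero len h = ∑ℤ-zero terms (λ {(β , l)} p → trans (cong (l ℤ.*_) (h β (All.lookup len p))) (ℤₚ.*-zeroʳ l))

    evaluate-*ˡ : ∀ k f → evaluate terms (λ β → k ℤ.* f β) ≡ k ℤ.* evaluate terms f
    evaluate-*ˡ k f = trans
      (∑ℤ-cong terms (λ {(β , l)} _ → regroup l k (f β)))
      (∑ℤ-*ˡ k (λ (β , l) → l ℤ.* f β) terms)
      where
      regroup : ∀ x y z → x ℤ.* (y ℤ.* z) ≡ y ℤ.* (x ℤ.* z)
      regroup = ℤ-Ring.solve-∀

    evaluate-∑ : ∀ (f : A → List ℕ → ℤ) xs → evaluate terms (λ β → ∑ℤ xs (λ x → f x β)) ≡ ∑ℤ xs (λ x → evaluate terms (f x))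
    evaluate-∑ f xs = trans
      (∑ℤ-cong terms (λ {(β , l)} _ → sym (∑ℤ-*ˡ l (λ x → f x β) xs)))
      (∑ℤ-swap (λ (β , l) x → l ℤ.* f x β) terms xs)

module Extraction (s : ℕ) where

  extract : (List ℕ → ℤ) → ℤ
  extract = evaluate jacobiTrudiTerms

  target : List ℕ
  target = 4 ∷ 4 ∷ 4 ∷ 4 ∷ ones s

  -- The first `s` colours occur once and hence only on the clique; the last four also colour the
  -- remaining graph, with content `β`.
  content : List ℕ → List ℕ
  content β = ones s ++ map suc β

  target-isPartition : IsPartition (12 + (s + 4)) target
  target-isPartition = (linked s , positive s) , total s
    where
    linked-ones : ∀ s → Linked _≥_ (4 ∷ ones s)
    linked-ones zero    = [-]
    linked-ones (suc s) = s≤s z≤n ∷ go s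
      where
      go : ∀ s → Linked _≥_ (ones (suc s))
      go zero    = [-]
      go (suc s) = ℕₚ.≤-refl ∷ go s
    linked : ∀ s → Linked _≥_ (4 ∷ 4 ∷ 4 ∷ 4 ∷ ones s)
    linked s = ℕₚ.≤-refl ∷ ℕₚ.≤-refl ∷ ℕₚ.≤-refl ∷ linked-ones s
    positive : ∀ s → All (1 ≤_) (4 ∷ 4 ∷ 4 ∷ 4 ∷ ones s)
    positive s = s≤s z≤n ∷ s≤s z≤n ∷ s≤s z≤n ∷ s≤s z≤n ∷ Allₚ.replicate⁺ s ℕₚ.≤-refl
    total : ∀ s → sum (4 ∷ 4 ∷ 4 ∷ 4 ∷ ones s) ≡ 12 + (s + 4)
    total s = cong (12 ℕ.+_) (trans (cong (4 ℕ.+_) (sum-ones s)) (ℕₚ.+-comm 4 s))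

  extract-target : extract (λ β → + kostka target (content β)) ≡ + 1
  extract-target = trans
    (evaluate-cong jacobiTrudiTerms jacobiTrudiTerms-length (λ β len → cong +_ (kostka-++-ones s 4444ˢ (map suc β) (sym (trans (Listₚ.length-map suc β) len))
      (proj₁ (proj₁ target-isPartition)))))
    jacobiTrudiTerms-4444

  length-content : ∀ {β} → length β ≡ 4 → length (content β) ≡ s + 4
  length-content {β} len = trans (length-ones-++ s (map suc β)) (cong (s ℕ.+_) (trans (Listₚ.length-map suc β) len))

  extract-++-ones : ∀ {lam′} → IsPartition (12 + (s + 4)) (lam′ ++ ones s) → length lam′ ≡ 4 →
    lam′ ++ ones s ≢ target → extract (λ β → + kostka (lam′ ++ ones s) (content β)) ≡ 0ℤ
  extract-++-ones {lam′} ((l , pos) , total) len′ ≢target = trans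
    (evaluate-cong jacobiTrudiTerms jacobiTrudiTerms-length (λ β len → cong +_
      (kostka-++-ones s lam′ (map suc β) (trans len′ (sym (trans (Listₚ.length-map suc β) len))) l)))
    ([ (λ eq → contradiction (cong (_++ ones s) eq) ≢target) , id ]′
      (jacobiTrudiTerms-kostka ((linked-++ˡ lam′ l , Allₚ.++⁻ˡ lam′ pos) , total′) len′))
    where
    total′ : sum lam′ ≡ 16
    total′ = ℕₚ.+-cancelʳ-≡ s _ _ (trans (cong (sum lam′ ℕ.+_) (sym (sum-ones s)))
      (trans (sym (Sumₚ.sum-++ lam′ (ones s))) (trans total (cong (12 ℕ.+_) (ℕₚ.+-comm s 4)))))

  -- Shapes with more than s+4 rows have no tableau with so few letters. Those with exactly s+4 rows
  -- either vanish or end in `s` ones, where stripping leaves a four-row partition of 16 other than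
  -- (4,4,4,4).
  extract-other : ∀ {lam} → IsPartition (12 + (s + 4)) lam → ¬ length lam < s + 4 → lam ≢ target →
    extract (λ β → + kostka lam (content β)) ≡ 0ℤ
  extract-other {lam} p@((l , pos) , _) ge lam≢ =
    [ (λ gt → evaluate-zero jacobiTrudiTerms jacobiTrudiTerms-length (λ β len → cong +_
        (kostka-too-long (content β) pos (subst (_< length lam) (sym (length-content len)) gt))))
    , (λ eq → [ (λ vanish → evaluate-zero jacobiTrudiTerms jacobiTrudiTerms-length (λ β len → cong +_
                  (vanish (map suc β) (trans (Listₚ.length-map suc β) len))))
              , (λ { (lam′ , refl , len′) → extract-++-ones p len′ lam≢ })
              ]′ (kostka-ones-support s lam 4 (sym eq) l pos))
    ]′ (ℕₚ.m≤n⇒m<n∨m≡n (ℕₚ.≮⇒≥ ge))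

  -- `extract` is linear, so it can be applied to both sides of the expansion. Short shapes drop out
  -- through their coefficient, all other shapes except `target` through `extract`, and `target`
  -- itself gives 1.
  coefficient-extract : ∀ G → order G ≡ 12 + (s + 4) → (∀ xs → length xs < s + 4 → colourings G xs ≡ 0) →
    ∀ c → IsSchurExpansion G c → c target ≡ extract (λ β → + colourings G (content β))
  coefficient-extract G ord few c h = sym (begin
    extract (λ β → + colourings G (content β))
      ≡⟨ evaluate-cong jacobiTrudiTerms jacobiTrudiTerms-length (λ β _ → expansion⇒ G c h (content β)) ⟩
    extract (λ β → ∑ℤ ps (λ lam → c lam ℤ.* + kostka lam (content β)))
      ≡⟨ evaluate-∑ jacobiTrudiTerms (λ lam β → c lam ℤ.* + kostka lam (content β)) ps ⟩
    ∑ℤ ps (λ lam → extract (λ β → c lam ℤ.* + kostka lam (content β)))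
      ≡⟨ ∑ℤ-cong ps (λ {lam} _ → evaluate-*ˡ jacobiTrudiTerms (c lam) (λ β → + kostka lam (content β))) ⟩
    ∑ℤ ps (λ lam → c lam ℤ.* extract (λ β → + kostka lam (content β)))
      ≡⟨ ∑ℤ-single _ (unique-partitions (order G))
           (∈-partitions⁺ (subst (λ n → IsPartition n target) (sym ord) target-isPartition)) other ⟩
    c target ℤ.* extract (λ β → + kostka target (content β))
      ≡⟨ trans (cong (c target ℤ.*_) extract-target) (ℤₚ.*-identityʳ (c target)) ⟩
    c target ∎)
    where
    open ≡-Reasoning
    ps = partitions (order G)
    other : ∀ {lam} → lam ∈ ps → lam ≢ target → c lam ℤ.* extract (λ β → + kostka lam (content β)) ≡ 0ℤ
    other {lam} lam∈ lam≢ with length lam ℕ.<? s + 4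
    ... | yes lt = trans (cong (ℤ._* extract (λ β → + kostka lam (content β)))
                     (coefficient-vanishes G c h (s + 4) few (∈-partitions⁻ (order G) lam∈) lt))
                     (ℤₚ.*-zeroˡ (extract (λ β → + kostka lam (content β))))
    ... | no ge  = trans (cong (c lam ℤ.*_)
                     (extract-other (subst (λ n → IsPartition n lam) ord (∈-partitions⁻ (order G) lam∈)) ge lam≢))
                     (ℤₚ.*-zeroʳ (c lam))

-- Colourings of G₂

-- Later k lists, for each of k vertices, its neighbours among the later vertices; Fin k
-- numbers the later vertices relative to the current one.
data Later : ℕ → Set where
  []  : Later 0
  _∷_ : ∀ {k} → List (Fin k) → Later k → Later (suc k)

EdgeOf : ∀ {k} → Later k → Fin k → Fin k → Set
EdgeOf (ns ∷ L) zero    (suc j) = j ∈ ns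
EdgeOf (ns ∷ L) (suc i) (suc j) = EdgeOf L i j
EdgeOf _        _       _       = ⊥

edgeOf? : ∀ {k} (L : Later k) i j → Dec (EdgeOf L i j)
edgeOf? (ns ∷ L) zero    (suc j) = j ∈F? ns
edgeOf? (ns ∷ L) (suc i) (suc j) = edgeOf? L i j
edgeOf? (ns ∷ L) zero    zero    = no λ ()
edgeOf? (ns ∷ L) (suc _) zero    = no λ ()

module _ {N : ℕ} (α : Vec ℕ N) where

  -- The bound is strict because `x` is about to be added to `κ`.
  Extends : ∀ {k} → List (Fin k) → Fin N → Vec (Fin N) k → Set
  Extends ns x κ = All (λ j → x ≢ Vec.lookup κ j) ns × multiplicity x (toList κ) < Vec.lookup α x

  extends? : ∀ {k} (ns : List (Fin k)) x κ → Dec (Extends ns x κ)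
  extends? ns x κ = All.all? (λ j → ¬? (x Fin.≟ Vec.lookup κ j)) ns ×-dec (multiplicity x (toList κ) ℕ.<? Vec.lookup α x)

  Passes : ∀ {k} → Later k → Vec (Fin N) k → Set
  Passes []       []      = ⊤
  Passes (ns ∷ L) (x ∷ κ) = Extends ns x κ × Passes L κ

  passes? : ∀ {k} (L : Later k) κ → Dec (Passes L κ)
  passes? []       []      = yes tt
  passes? (ns ∷ L) (x ∷ κ) = extends? ns x κ ×-dec passes? L κ

  -- Backtracking search, from the last vertex to the first, that never exceeds the content α.
  search : ∀ {k} → Later k → (Vec (Fin N) k → ℕ) → ℕ
  search []       g = g []
  search (ns ∷ L) g = search L (λ κ → ∑ (allFin N) (λ x → if does (extends? ns x κ) then g (x ∷ κ) else 0))

  -- `search` branches with `if`, so that a rejected branch is cut off; the proofs work with the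
  -- equivalent product.
  if-𝟙 : {P : Set} (P? : Dec P) (n : ℕ) → (if does P? then n else 0) ≡ 𝟙 P? * n
  if-𝟙 (yes _) n = sym (ℕₚ.+-identityʳ n)
  if-𝟙 (no _)  n = refl

  -- Pruning discards only terms whose factor `𝟙 (passes? …)` is 0: a vector passes exactly when its
  -- head extends its tail and the tail passes.
  search-∑ : ∀ {k} (L : Later k) g → search L g ≡ ∑ (vectors (allFin N) k) (λ κ → 𝟙 (passes? L κ) * g κ)
  search-∑ []       g = sym (trans (ℕₚ.+-identityʳ _) (ℕₚ.+-identityʳ (g [])))
  search-∑ (ns ∷ L) g = begin
    search L (λ κ → ∑ (allFin N) (λ x → if does (extends? ns x κ) then g (x ∷ κ) else 0))
      ≡⟨ search-∑ L _ ⟩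
    ∑ κs (λ κ → 𝟙 (passes? L κ) * ∑ (allFin N) (λ x → if does (extends? ns x κ) then g (x ∷ κ) else 0))
      ≡⟨ ∑-cong κs (λ {κ} _ → sym (∑-*ˡ _ (𝟙 (passes? L κ)) (allFin N))) ⟩
    ∑ κs (λ κ → ∑ (allFin N) (λ x → 𝟙 (passes? L κ) * (if does (extends? ns x κ) then g (x ∷ κ) else 0)))
      ≡⟨ ∑-cong κs (λ {κ} _ → ∑-cong (allFin N) (λ {x} _ → step x κ)) ⟩
    ∑ κs (λ κ → ∑ (allFin N) (λ x → 𝟙 (passes? (ns ∷ L) (x ∷ κ)) * g (x ∷ κ)))
      ≡⟨ ∑-swap (λ κ x → 𝟙 (passes? (ns ∷ L) (x ∷ κ)) * g (x ∷ κ)) κs (allFin N) ⟩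
    ∑ (allFin N) (λ x → ∑ κs (λ κ → 𝟙 (passes? (ns ∷ L) (x ∷ κ)) * g (x ∷ κ)))
      ≡⟨ ∑-vectors-suc (allFin N) (λ κ → 𝟙 (passes? (ns ∷ L) κ) * g κ) ⟨
    ∑ (vectors (allFin N) _) (λ κ → 𝟙 (passes? (ns ∷ L) κ) * g κ) ∎
    where
    open ≡-Reasoning
    κs = vectors (allFin N) _
    regroup : ∀ a b c → a * (b * c) ≡ (b * a) * c
    regroup = solve-∀
    step : ∀ x κ → 𝟙 (passes? L κ) * (if does (extends? ns x κ) then g (x ∷ κ) else 0) ≡
                   𝟙 (passes? (ns ∷ L) (x ∷ κ)) * g (x ∷ κ)
    step x κ = begin
      𝟙 (passes? L κ) * (if does (extends? ns x κ) then g (x ∷ κ) else 0)  ≡⟨ cong (𝟙 (passes? L κ) ℕ.*_) (if-𝟙 (extends? ns x κ) (g (x ∷ κ))) ⟩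
      𝟙 (passes? L κ) * (𝟙 (extends? ns x κ) * g (x ∷ κ))                  ≡⟨ regroup (𝟙 (passes? L κ)) (𝟙 (extends? ns x κ)) (g (x ∷ κ)) ⟩
      (𝟙 (extends? ns x κ) * 𝟙 (passes? L κ)) * g (x ∷ κ)                  ≡⟨ cong (ℕ._* g (x ∷ κ)) (𝟙-× (extends? ns x κ) (passes? L κ)) ⟨
      𝟙 (passes? (ns ∷ L) (x ∷ κ)) * g (x ∷ κ)                             ∎

  passes⇒distinct : ∀ {k} (L : Later k) κ → Passes L κ → ∀ i j → EdgeOf L i j → Vec.lookup κ i ≢ Vec.lookup κ j
  passes⇒distinct (ns ∷ L) (x ∷ κ) ((avoids , _) , _) zero    (suc j) j∈ = All.lookup avoids j∈
  passes⇒distinct (ns ∷ L) (x ∷ κ) (_ , p)            (suc i) (suc j) e  = passes⇒distinct L κ p i j e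

  distinct⇒passes : ∀ {k} (L : Later k) κ → (∀ i j → EdgeOf L i j → Vec.lookup κ i ≢ Vec.lookup κ j) →
    (∀ i → multiplicity i (toList κ) ≤ Vec.lookup α i) → Passes L κ
  distinct⇒passes []       []      _ _       = tt
  distinct⇒passes (ns ∷ L) (x ∷ κ) h bounded =
    (All.tabulate (λ {j} j∈ → h zero (suc j) j∈) ,
     subst (_≤ Vec.lookup α x) (cong length (Listₚ.filter-accept (x Fin.≟_) refl)) (bounded x)) ,
    distinct⇒passes L κ (λ i j → h (suc i) (suc j)) (λ i → ℕₚ.≤-trans (smaller i) (bounded i))
    where
    smaller : ∀ i → multiplicity i (toList κ) ≤ multiplicity i (x ∷ toList κ)
    smaller i = subst₂ _≤_ (sym (multiplicity-∑ i (toList κ))) (sym (multiplicity-∑ i (x ∷ toList κ)))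
      (ℕₚ.m≤n+m _ (𝟙 (i Fin.≟ x)))

module _ (G : Graph) (L : Later (order G))
  (adj⇒edge : ∀ i j → Adj G i j → EdgeOf L i j ⊎ EdgeOf L j i)
  (edge⇒adj : ∀ i j → EdgeOf L i j → Adj G i j)
  where

  colouringCount-search : ∀ {N} (α : Vec ℕ N) →
    colouringCount G N α ≡ search α L (λ κ → 𝟙 (hasContent? α (toList κ)))
  colouringCount-search {N} α = begin
    colouringCount G N α                                   ≡⟨ count-∑ (properOfContent? G α) κs ⟩
    ∑ κs (𝟙 ∘ properOfContent? G α)                        ≡⟨ ∑-cong κs (λ {κ} _ → trans
                                                               (𝟙-⇔ (properOfContent? G α κ) (passes? α L κ ×-dec hasContent? α (toList κ)) (to κ) (from κ))
                                                               (𝟙-× (passes? α L κ) (hasContent? α (toList κ)))) ⟩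
    ∑ κs (λ κ → 𝟙 (passes? α L κ) * 𝟙 (hasContent? α (toList κ)))  ≡⟨ search-∑ α L _ ⟨
    search α L (λ κ → 𝟙 (hasContent? α (toList κ)))        ∎
    where
    open ≡-Reasoning
    κs = vectors (allFin N) (order G)
    to : ∀ κ → ProperOfContent G α κ → Passes α L κ × HasContent α (toList κ)
    to κ (proper , content) =
      distinct⇒passes α L κ (λ i j e → proper i j (edge⇒adj i j e)) (λ i → ℕₚ.≤-reflexive (content i)) , content
    from : ∀ κ → Passes α L κ × HasContent α (toList κ) → ProperOfContent G α κ
    from κ (p , content) = (λ i j a → [ passes⇒distinct α L κ p i j , (λ e → passes⇒distinct α L κ p j i e ∘ sym) ]′ (adj⇒edge i j a)) , content

G₂-edges : Later (order G₂)
G₂-edges = (# 0 ∷ # 10 ∷ [])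
  ∷ (# 4 ∷ # 5 ∷ # 7 ∷ [])
  ∷ (# 6 ∷ # 7 ∷ [])
  ∷ (# 0 ∷ # 4 ∷ [])
  ∷ (# 3 ∷ # 5 ∷ # 6 ∷ [])
  ∷ (# 0 ∷ # 1 ∷ [])
  ∷ (# 0 ∷ # 2 ∷ [])
  ∷ (# 1 ∷ [])
  ∷ (# 1 ∷ # 2 ∷ [])
  ∷ (# 0 ∷ [])
  ∷ (# 0 ∷ [])
  ∷ ([]) ∷ []

G₂-edges-complete : ∀ i j → Adj G₂ i j → EdgeOf G₂-edges i j ⊎ EdgeOf G₂-edges j i
G₂-edges-complete = toWitness
  {a? = Finₚ.all? λ i → Finₚ.all? λ j → adj? G₂ i j →-dec (edgeOf? G₂-edges i j ⊎-dec edgeOf? G₂-edges j i)} _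

G₂-edges-sound : ∀ i j → EdgeOf G₂-edges i j → Adj G₂ i j
G₂-edges-sound = toWitness {a? = Finₚ.all? λ i → Finₚ.all? λ j → edgeOf? G₂-edges i j →-dec adj? G₂ i j} _

G₂-search : List ℕ → ℕ
G₂-search β = search (fromList β) G₂-edges (λ κ → 𝟙 (hasContent? (fromList β) (toList κ)))

colourings-G₂ : ∀ β → colourings G₂ β ≡ G₂-search β
colourings-G₂ β = colouringCount-search G₂ G₂-edges G₂-edges-complete G₂-edges-sound (fromList β)

opaque
  unfolding evaluate

  G₂-coefficient : evaluate jacobiTrudiTerms (λ β → + G₂-search β) ≡ - + 40
  G₂-coefficient = refl

-- Line graphs

-- Names the edges of a root graph by the vertices of `G`, free of the lexicographic numbering that
-- `lineGraph` imposes. `ordered` excludes loops and gives each edge the orientation in which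
-- `edges` lists it.
record LineRepresentation (G : Graph) : Set where
  field
    size        : ℕ
    edge        : Vertex G → Fin size × Fin size
    ordered     : ∀ v → proj₁ (edge v) Fin.< proj₂ (edge v)
    injective   : ∀ {u v} → edge u ≡ edge v → u ≡ v
    adj⇒share   : ∀ {u v} → Adj G u v → ShareEndpoint (edge u) (edge v)
    share⇒adj   : ∀ {u v} → u ≢ v → ShareEndpoint (edge u) (edge v) → Adj G u v

module _ {G : Graph} (R : LineRepresentation G) where

  open LineRepresentation R

  root : Graph
  root = record
    { order  = size
    ; Adj    = λ i j → ∃ λ v → edge v ≡ (i , j) ⊎ edge v ≡ (j , i)
    ; adj?   = λ i j → Finₚ.any? λ v → (edge v ≟ᵉ (i , j)) ⊎-dec (edge v ≟ᵉ (j , i))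
    ; adjSym = λ (v , e) → v , Sum.swap e
    ; irrefl = λ { refl (v , inj₁ e) → loop v e ; refl (v , inj₂ e) → loop v e }
    }
    where
    _≟ᵉ_ : DecidableEquality (Fin size × Fin size)
    _≟ᵉ_ = Productₚ.≡-dec Fin._≟_ Fin._≟_
    loop : ∀ v {i} → edge v ≡ (i , i) → ⊥
    loop v eq = ℕₚ.<-irrefl refl (subst (λ (i , j) → i Fin.< j) eq (ordered v))

  private
    isEdge? : Decidable₁ (λ (p : Fin size × Fin size) → proj₁ p Fin.< proj₂ p × Adj root (proj₁ p) (proj₂ p))
    isEdge? (i , j) = (i Fin.<? j) ×-dec adj? root i j

    unique-edges : Unique (edges root)
    unique-edges = Uniqueₚ.filter⁺ isEdge? (Uniqueₚ.cartesianProduct⁺ (Uniqueₚ.allFin⁺ size) (Uniqueₚ.allFin⁺ size))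

    edge∈ : ∀ v → edge v ∈ edges root
    edge∈ v = ∈ₚ.∈-filter⁺ isEdge? (∈ₚ.∈-cartesianProduct⁺ (∈ₚ.∈-allFin _) (∈ₚ.∈-allFin _)) (ordered v , v , inj₁ refl)

    position : Vertex G → Vertex (lineGraph root)
    position v = Any.index (edge∈ v)

    lookup-position : ∀ v → edge v ≡ lookup (edges root) (position v)
    lookup-position v = Anyₚ.lookup-index (edge∈ v)

    preimage : ∀ a → ∃ λ v → edge v ≡ lookup (edges root) a
    preimage a with proj₂ (∈ₚ.∈-filter⁻ isEdge?
      {xs = cartesianProduct (allFin size) (allFin size)} (∈ₚ.∈-lookup {xs = edges root} a))
    ... | i<j , v , inj₁ eq = v , eq
    ... | i<j , v , inj₂ eq = contradiction (subst (λ (i , j) → i Fin.< j) eq (ordered v)) (ℕₚ.<-asym i<j)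

  isLineGraph : IsLineGraph G
  isLineGraph = root ,
    mk↔ₛ′ position (proj₁ ∘ preimage)
      (λ a → lookup-injective unique-edges (trans (sym (lookup-position _)) (proj₂ (preimage a))))
      (λ v → injective (trans (proj₂ (preimage (position v))) (sym (lookup-position v)))) ,
    λ u v → mk⇔
      (λ a → (λ eq → Graph.irrefl G (injective (trans (lookup-position u)
                 (trans (cong (lookup (edges root)) eq) (sym (lookup-position v))))) a) ,
             subst₂ ShareEndpoint (lookup-position u) (lookup-position v) (adj⇒share a))
      (λ (ne , s) → share⇒adj (ne ∘ cong position)
             (subst₂ ShareEndpoint (sym (lookup-position u)) (sym (lookup-position v)) s))

  private
    _Touches_ : Fin size → Fin size × Fin size → Set
    i Touches (k , l) = i ≡ k ⊎ i ≡ l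

    share⇒touches : ∀ {p q} → ShareEndpoint p q → proj₁ p Touches q ⊎ proj₂ p Touches q
    share⇒touches (inj₁ (inj₁ e)) = inj₁ (inj₁ e)
    share⇒touches (inj₁ (inj₂ e)) = inj₂ (inj₂ e)
    share⇒touches (inj₂ (inj₁ e)) = inj₁ (inj₂ e)
    share⇒touches (inj₂ (inj₂ e)) = inj₂ (inj₁ e)

    touches⇒share : ∀ {i p q} → i Touches p → i Touches q → ShareEndpoint p q
    touches⇒share (inj₁ refl) (inj₁ refl) = inj₁ (inj₁ refl)
    touches⇒share (inj₁ refl) (inj₂ refl) = inj₂ (inj₁ refl)
    touches⇒share (inj₂ refl) (inj₁ refl) = inj₂ (inj₂ refl)
    touches⇒share (inj₂ refl) (inj₂ refl) = inj₁ (inj₂ refl)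

  -- Two of the three leaves of a claw meet its centre, an edge of the root, in the same endpoint.
  clawFree : ClawFree G
  clawFree (f , inj , iff) = pigeonhole (meets (# 1) _) (meets (# 2) _) (meets (# 3) _)
    where
    centre : Fin size × Fin size
    centre = edge (f (# 0))
    meets : ∀ k → True (adj? claw (# 0) k) → proj₁ centre Touches edge (f k) ⊎ proj₂ centre Touches edge (f k)
    meets k a = share⇒touches (adj⇒share (Equivalence.to (iff (# 0) k) (toWitness {a? = adj? claw (# 0) k} a)))
    apart : ∀ {i} k l → True (¬? (k Fin.≟ l)) → True (¬? (adj? claw k l)) →
      i Touches edge (f k) → i Touches edge (f l) → ⊥
    apart k l k≢l ¬a p q = toWitness {a? = ¬? (adj? claw k l)} ¬a (Equivalence.from (iff k l)
      (share⇒adj (toWitness {a? = ¬? (k Fin.≟ l)} k≢l ∘ inj) (touches⇒share p q)))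
    pigeonhole : proj₁ centre Touches edge (f (# 1)) ⊎ proj₂ centre Touches edge (f (# 1)) →
      proj₁ centre Touches edge (f (# 2)) ⊎ proj₂ centre Touches edge (f (# 2)) →
      proj₁ centre Touches edge (f (# 3)) ⊎ proj₂ centre Touches edge (f (# 3)) → ⊥
    pigeonhole (inj₁ p) (inj₁ q) _        = apart (# 1) (# 2) _ _ p q
    pigeonhole (inj₂ p) (inj₂ q) _        = apart (# 1) (# 2) _ _ p q
    pigeonhole (inj₁ p) (inj₂ _) (inj₁ r) = apart (# 1) (# 3) _ _ p r
    pigeonhole (inj₁ _) (inj₂ q) (inj₂ r) = apart (# 2) (# 3) _ _ q r
    pigeonhole (inj₂ _) (inj₁ q) (inj₁ r) = apart (# 2) (# 3) _ _ q r
    pigeonhole (inj₂ p) (inj₁ _) (inj₂ r) = apart (# 1) (# 3) _ _ p r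

-- K_t is the line graph of a star.  Its centre is a new vertex n; the edge for w joins n to
-- the endpoint p of e_u, and every other edge joins n to a new leaf.
module _ (H : Graph) (u : Vertex (lineGraph H)) (p : Vertex H)
  (p-pendant : ∀ a → proj₁ (lookup (edges H) a) ≡ p ⊎ proj₂ (lookup (edges H) a) ≡ p → a ≡ u)
  (p-endpoint : proj₁ (lookup (edges H) u) ≡ p ⊎ proj₂ (lookup (edges H) u) ≡ p)
  {t : ℕ} (w : Fin t)
  where

  private
    n m : ℕ
    n = order H
    m = order (lineGraph H)

    open JoinByEdge (lineGraph H) (complete t) u w using (SumAdj)

    old : Fin n → Fin (n + suc t)
    old i = i ↑ˡ suc t

    new : Fin (suc t) → Fin (n + suc t)
    new j = n ↑ʳ j

    old≢new : ∀ {i j} → old i ≢ new j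
    old≢new {i} {j} eq = ℕₚ.<⇒≱ (Finₚ.toℕ<n i) (subst (n ≤_)
      (trans (sym (Finₚ.toℕ-↑ʳ n j)) (trans (sym (cong toℕ eq)) (Finₚ.toℕ-↑ˡ i (suc t)))) (ℕₚ.m≤m+n n (toℕ j)))

    old-injective : ∀ {i j} → old i ≡ old j → i ≡ j
    old-injective = Finₚ.↑ˡ-injective (suc t) _ _

    new-injective : ∀ {i j} → new i ≡ new j → i ≡ j
    new-injective = Finₚ.↑ʳ-injective n _ _

    centre : Fin (n + suc t)
    centre = new zero

    leftEdge : Fin m → Fin (n + suc t) × Fin (n + suc t)
    leftEdge a = old (proj₁ (lookup (edges H) a)) , old (proj₂ (lookup (edges H) a))

    rightEdge : ∀ b → Dec (b ≡ w) → Fin (n + suc t) × Fin (n + suc t)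
    rightEdge b (yes _) = old p , centre
    rightEdge b (no _)  = centre , new (suc b)

    edge : Fin m ⊎ Fin t → Fin (n + suc t) × Fin (n + suc t)
    edge (inj₁ a) = leftEdge a
    edge (inj₂ b) = rightEdge b (b Fin.≟ w)

    old<new : ∀ i j → old i Fin.< new j
    old<new i j = subst₂ _<_ (sym (Finₚ.toℕ-↑ˡ i (suc t))) (sym (Finₚ.toℕ-↑ʳ n j))
      (ℕₚ.<-≤-trans (Finₚ.toℕ<n i) (ℕₚ.m≤m+n n (toℕ j)))

    isEdge? : Decidable₁ (λ (e : Fin n × Fin n) → proj₁ e Fin.< proj₂ e × Adj H (proj₁ e) (proj₂ e))
    isEdge? (i , j) = (i Fin.<? j) ×-dec adj? H i j

    edge-ordered : ∀ x → proj₁ (edge x) Fin.< proj₂ (edge x)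
    edge-ordered (inj₁ a) = subst₂ _<_ (sym (Finₚ.toℕ-↑ˡ _ (suc t))) (sym (Finₚ.toℕ-↑ˡ _ (suc t)))
      (proj₁ (proj₂ (∈ₚ.∈-filter⁻ isEdge? {xs = cartesianProduct (allFin n) (allFin n)} (∈ₚ.∈-lookup {xs = edges H} a))))
    edge-ordered (inj₂ b) with b Fin.≟ w
    ... | yes _ = old<new p zero
    ... | no _  = subst₂ _<_ (sym (Finₚ.toℕ-↑ʳ n zero)) (sym (Finₚ.toℕ-↑ʳ n (suc b))) (ℕₚ.+-monoʳ-< n z<s)

    edge-injective : ∀ x y → edge x ≡ edge y → x ≡ y
    edge-injective (inj₁ a) (inj₁ b) eq = cong inj₁ (lookup-injective
      (Uniqueₚ.filter⁺ isEdge? (Uniqueₚ.cartesianProduct⁺ (Uniqueₚ.allFin⁺ n) (Uniqueₚ.allFin⁺ n)))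
      (cong₂ _,_ (old-injective (cong proj₁ eq)) (old-injective (cong proj₂ eq))))
    edge-injective (inj₁ a) (inj₂ b) eq with b Fin.≟ w
    ... | yes _ = contradiction (cong proj₂ eq) old≢new
    ... | no _  = contradiction (cong proj₂ eq) old≢new
    edge-injective (inj₂ a) (inj₁ b) eq with a Fin.≟ w
    ... | yes _ = contradiction (sym (cong proj₂ eq)) old≢new
    ... | no _  = contradiction (sym (cong proj₂ eq)) old≢new
    edge-injective (inj₂ a) (inj₂ b) eq with a Fin.≟ w | b Fin.≟ w
    ... | yes refl | yes refl = refl
    ... | yes _    | no _     = contradiction (cong proj₁ eq) old≢new
    ... | no _     | yes _    = contradiction (sym (cong proj₁ eq)) old≢new
    ... | no _     | no _     = cong inj₂ (Finₚ.suc-injective (new-injective (cong proj₂ eq)))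

    share-old⁺ : ∀ {i j k l} → ShareEndpoint (i , j) (k , l) → ShareEndpoint (old i , old j) (old k , old l)
    share-old⁺ = Sum.map (Sum.map (cong old) (cong old)) (Sum.map (cong old) (cong old))

    share-old⁻ : ∀ {i j k l} → ShareEndpoint (old i , old j) (old k , old l) → ShareEndpoint (i , j) (k , l)
    share-old⁻ = Sum.map (Sum.map old-injective old-injective) (Sum.map old-injective old-injective)

    share-mixed⁺ : ∀ a b → a ≡ u × b ≡ w → ShareEndpoint (edge (inj₁ a)) (edge (inj₂ b))
    share-mixed⁺ a b (refl , refl) with w Fin.≟ w
    ... | no w≢w = contradiction refl w≢w
    ... | yes _  = [ inj₁ ∘ inj₁ ∘ cong old , inj₂ ∘ inj₂ ∘ cong old ]′ p-endpoint

    -- `p` is the only old vertex on any edge of the star, it lies on the edge of `w` alone, and by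
    -- `p-pendant` no edge of `H` but `u` ends there.
    share-mixed⁻ : ∀ a b → ShareEndpoint (edge (inj₁ a)) (edge (inj₂ b)) → a ≡ u × b ≡ w
    share-mixed⁻ a b s with b Fin.≟ w | s
    ... | yes b≡w | inj₁ (inj₁ eq) = p-pendant a (inj₁ (old-injective eq)) , b≡w
    ... | yes b≡w | inj₁ (inj₂ eq) = contradiction eq old≢new
    ... | yes b≡w | inj₂ (inj₁ eq) = contradiction eq old≢new
    ... | yes b≡w | inj₂ (inj₂ eq) = p-pendant a (inj₂ (old-injective eq)) , b≡w
    ... | no _    | inj₁ (inj₁ eq) = contradiction eq old≢new
    ... | no _    | inj₁ (inj₂ eq) = contradiction eq old≢new
    ... | no _    | inj₂ (inj₁ eq) = contradiction eq old≢new
    ... | no _    | inj₂ (inj₂ eq) = contradiction eq old≢new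

    share-clique : ∀ a b → ShareEndpoint (edge (inj₂ a)) (edge (inj₂ b))
    share-clique a b with a Fin.≟ w | b Fin.≟ w
    ... | yes _ | yes _ = inj₁ (inj₁ refl)
    ... | yes _ | no _  = inj₂ (inj₂ refl)
    ... | no _  | yes _ = inj₂ (inj₁ refl)
    ... | no _  | no _  = inj₁ (inj₁ refl)

    sumAdj⇒share : ∀ x y → SumAdj x y → ShareEndpoint (edge x) (edge y)
    sumAdj⇒share (inj₁ a) (inj₁ b) (_ , s) = share-old⁺ s
    sumAdj⇒share (inj₁ a) (inj₂ b) e       = share-mixed⁺ a b e
    sumAdj⇒share (inj₂ a) (inj₁ b) e       = shareEndpoint-sym (share-mixed⁺ b a e)
    sumAdj⇒share (inj₂ a) (inj₂ b) _       = share-clique a b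

    share⇒sumAdj : ∀ x y → x ≢ y → ShareEndpoint (edge x) (edge y) → SumAdj x y
    share⇒sumAdj (inj₁ a) (inj₁ b) x≢y s = x≢y ∘ cong inj₁ , share-old⁻ s
    share⇒sumAdj (inj₁ a) (inj₂ b) _   s = share-mixed⁻ a b s
    share⇒sumAdj (inj₂ a) (inj₁ b) _   s = share-mixed⁻ b a (shareEndpoint-sym s)
    share⇒sumAdj (inj₂ a) (inj₂ b) x≢y _ = x≢y ∘ cong inj₂

    splitAt-injective : ∀ {x y : Fin (m + t)} → splitAt m x ≡ splitAt m y → x ≡ y
    splitAt-injective {x} {y} eq = trans (sym (Finₚ.join-splitAt m t x)) (trans (cong (Fin.join m t) eq) (Finₚ.join-splitAt m t y))

  joinComplete-lineRepresentation : LineRepresentation (joinByEdge (lineGraph H) (complete t) u w)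
  joinComplete-lineRepresentation = record
    { size      = n + suc t
    ; edge      = λ x → edge (splitAt m x)
    ; ordered   = λ x → edge-ordered (splitAt m x)
    ; injective = λ {x} {y} eq → splitAt-injective (edge-injective (splitAt m x) (splitAt m y) eq)
    ; adj⇒share = λ {x} {y} → sumAdj⇒share (splitAt m x) (splitAt m y)
    ; share⇒adj = λ {x} {y} x≢y → share⇒sumAdj (splitAt m x) (splitAt m y) (x≢y ∘ splitAt-injective)
    }

-- Connectedness

reachable⇒connected : ∀ (G : Graph) (r : Vertex G) → (∀ v → Star (Adj G) v r) → Connected G
reachable⇒connected G r reach = ℕₚ.≤-<-trans z≤n (Finₚ.toℕ<n r) , λ u v → reach u ◅◅ Star.reverse (Graph.adjSym G) (reach v)

module _ (G : Graph) {t : ℕ} (u : Vertex G) (w : Fin t) where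

  open JoinComplete G t u w using (J; m; adj-split⁺)

  joinComplete-connected : Connected G → Connected J
  joinComplete-connected (_ , path) = reachable⇒connected J (u ↑ˡ t) λ x →
    subst (λ z → Star (Adj J) z (u ↑ˡ t)) (Finₚ.join-splitAt m t x) (reach (splitAt m x))
    where
    fromClique : Adj J (m ↑ʳ w) (u ↑ˡ t)
    fromClique = adj-split⁺ (Finₚ.splitAt-↑ʳ m t w) (Finₚ.splitAt-↑ˡ m u t) (refl , refl)
    reach : ∀ x → Star (Adj J) (Fin.join m t x) (u ↑ˡ t)
    reach (inj₁ a) = Star.gmap (_↑ˡ t)
      (λ {i} {j} → adj-split⁺ (Finₚ.splitAt-↑ˡ m i t) (Finₚ.splitAt-↑ˡ m j t)) (path a u)
    reach (inj₂ b) with b Fin.≟ w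
    ... | yes refl = fromClique ◅ ε
    ... | no b≢w   = adj-split⁺ (Finₚ.splitAt-↑ʳ m t b) (Finₚ.splitAt-↑ʳ m t w) b≢w ◅ fromClique ◅ ε

-- The coefficient for `F t w` and the conclusions

colourings-joinComplete : ∀ G s (u : Vertex G) (w : Fin (s + 4)) β → length β ≡ 4 →
  colourings (joinByEdge G (complete (s + 4)) u w) (ones s ++ map suc β) ≡
  (s + 4 ∸ 1) * (s + 4 ∸ 1) ! * colourings G β
colourings-joinComplete G s u w β len = begin
  colourings J (ones s ++ map suc β)              ≡⟨ cong (colourings J) (sym (trans (Listₚ.map-++ suc (replicate s 0) β)
                                                       (cong (_++ map suc β) (Listₚ.map-replicate suc s 0)))) ⟩
  colourings J (map suc (replicate s 0 ++ β))     ≡⟨ colourings-join G u w (replicate s 0 ++ β)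
                                                       (trans (Listₚ.length-++ (replicate s 0)) (cong₂ _+_ (Listₚ.length-replicate s) len)) ⟩
  colourings G (replicate s 0 ++ β) * d           ≡⟨ cong (ℕ._* d) (colourings-zeros G s β) ⟩
  colourings G β * d                              ≡⟨ ℕₚ.*-comm (colourings G β) d ⟩
  d * colourings G β                              ∎
  where
  open ≡-Reasoning
  J = joinByEdge G (complete (s + 4)) u w
  d = (s + 4 ∸ 1) * (s + 4 ∸ 1) !

evaluate-joinComplete : ∀ terms → All (λ (β , _) → length β ≡ 4) terms →
  ∀ G s (u : Vertex G) (w : Fin (s + 4)) →
  evaluate terms (λ β → + colourings (joinByEdge G (complete (s + 4)) u w) (ones s ++ map suc β)) ≡
  + ((s + 4 ∸ 1) * (s + 4 ∸ 1) !) ℤ.* evaluate terms (λ β → + colourings G β)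
evaluate-joinComplete terms len G s u w = trans
  (evaluate-cong terms len (λ β lenβ → trans (cong +_ (colourings-joinComplete G s u w β lenβ)) (ℤₚ.pos-* d (colourings G β))))
  (evaluate-*ˡ terms (+ d) (λ β → + colourings G β))
  where
  d = (s + 4 ∸ 1) * (s + 4 ∸ 1) !

evaluate-G₂ : evaluate jacobiTrudiTerms (λ β → + colourings G₂ β) ≡ - + 40
evaluate-G₂ = trans
  (evaluate-cong jacobiTrudiTerms jacobiTrudiTerms-length (λ β _ → cong +_ (colourings-G₂ β)))
  G₂-coefficient

F-coefficient : ∀ s (w : Fin (s + 4)) c → IsSchurExpansion (F (s + 4) w) c →
  c (Extraction.target s) ≡ - (+ (40 * (s + 4 ∸ 1) * (s + 4 ∸ 1) !))
F-coefficient s w c h = begin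
  c (Extraction.target s)
    -- `refl` works because `G₂` has twelve vertices, so the order computes to `12 + (s + 4)`.
    ≡⟨ Extraction.coefficient-extract s (F (s + 4) w) refl (JoinComplete.few-colours G₂ (s + 4) v₃ w) c h ⟩
  evaluate jacobiTrudiTerms (λ β → + colourings (F (s + 4) w) (ones s ++ map suc β))
    ≡⟨ evaluate-joinComplete jacobiTrudiTerms jacobiTrudiTerms-length G₂ s v₃ w ⟩
  + d ℤ.* evaluate jacobiTrudiTerms (λ β → + colourings G₂ β)
    ≡⟨ cong (+ d ℤ.*_) evaluate-G₂ ⟩
  + d ℤ.* - + 40
    ≡⟨ ℤₚ.neg-distribʳ-* (+ d) (+ 40) ⟨
  - (+ d ℤ.* + 40)
    ≡⟨ cong -_ (ℤₚ.pos-* d 40) ⟨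
  - + (d * 40)
    ≡⟨ cong (λ n → - + n) (trans (ℕₚ.*-comm d 40) (sym (ℕₚ.*-assoc 40 (s + 4 ∸ 1) _))) ⟩
  - + (40 * (s + 4 ∸ 1) * (s + 4 ∸ 1) !) ∎
  where
  open ≡-Reasoning
  d = (s + 4 ∸ 1) * (s + 4 ∸ 1) !

-- `t ∸ 4 + 4` does not compute to `t`, so the relation is an equation to match on; `w : Fin t` then
-- needs no transport.
F-schurCoefficient : ∀ s {t} → s + 4 ≡ t → (w : Fin t) →
  SchurCoefficient (F t w) (4 ∷ 4 ∷ 4 ∷ 4 ∷ replicate s 1) (- (+ (40 * (t ∸ 1) * (t ∸ 1) !)))
F-schurCoefficient s refl w = schurExpansion-exists (F (s + 4) w) , F-coefficient s w

target-isPartition : ∀ s {t} → s + 4 ≡ t → IsPartition (12 + t) (4 ∷ 4 ∷ 4 ∷ 4 ∷ replicate s 1)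
target-isPartition s refl = Extraction.target-isPartition s

-- The parent of each vertex of G₂ in a breadth-first tree rooted at v₃.
G₂-parent : Vec (Vertex G₂) (order G₂)
G₂-parent = # 1 ∷ # 9 ∷ # 2 ∷ # 4 ∷ # 10 ∷ # 6 ∷ # 9 ∷ # 9 ∷ # 10 ∷ # 2 ∷ # 2 ∷ # 10 ∷ []

G₂-connected : Connected G₂
-- The tree has depth 3 and its root v₃ is its own parent, so three steps upward always end at v₃.
G₂-connected = reachable⇒connected G₂ v₃ (λ v → climb 3 v (short v))
  where
  parent : Vertex G₂ → Vertex G₂
  parent = Vec.lookup G₂-parent
  step : ∀ v → v ≡ v₃ ⊎ Adj G₂ v (parent v)
  step = toWitness {a? = Finₚ.all? λ v → (v Fin.≟ v₃) ⊎-dec adj? G₂ v (parent v)} _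
  short : ∀ v → parent (parent (parent v)) ≡ v₃
  short = toWitness {a? = Finₚ.all? λ v → parent (parent (parent v)) Fin.≟ v₃} _
  iterate : ℕ → Vertex G₂ → Vertex G₂
  iterate zero    v = v
  iterate (suc n) v = iterate n (parent v)
  climb : ∀ n v → iterate n v ≡ v₃ → Star (Adj G₂) v v₃
  climb zero    v refl = ε
  climb (suc n) v eq with step v
  ... | inj₁ refl = ε
  ... | inj₂ a    = a ◅ climb n (parent v) eq

F-lineRepresentation : ∀ t (w : Fin t) → LineRepresentation (F t w)
-- `# 1` is the vertex of `H₂` labelled 2, the first endpoint of v₃ = {2,7} and an endpoint of no
-- other edge.
F-lineRepresentation t w = joinComplete-lineRepresentation H₂ v₃ (# 1)
  (toWitness {a? = Finₚ.all? λ a → ((proj₁ (lookup (edges H₂) a) Fin.≟ # 1) ⊎-dec (proj₂ (lookup (edges H₂) a) Fin.≟ # 1)) →-dec (a Fin.≟ v₃)} _)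
  (inj₁ refl) w

40·[t-1]·[t-1]!>0 : ∀ {t} → 4 ≤ t → 0 < 40 * (t ∸ 1) * (t ∸ 1) !
40·[t-1]·[t-1]!>0 (s≤s {n = n} 3≤n) = ℕₚ.*-mono-≤ (ℕₚ.*-mono-≤ {1} {40} (s≤s z≤n) (ℕₚ.≤-trans (s≤s z≤n) 3≤n)) (ℕₚ.1≤n! n)

-pos<0 : ∀ {n} → 0 < n → - + n ℤ.< 0ℤ
-pos<0 {suc n} _ = ℤ.-<+

F-not-schurPositive : ∀ {t} → 4 ≤ t → (w : Fin t) → ¬ SchurPositive (F t w)
F-not-schurPositive {t} 4≤t w (c , h , positive) = ℤₚ.<⇒≱ (-pos<0 (40·[t-1]·[t-1]!>0 4≤t))
  (subst (0ℤ ℤ.≤_) (proj₂ (F-schurCoefficient (t ∸ 4) (ℕₚ.m∸n+n≡m 4≤t) w) c h)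
    (positive _ (target-isPartition (t ∸ 4) (ℕₚ.m∸n+n≡m 4≤t))))

theorem3p4 : (∀ (t : ℕ) → 4 ≤ t → ∀ (w : Fin t) →
    Connected (F t w)
    × IsLineGraph (F t w)
    × SchurCoefficient (F t w) (4 ∷ 4 ∷ 4 ∷ 4 ∷ replicate (t ∸ 4) 1) (- (+ (40 * (t ∸ 1) * (t ∸ 1) !)))
    × - (+ (40 * (t ∸ 1) * (t ∸ 1) !)) ℤ.< 0ℤ)
    × (∀ (t : ℕ) → 4 ≤ t → ∀ (w : Fin t) → ClawFree (F t w) × ¬ SchurPositive (F t w))
    × (∀ (t t′ : ℕ) → 4 ≤ t → 4 ≤ t′ → t ≢ t′ → ∀ (w : Fin t) (w′ : Fin t′) → ¬ (F t w ≅ F t′ w′))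
theorem3p4 =
  (λ t 4≤t w →
    joinComplete-connected G₂ v₃ w G₂-connected ,
    isLineGraph (F-lineRepresentation t w) ,
    F-schurCoefficient (t ∸ 4) (ℕₚ.m∸n+n≡m 4≤t) w ,
    -pos<0 (40·[t-1]·[t-1]!>0 4≤t)) ,
  (λ t 4≤t w → clawFree (F-lineRepresentation t w) , F-not-schurPositive 4≤t w) ,
  -- An isomorphism forces equal orders, here `12 + t` and `12 + t′`.
  (λ t t′ _ _ t≢t′ w w′ (φ , _) → t≢t′ (ℕₚ.+-cancelˡ-≡ 12 t t′ (Permutation.↔⇒≡ φ)))
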